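{- Let $\mathbb S$ be a sort context and let $\mathbb S\vdash\psi_1,\dots,\psi_n\Rrightarrow\psi$ be a derivable (well-formed) sequent of HOL. Write $\Psi=\psi_1,\dots,\psi_n$, let $x_1,\dots,x_n$ be distinct program variables, and put $[\![\Psi]\!]^{T}:=x_1:[\![\psi_1]\!]^{T},\dots,x_n:[\![\psi_n]\!]^{T}$ and $[\![\Psi]\!]^{S}:=[\![\psi_1]\!]^{S}_{x_1},\dots,[\![\psi_n]\!]^{S}_{x_n}$. Then there is a program $p$ of EffHOL with $$[\![\mathbb S]\!]^{K}\mid[\![\Psi]\!]^{T}\vdash p:M([\![\psi]\!]^{T})$$ such that for all kind, index and type contexts $\mathbb K,\mathbb I,\mathbb T$ (with variables disjoint from those above) and every finite collection $\Phi$ of specifications well-formed in $\mathbb K\mid\mathbb I\mid\mathbb T$, the following judgment is derivable in EffHOL: $$[\![\mathbb S]\!]^{K},\mathbb K\mid[\![\mathbb S]\!]^{I},\mathbb I\mid[\![\Psi]\!]^{T},\mathbb T\ \vdash\ [\![\Psi]\!]^{S},\Phi\ \Rightarrow\ \langle x_r\leftarrow p\rangle\,[\![\psi]\!]^{S}_{x_r}.$$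
   Context: All syntax is up to $\alpha$-equivalence; all substitutions are capture-avoiding. **HOL.** Sorts $s::=\bigstar\mid s\rightarrowtail\bigstar$. Terms $t::=u\mid\{u:s\mid\psi\}\mid\{\psi\}$ ($u$ a variable, bound in $\{u:s\mid\psi\}$). Propositions $\psi::=\overline t\mid t\in t\mid\psi\sqsupset\psi\mid\forall_{u:s}.\psi$. A sort context $\mathbb S$ is a list of distinct sorted variables $u:s$. Well-formedness: $\mathbb S\vdash u:s$ if $(u:s)\in\mathbb S$; $\mathbb S\vdash\{u:s\mid\psi\}:s\rightarrowtail\bigstar$ if $\mathbb S,u:s\vdash\psi$; $\mathbb S\vdash\{\psi\}:\bigstar$ if $\mathbb S\vdash\psi$; $\mathbb S\vdash\overline t$ if $\mathbb S\vdash t:\bigstar$; $\mathbb S\vdash t_1\in t_2$ if $\mathbb S\vdash t_1:s$ and $\mathbb S\vdash t_2:s\rightarrowtail\bigstar$; $\mathbb S\vdash\psi_1\sqsupset\psi_2$ if $\mathbb S\vdash\psi_1$ and $\mathbb S\vdash\psi_2$; $\mathbb S\vdash\forall_{u:s}.\psi$ if $\mathbb S,u:s\vdash\psi$. Sequents $\mathbb S\vdash\Psi\Rrightarrow\psi$ ($\Psi$ a finite set of propositions; everything well-formed in $\mathbb S$) are derived by: identity ($\psi\in\Psi$); introduction and elimination of $\sqsupset$ (natural deduction); from $\mathbb S,u:s\vdash\Psi\Rrightarrow\psi$ ($u$ fresh for $\Psi$) infer $\mathbb S\vdash\Psi\Rrightarrow\forall_{u:s}.\psi$; from $\mathbb S\vdash\Psi\Rrightarrow\forall_{u:s}.\psi$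 and $\mathbb S\vdash t:s$ infer $\mathbb S\vdash\Psi\Rrightarrow\psi[u:=t]$; mutual inference between $\mathbb S\vdash\Psi\Rrightarrow\psi[u:=t]$ (with $\mathbb S\vdash t:s$) and $\mathbb S\vdash\Psi\Rrightarrow t\in\{u:s\mid\psi\}$; mutual inference between $\mathbb S\vdash\Psi\Rrightarrow\psi$ and $\mathbb S\vdash\Psi\Rrightarrow\overline{\{\psi\}}$. **EffHOL syntax.** Kinds $\kappa::=\star\mid\kappa\rightarrowtail\star$. Types $\tau::=X\mid\tau\,\tau\mid\bar\Lambda_{X:\kappa}.\tau\mid\tau\to\tau\mid\prod_{X:\kappa}.\tau\mid M(\tau)$. Programs $p::=x\mid\Lambda X{:}\kappa.p\mid p\,\tau\mid\lambda x{:}\tau.p\mid p\,p\mid[p]\mid\mathsf{let}\ x\leftarrow p\ \mathsf{in}\ p$. Indices $\sigma::=R_\tau\mid R_\tau(\sigma)\mid\bigwedge_{X:\kappa}.\sigma$. Expressions $e::=y\mid\{x:\tau;y:\sigma\mid\varphi\}\mid\{x:\tau\mid\varphi\}\mid\mathsf\Lambda_{X:\kappa}.e\mid e\,\tau$. Specifications $\varphi::=(p;e_2\mathrel\varepsilon e_1)\mid(p\mathrel\varepsilon e)\mid\varphi\supset\varphi\mid\langle x\leftarrow p\rangle\varphi\mid\bigcap_{X:\kappa}.\varphi\mid\sqcap_{x:\tau}.\varphi\mid\forall_{y:\sigma}.\varphi$. ($\langle x\leftarrow p\rangle\varphi$ binds $x$ in $\varphi$.) Values $V::=x\mid\Lambda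 X{:}\kappa.p\mid\lambda x{:}\tau.p$. Contexts: kind contexts $\mathbb K$ (declarations $X:\kappa$), index contexts $\mathbb I$ ($y:\sigma$), type contexts $\mathbb T$ ($x:\tau$). **Reduction and conversion.** $\rightsquigarrow$ on programs is given by $\mathsf{let}\ x\leftarrow[p_1]\ \mathsf{in}\ p_2\rightsquigarrow p_2[x:=p_1]$, $(\Lambda X{:}\kappa.p)\,\tau\rightsquigarrow p[X:=\tau]$, $(\lambda x{:}\tau.p)\,V\rightsquigarrow p[x:=V]$. Conversion $\equiv$ is the reflexive, symmetric, transitive, contextual closure, in all syntactic categories, of $(\bar\Lambda_{X:\kappa}.\tau_1)\,\tau_2\equiv\tau_1[X:=\tau_2]$ and $(\mathsf\Lambda_{X:\kappa}.e)\,\tau\equiv e[X:=\tau]$. **Typing.** Types, $\mathbb K\vdash\tau:\kappa$: variables from $\mathbb K$; $\bar\Lambda_{X:\kappa}.\tau:\kappa\rightarrowtail\star$ if $\mathbb K,X:\kappa\vdash\tau:\star$; $\tau_1\,\tau_2:\star$ if $\tau_1:\kappa\rightarrowtail\star$ and $\tau_2:\kappa$; $\tau_1\to\tau_2:\star$ and $M(\tau_1):\star$ if $\tau_1,\tau_2:\star$; $\prod_{X:\kappa}.\tau:\star$ if $\mathbb K,X:\kappa\vdash\tau:\star$. Programs, $\mathbb K\mid\mathbb T\vdash p:\tau$: the usual System $F_\omega$ rules for variables, $\lambda$, application, $\Lambda X{:}\kappa.p:\prod_{X:\kappa}.\tau$ and $p\,\tau':\tau[X:=\tau']$; $[p]:M(\tau)$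 if $p:\tau$; $\mathsf{let}\ x\leftarrow p_1\ \mathsf{in}\ p_2:M(\tau_2)$ if $p_1:M(\tau_1)$ and $p_2:M(\tau_2)$ in the context extended by $x:\tau_1$; closure under conversion of well-kinded types. Indices are well-formed if all constituent types have kind $\star$. Expressions, $\mathbb K\mid\mathbb I\mid\mathbb T\vdash e:\sigma$: variables from $\mathbb I$; $\{x:\tau;y:\sigma\mid\varphi\}:R_\tau(\sigma)$ if $\varphi$ is well-formed in the context extended by $x:\tau$, $y:\sigma$; $\{x:\tau\mid\varphi\}:R_\tau$ if $\varphi$ is well-formed in the context extended by $x:\tau$; $\mathsf\Lambda_{X:\kappa}.e:\bigwedge_{X:\kappa}.\sigma$ if $e:\sigma$ in the context extended by $X:\kappa$; $e\,\tau:\sigma[X:=\tau]$ if $e:\bigwedge_{X:\kappa}.\sigma$ and $\tau:\kappa$; closure under conversion of well-formed indices. Specifications, $\mathbb K\mid\mathbb I\mid\mathbb T\vdash\varphi$: $p;e_2\mathrel\varepsilon e_1$ if $p:\tau$, $e_1:R_\tau(\sigma)$, $e_2:\sigma$; $p\mathrel\varepsilon e$ if $p:\tau$, $e:R_\tau$; $\varphi_1\supset\varphi_2$ if both are well-formed; $\langle x\leftarrow p\rangle\varphi$ if $p:M(\tau)$ and $\varphi$ is well-formed with $x:\tau$ added; the quantified specifications if the body is well-formed in the extended context. **Theory of EffHOL.** Judgments $\mathbb K\mid\mathbb I\mid\mathbb T\vdash\Phi\Rightarrow\varphi$ ($\Phi$ a finite set of specifications, everything well-typed) are derived by: identity; introduction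 and elimination for $\supset$; introduction for $\sqcap_{x:\tau}$, $\forall_{y:\sigma}$, $\bigcap_{X:\kappa}$ with a fresh variable; elimination $\sqcap_{x:\tau}.\varphi\leadsto\varphi[x:=V]$ ($V:\tau$ a value), $\forall_{y:\sigma}.\varphi\leadsto\varphi[y:=e]$ ($e:\sigma$), $\bigcap_{X:\kappa}.\varphi\leadsto\varphi[X:=\tau]$ ($\tau:\kappa$); (Mod-I) from $\Phi\Rightarrow\varphi[x:=p]$ infer $\Phi\Rightarrow\langle x\leftarrow[p]\rangle\varphi$; (Mod-E) from $\Phi\Rightarrow\langle x_1\leftarrow p_1\rangle\langle x_2\leftarrow p_2\rangle\varphi$, with $x_1$ not free in $\varphi$, infer $\Phi\Rightarrow\langle x_2\leftarrow(\mathsf{let}\ x_1\leftarrow p_1\ \mathsf{in}\ p_2)\rangle\varphi$; (Mon) from $\Phi,\varphi_1\Rightarrow\varphi_2$ in the context extended by fresh $x:\tau$ and $\Phi\Rightarrow\langle x\leftarrow p\rangle\varphi_1$ infer $\Phi\Rightarrow\langle x\leftarrow p\rangle\varphi_2$; (Mem) mutual inference between $\Phi\Rightarrow\varphi[x:=p][y:=e]$ and $\Phi\Rightarrow(p;e\mathrel\varepsilon\{x:\tau;y:\sigma\mid\varphi\})$; (Mem$_0$) mutual inference between $\Phi\Rightarrow\varphi[x:=p]$ and $\Phi\Rightarrow(p\mathrel\varepsilon\{x:\tau\mid\varphi\})$; ($\equiv$) from $\Phi\Rightarrow\varphi_1$ and $\varphi_1\equiv\varphi_2$ infer $\Phi\Rightarrow\varphi_2$;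 ($\rightsquigarrow$) from $\Phi\Rightarrow\varphi[x:=p_2]$ and $p_1\rightsquigarrow p_2$ infer $\Phi\Rightarrow\varphi[x:=p_1]$. **Realizability translation.** To each HOL variable $u$ associate a type variable $X_u$ and an expression variable $y_u$. Sorts to kinds: $[\![\bigstar]\!]^K=\star$, $[\![s\rightarrowtail\bigstar]\!]^K=[\![s]\!]^K\rightarrowtail\star$. Sorts to indices: $[\![\bigstar]\!]^I_\tau=R_\tau$, $[\![s\rightarrowtail\bigstar]\!]^I_\tau=\bigwedge_{X_0:[\![s]\!]^K}.R_{\tau X_0}([\![s]\!]^I_{X_0})$. Terms to types: $[\![u]\!]^{\mathrm t}=X_u$, $[\![\{u:s\mid\psi\}]\!]^{\mathrm t}=\bar\Lambda_{X_u:[\![s]\!]^K}.[\![\psi]\!]^T$, $[\![\{\psi\}]\!]^{\mathrm t}=[\![\psi]\!]^T$. Terms to expressions: $[\![u]\!]^{\mathrm e}=y_u$, $[\![\{u:s\mid\psi\}]\!]^{\mathrm e}=\mathsf\Lambda_{X_u:[\![s]\!]^K}.\{x:[\![\psi]\!]^T;y_u:[\![s]\!]^I_{X_u}\mid[\![\psi]\!]^S_x\}$, $[\![\{\psi\}]\!]^{\mathrm e}=\{x:[\![\psi]\!]^T\mid[\![\psi]\!]^S_x\}$. Propositions to types: $[\![\psi_1\sqsupset\psi_2]\!]^T=[\![\psi_1]\!]^T\to M([\![\psi_2]\!]^T)$, $[\![\forall_{u:s}.\psi]\!]^T=\prod_{X_u:[\![s]\!]^K}.M([\![\psi]\!]^T)$,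 $[\![t_1\in t_2]\!]^T=[\![t_2]\!]^{\mathrm t}\,[\![t_1]\!]^{\mathrm t}$, $[\![\overline t]\!]^T=[\![t]\!]^{\mathrm t}$. Propositions to specifications (for a program $p$): $[\![\psi_1\sqsupset\psi_2]\!]^S_p=\sqcap_{x_1:[\![\psi_1]\!]^T}.([\![\psi_1]\!]^S_{x_1}\supset\langle x_2\leftarrow p\,x_1\rangle[\![\psi_2]\!]^S_{x_2})$, $[\![\forall_{u:s}.\psi]\!]^S_p=\bigcap_{X_u:[\![s]\!]^K}.\forall_{y_u:[\![s]\!]^I_{X_u}}.\langle x_0\leftarrow p\,X_u\rangle[\![\psi]\!]^S_{x_0}$, $[\![t_1\in t_2]\!]^S_p=(p;[\![t_1]\!]^{\mathrm e}\mathrel\varepsilon[\![t_2]\!]^{\mathrm e}\,[\![t_1]\!]^{\mathrm t})$, $[\![\overline t]\!]^S_p=(p\mathrel\varepsilon[\![t]\!]^{\mathrm e})$. Contexts: $[\![\emptyset]\!]^K=[\![\emptyset]\!]^I=\emptyset$, $[\![\mathbb S,u:s]\!]^K=[\![\mathbb S]\!]^K,X_u:[\![s]\!]^K$, $[\![\mathbb S,u:s]\!]^I=[\![\mathbb S]\!]^I,y_u:[\![s]\!]^I_{X_u}$. -}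

module Defs where

open import Data.Fin.Base using (Fin; zero; suc; lift; _↑ˡ_; _↑ʳ_)
open import Data.List.Base as List using (List)
open import Data.List.Membership.Propositional using () renaming (_∈_ to _∈ˡ_)
open import Data.List.Relation.Unary.All using () renaming (All to Allˡ)
open import Data.Nat.Base using (ℕ; suc; _+_)
open import Data.Product.Base using (_×_)
open import Data.Vec.Base using (Vec; []; _∷_; _++_; map; lookup; tabulate; toList)
open import Data.Vec.Functional using () renaming (_∷_ to _∷ᶠ_)
open import Data.Vec.Membership.Propositional using (_∈_)
open import Data.Vec.Relation.Unary.All using (All)
open import Function.Base using (_∘_; id)
open import Relation.Binary.PropositionalEquality.Core using (_≡_)

-- Syntax is well-scoped de Bruijn: an index bounds the number of free variables
-- of each class, binders bind variable `zero`, and contexts are vectors whose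
-- head declares variable `zero`.  Freshness of a variable for an expression
-- becomes weakening of that expression along `suc`.

private
  variable
    m m′ n : ℕ
    k k′ i i′ t t′ : ℕ

data Sort : Set where
  ★   : Sort
  _↣★ : Sort → Sort

mutual
  data Tm (m : ℕ) : Set where
    var   : Fin m → Tm m
    ⁅_∣_⁆ : Sort → Form (suc m) → Tm m     -- {u : s ∣ ψ}
    ⁅_⁆   : Form m → Tm m                  -- {ψ}

  data Form (m : ℕ) : Set where
    ⌜_⌝  : Tm m → Form m                   -- t̄
    _∈′_ : Tm m → Tm m → Form m
    _⊐_  : Form m → Form m → Form m
    all  : Sort → Form (suc m) → Form m

infix  7 _∈′_
infixr 6 _⊐_

mutual
  renTm : (Fin m → Fin m′) → Tm m → Tm m′
  renTm ρ (var u)     = var (ρ u)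
  renTm ρ ⁅ s ∣ ψ ⁆   = ⁅ s ∣ renForm (lift 1 ρ) ψ ⁆
  renTm ρ ⁅ ψ ⁆       = ⁅ renForm ρ ψ ⁆

  renForm : (Fin m → Fin m′) → Form m → Form m′
  renForm ρ ⌜ t ⌝       = ⌜ renTm ρ t ⌝
  renForm ρ (t₁ ∈′ t₂)  = renTm ρ t₁ ∈′ renTm ρ t₂
  renForm ρ (ψ₁ ⊐ ψ₂)   = renForm ρ ψ₁ ⊐ renForm ρ ψ₂
  renForm ρ (all s ψ)   = all s (renForm (lift 1 ρ) ψ)

liftTm : (Fin m → Tm m′) → Fin (suc m) → Tm (suc m′)
liftTm θ = var zero ∷ᶠ (renTm suc ∘ θ)

mutual
  subTm : (Fin m → Tm m′) → Tm m → Tm m′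
  subTm θ (var u)     = θ u
  subTm θ ⁅ s ∣ ψ ⁆   = ⁅ s ∣ subForm (liftTm θ) ψ ⁆
  subTm θ ⁅ ψ ⁆       = ⁅ subForm θ ψ ⁆

  subForm : (Fin m → Tm m′) → Form m → Form m′
  subForm θ ⌜ t ⌝       = ⌜ subTm θ t ⌝
  subForm θ (t₁ ∈′ t₂)  = subTm θ t₁ ∈′ subTm θ t₂
  subForm θ (ψ₁ ⊐ ψ₂)   = subForm θ ψ₁ ⊐ subForm θ ψ₂
  subForm θ (all s ψ)   = all s (subForm (liftTm θ) ψ)

_[_]ᵘ : Form (suc m) → Tm m → Form m
ψ [ t ]ᵘ = subForm (t ∷ᶠ var) ψ

infix 4 _⊢_⦂_ _⊢_wff

mutual
  data _⊢_⦂_ (S : Vec Sort m) : Tm m → Sort → Set where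
    var : ∀ {u s} → lookup S u ≡ s → S ⊢ var u ⦂ s
    cmp : ∀ {s ψ} → s ∷ S ⊢ ψ wff → S ⊢ ⁅ s ∣ ψ ⁆ ⦂ s ↣★
    cmp₀ : ∀ {ψ} → S ⊢ ψ wff → S ⊢ ⁅ ψ ⁆ ⦂ ★

  data _⊢_wff (S : Vec Sort m) : Form m → Set where
    ⌜⌝  : ∀ {t} → S ⊢ t ⦂ ★ → S ⊢ ⌜ t ⌝ wff
    mem : ∀ {t₁ t₂ s} → S ⊢ t₁ ⦂ s → S ⊢ t₂ ⦂ s ↣★ → S ⊢ t₁ ∈′ t₂ wff
    imp : ∀ {ψ₁ ψ₂} → S ⊢ ψ₁ wff → S ⊢ ψ₂ wff → S ⊢ ψ₁ ⊐ ψ₂ wff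
    all : ∀ {s ψ} → s ∷ S ⊢ ψ wff → S ⊢ all s ψ wff

infix 4 _⊢_⇛_ _⊢_⇛ʳ_

-- A sequent S ⊢ Ψ ⇛ ψ is derivable if it is well-formed and is the conclusion
-- of a rule (_⊢_⇛ʳ_) all of whose premises are derivable.
mutual
  data _⊢_⇛_ (S : Vec Sort m) (Ψ : Vec (Form m) n) (ψ : Form m) : Set where
    derive : All (S ⊢_wff) Ψ → S ⊢ ψ wff → S ⊢ Ψ ⇛ʳ ψ → S ⊢ Ψ ⇛ ψ

  data _⊢_⇛ʳ_ (S : Vec Sort m) (Ψ : Vec (Form m) n) : Form m → Set where
    ident : ∀ {ψ} → ψ ∈ Ψ → S ⊢ Ψ ⇛ʳ ψ
    ⊐-I : ∀ {ψ₁ ψ₂} → S ⊢ ψ₁ ∷ Ψ ⇛ ψ₂ → S ⊢ Ψ ⇛ʳ ψ₁ ⊐ ψ₂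
    ⊐-E : ∀ {ψ₁ ψ₂} → S ⊢ Ψ ⇛ ψ₁ ⊐ ψ₂ → S ⊢ Ψ ⇛ ψ₁ → S ⊢ Ψ ⇛ʳ ψ₂
    all-I : ∀ {s ψ} → s ∷ S ⊢ map (renForm suc) Ψ ⇛ ψ → S ⊢ Ψ ⇛ʳ all s ψ
    all-E : ∀ {s ψ u} → S ⊢ Ψ ⇛ all s ψ → S ⊢ u ⦂ s → S ⊢ Ψ ⇛ʳ ψ [ u ]ᵘ
    ∈-I : ∀ {s ψ u} → S ⊢ u ⦂ s → S ⊢ Ψ ⇛ ψ [ u ]ᵘ → S ⊢ Ψ ⇛ʳ u ∈′ ⁅ s ∣ ψ ⁆
    ∈-E : ∀ {s ψ u} → S ⊢ u ⦂ s → S ⊢ Ψ ⇛ u ∈′ ⁅ s ∣ ψ ⁆ → S ⊢ Ψ ⇛ʳ ψ [ u ]ᵘ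
    ⌜⌝-I : ∀ {ψ} → S ⊢ Ψ ⇛ ψ → S ⊢ Ψ ⇛ʳ ⌜ ⁅ ψ ⁆ ⌝
    ⌜⌝-E : ∀ {ψ} → S ⊢ Ψ ⇛ ⌜ ⁅ ψ ⁆ ⌝ → S ⊢ Ψ ⇛ʳ ψ

-- Throughout, k, i and t count type variables X, expression variables y and
-- program variables x, respectively.

data Kind : Set where
  ⋆   : Kind
  _↣⋆ : Kind → Kind

data Ty (k : ℕ) : Set where
  tvar : Fin k → Ty k
  _·ᵗ_ : Ty k → Ty k → Ty k
  Λ̄    : Kind → Ty (suc k) → Ty k
  _⇒_  : Ty k → Ty k → Ty k
  Π    : Kind → Ty (suc k) → Ty k
  M    : Ty k → Ty k

data Prog (k t : ℕ) : Set where
  pvar : Fin t → Prog k t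
  Λᵖ   : Kind → Prog (suc k) t → Prog k t
  _∙_  : Prog k t → Ty k → Prog k t
  ƛ    : Ty k → Prog k (suc t) → Prog k t
  _·_  : Prog k t → Prog k t → Prog k t
  [_]  : Prog k t → Prog k t
  let′ : Prog k t → Prog k (suc t) → Prog k t     -- let x ← p₁ in p₂

data Idx (k : ℕ) : Set where
  R₀ : Ty k → Idx k                               -- R_τ
  R  : Ty k → Idx k → Idx k                       -- R_τ(σ)
  ⋀  : Kind → Idx (suc k) → Idx k

mutual
  data Exp (k i t : ℕ) : Set where
    evar   : Fin i → Exp k i t
    cmp    : Ty k → Idx k → Spec k (suc i) (suc t) → Exp k i t   -- {x : τ; y : σ ∣ φ}
    cmp₀   : Ty k → Spec k i (suc t) → Exp k i t                 -- {x : τ ∣ φ}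
    Λᵉ     : Kind → Exp (suc k) i t → Exp k i t
    _∙_    : Exp k i t → Ty k → Exp k i t

  data Spec (k i t : ℕ) : Set where
    _⨾_ε_  : Prog k t → Exp k i t → Exp k i t → Spec k i t       -- (p; e₂ ε e₁)
    _ε_    : Prog k t → Exp k i t → Spec k i t
    _⊃_    : Spec k i t → Spec k i t → Spec k i t
    ⟨_⟩_   : Prog k t → Spec k i (suc t) → Spec k i t            -- ⟨x ← p⟩ φ
    ⋂      : Kind → Spec (suc k) i t → Spec k i t                -- over X : κ
    ⊓      : Ty k → Spec k i (suc t) → Spec k i t                -- over x : τ
    ∀′     : Idx k → Spec k (suc i) t → Spec k i t               -- over y : σ

infixl 9 _·ᵗ_ _∙_ _·_
infixr 8 _⇒_
infix  7 _⨾_ε_ _ε_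
infixr 5 _⊃_
infixr 6 ⟨_⟩_

data Value {k t : ℕ} : Prog k t → Set where
  pvar : ∀ {x} → Value (pvar x)
  Λᵖ   : ∀ {κ p} → Value (Λᵖ κ p)
  ƛ    : ∀ {τ p} → Value (ƛ τ p)

renTy : (Fin k → Fin k′) → Ty k → Ty k′
renTy ρ (tvar X)   = tvar (ρ X)
renTy ρ (τ₁ ·ᵗ τ₂) = renTy ρ τ₁ ·ᵗ renTy ρ τ₂
renTy ρ (Λ̄ κ τ)    = Λ̄ κ (renTy (lift 1 ρ) τ)
renTy ρ (τ₁ ⇒ τ₂)  = renTy ρ τ₁ ⇒ renTy ρ τ₂
renTy ρ (Π κ τ)    = Π κ (renTy (lift 1 ρ) τ)
renTy ρ (M τ)      = M (renTy ρ τ)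

renProg : (Fin k → Fin k′) → (Fin t → Fin t′) → Prog k t → Prog k′ t′
renProg ρ ξ (pvar x)     = pvar (ξ x)
renProg ρ ξ (Λᵖ κ p)     = Λᵖ κ (renProg (lift 1 ρ) ξ p)
renProg ρ ξ (p ∙ τ)      = renProg ρ ξ p ∙ renTy ρ τ
renProg ρ ξ (ƛ τ p)      = ƛ (renTy ρ τ) (renProg ρ (lift 1 ξ) p)
renProg ρ ξ (p₁ · p₂)    = renProg ρ ξ p₁ · renProg ρ ξ p₂
renProg ρ ξ [ p ]        = [ renProg ρ ξ p ]
renProg ρ ξ (let′ p₁ p₂) = let′ (renProg ρ ξ p₁) (renProg ρ (lift 1 ξ) p₂)

renIdx : (Fin k → Fin k′) → Idx k → Idx k′
renIdx ρ (R₀ τ)  = R₀ (renTy ρ τ)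
renIdx ρ (R τ σ) = R (renTy ρ τ) (renIdx ρ σ)
renIdx ρ (⋀ κ σ) = ⋀ κ (renIdx (lift 1 ρ) σ)

mutual
  renExp : (Fin k → Fin k′) → (Fin i → Fin i′) → (Fin t → Fin t′) →
           Exp k i t → Exp k′ i′ t′
  renExp ρ ζ ξ (evar y)    = evar (ζ y)
  renExp ρ ζ ξ (cmp τ σ φ) = cmp (renTy ρ τ) (renIdx ρ σ) (renSpec ρ (lift 1 ζ) (lift 1 ξ) φ)
  renExp ρ ζ ξ (cmp₀ τ φ)  = cmp₀ (renTy ρ τ) (renSpec ρ ζ (lift 1 ξ) φ)
  renExp ρ ζ ξ (Λᵉ κ e)    = Λᵉ κ (renExp (lift 1 ρ) ζ ξ e)
  renExp ρ ζ ξ (e ∙ τ)     = renExp ρ ζ ξ e ∙ renTy ρ τ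

  renSpec : (Fin k → Fin k′) → (Fin i → Fin i′) → (Fin t → Fin t′) →
            Spec k i t → Spec k′ i′ t′
  renSpec ρ ζ ξ (p ⨾ e₂ ε e₁) = renProg ρ ξ p ⨾ renExp ρ ζ ξ e₂ ε renExp ρ ζ ξ e₁
  renSpec ρ ζ ξ (p ε e)       = renProg ρ ξ p ε renExp ρ ζ ξ e
  renSpec ρ ζ ξ (φ₁ ⊃ φ₂)     = renSpec ρ ζ ξ φ₁ ⊃ renSpec ρ ζ ξ φ₂
  renSpec ρ ζ ξ (⟨ p ⟩ φ)     = ⟨ renProg ρ ξ p ⟩ renSpec ρ ζ (lift 1 ξ) φ
  renSpec ρ ζ ξ (⋂ κ φ)       = ⋂ κ (renSpec (lift 1 ρ) ζ ξ φ)
  renSpec ρ ζ ξ (⊓ τ φ)       = ⊓ (renTy ρ τ) (renSpec ρ ζ (lift 1 ξ) φ)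
  renSpec ρ ζ ξ (∀′ σ φ)      = ∀′ (renIdx ρ σ) (renSpec ρ (lift 1 ζ) ξ φ)

liftTy : (Fin k → Ty k′) → Fin (suc k) → Ty (suc k′)
liftTy α = tvar zero ∷ᶠ (renTy suc ∘ α)

liftProg : (Fin t → Prog k t′) → Fin (suc t) → Prog k (suc t′)
liftProg γ = pvar zero ∷ᶠ (renProg id suc ∘ γ)

liftExp : (Fin i → Exp k i′ t) → Fin (suc i) → Exp k (suc i′) t
liftExp β = evar zero ∷ᶠ (renExp id suc id ∘ β)

subTy : (Fin k → Ty k′) → Ty k → Ty k′
subTy α (tvar X)   = α X
subTy α (τ₁ ·ᵗ τ₂) = subTy α τ₁ ·ᵗ subTy α τ₂
subTy α (Λ̄ κ τ)    = Λ̄ κ (subTy (liftTy α) τ)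
subTy α (τ₁ ⇒ τ₂)  = subTy α τ₁ ⇒ subTy α τ₂
subTy α (Π κ τ)    = Π κ (subTy (liftTy α) τ)
subTy α (M τ)      = M (subTy α τ)

subProg : (Fin k → Ty k′) → (Fin t → Prog k′ t′) → Prog k t → Prog k′ t′
subProg α γ (pvar x)     = γ x
subProg α γ (Λᵖ κ p)     = Λᵖ κ (subProg (liftTy α) (renProg suc id ∘ γ) p)
subProg α γ (p ∙ τ)      = subProg α γ p ∙ subTy α τ
subProg α γ (ƛ τ p)      = ƛ (subTy α τ) (subProg α (liftProg γ) p)
subProg α γ (p₁ · p₂)    = subProg α γ p₁ · subProg α γ p₂
subProg α γ [ p ]        = [ subProg α γ p ]
subProg α γ (let′ p₁ p₂) = let′ (subProg α γ p₁) (subProg α (liftProg γ) p₂)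

subIdx : (Fin k → Ty k′) → Idx k → Idx k′
subIdx α (R₀ τ)  = R₀ (subTy α τ)
subIdx α (R τ σ) = R (subTy α τ) (subIdx α σ)
subIdx α (⋀ κ σ) = ⋀ κ (subIdx (liftTy α) σ)

mutual
  subExp : (Fin k → Ty k′) → (Fin i → Exp k′ i′ t′) → (Fin t → Prog k′ t′) →
           Exp k i t → Exp k′ i′ t′
  subExp α β γ (evar y)    = β y
  subExp α β γ (cmp τ σ φ) =
    cmp (subTy α τ) (subIdx α σ)
        (subSpec α (liftExp (renExp id id suc ∘ β)) (liftProg γ) φ)
  subExp α β γ (cmp₀ τ φ)  =
    cmp₀ (subTy α τ) (subSpec α (renExp id id suc ∘ β) (liftProg γ) φ)
  subExp α β γ (Λᵉ κ e)    =
    Λᵉ κ (subExp (liftTy α) (renExp suc id id ∘ β) (renProg suc id ∘ γ) e)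
  subExp α β γ (e ∙ τ)     = subExp α β γ e ∙ subTy α τ

  subSpec : (Fin k → Ty k′) → (Fin i → Exp k′ i′ t′) → (Fin t → Prog k′ t′) →
            Spec k i t → Spec k′ i′ t′
  subSpec α β γ (p ⨾ e₂ ε e₁) = subProg α γ p ⨾ subExp α β γ e₂ ε subExp α β γ e₁
  subSpec α β γ (p ε e)       = subProg α γ p ε subExp α β γ e
  subSpec α β γ (φ₁ ⊃ φ₂)     = subSpec α β γ φ₁ ⊃ subSpec α β γ φ₂
  subSpec α β γ (⟨ p ⟩ φ)     =
    ⟨ subProg α γ p ⟩ subSpec α (renExp id id suc ∘ β) (liftProg γ) φ
  subSpec α β γ (⋂ κ φ)       =
    ⋂ κ (subSpec (liftTy α) (renExp suc id id ∘ β) (renProg suc id ∘ γ) φ)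
  subSpec α β γ (⊓ τ φ)       =
    ⊓ (subTy α τ) (subSpec α (renExp id id suc ∘ β) (liftProg γ) φ)
  subSpec α β γ (∀′ σ φ)      = ∀′ (subIdx α σ) (subSpec α (liftExp β) γ φ)

infixl 10 _[_]ᵗ _[_]ⁱ _[_]ᵖˣ _[_]ᵖᵗ _[_]ᵉᵗ _[_]ˣ _[_]ʸ _[_]ˢᵗ

_[_]ᵗ : Ty (suc k) → Ty k → Ty k
τ [ τ′ ]ᵗ = subTy (τ′ ∷ᶠ tvar) τ

_[_]ⁱ : Idx (suc k) → Ty k → Idx k
σ [ τ ]ⁱ = subIdx (τ ∷ᶠ tvar) σ

_[_]ᵖˣ : Prog k (suc t) → Prog k t → Prog k t
p [ q ]ᵖˣ = subProg tvar (q ∷ᶠ pvar) p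

_[_]ᵖᵗ : Prog (suc k) t → Ty k → Prog k t
p [ τ ]ᵖᵗ = subProg (τ ∷ᶠ tvar) pvar p

_[_]ᵉᵗ : Exp (suc k) i t → Ty k → Exp k i t
e [ τ ]ᵉᵗ = subExp (τ ∷ᶠ tvar) evar pvar e

_[_]ˣ : Spec k i (suc t) → Prog k t → Spec k i t
φ [ p ]ˣ = subSpec tvar evar (p ∷ᶠ pvar) φ

_[_]ʸ : Spec k (suc i) t → Exp k i t → Spec k i t
φ [ e ]ʸ = subSpec tvar (e ∷ᶠ evar) pvar φ

_[_]ˢᵗ : Spec (suc k) i t → Ty k → Spec k i t
φ [ τ ]ˢᵗ = subSpec (τ ∷ᶠ tvar) evar pvar φ

infix 4 _⇝_ _≡ᵗ_ _≡ᵖ_ _≡ⁱ_ _≡ᵉ_ _≡ˢ_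

data _⇝_ {k t : ℕ} : Prog k t → Prog k t → Set where
  let-β : ∀ {p₁ p₂} → let′ [ p₁ ] p₂ ⇝ p₂ [ p₁ ]ᵖˣ
  Λ-β   : ∀ {κ p τ} → Λᵖ κ p ∙ τ ⇝ p [ τ ]ᵖᵗ
  ƛ-β   : ∀ {τ p V} → Value V → ƛ τ p · V ⇝ p [ V ]ᵖˣ

data _≡ᵗ_ {k : ℕ} : Ty k → Ty k → Set where
  β     : ∀ {κ τ₁ τ₂} → Λ̄ κ τ₁ ·ᵗ τ₂ ≡ᵗ τ₁ [ τ₂ ]ᵗ
  refl  : ∀ {τ} → τ ≡ᵗ τ
  sym   : ∀ {τ τ′} → τ ≡ᵗ τ′ → τ′ ≡ᵗ τ
  trans : ∀ {τ τ′ τ″} → τ ≡ᵗ τ′ → τ′ ≡ᵗ τ″ → τ ≡ᵗ τ″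
  _·ᵗ_  : ∀ {τ₁ τ₁′ τ₂ τ₂′} → τ₁ ≡ᵗ τ₁′ → τ₂ ≡ᵗ τ₂′ → τ₁ ·ᵗ τ₂ ≡ᵗ τ₁′ ·ᵗ τ₂′
  Λ̄     : ∀ {κ τ τ′} → τ ≡ᵗ τ′ → Λ̄ κ τ ≡ᵗ Λ̄ κ τ′
  _⇒_   : ∀ {τ₁ τ₁′ τ₂ τ₂′} → τ₁ ≡ᵗ τ₁′ → τ₂ ≡ᵗ τ₂′ → τ₁ ⇒ τ₂ ≡ᵗ τ₁′ ⇒ τ₂′
  Π     : ∀ {κ τ τ′} → τ ≡ᵗ τ′ → Π κ τ ≡ᵗ Π κ τ′
  M     : ∀ {τ τ′} → τ ≡ᵗ τ′ → M τ ≡ᵗ M τ′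

data _≡ᵖ_ {k t : ℕ} : Prog k t → Prog k t → Set where
  refl  : ∀ {p} → p ≡ᵖ p
  sym   : ∀ {p p′} → p ≡ᵖ p′ → p′ ≡ᵖ p
  trans : ∀ {p p′ p″} → p ≡ᵖ p′ → p′ ≡ᵖ p″ → p ≡ᵖ p″
  Λᵖ    : ∀ {κ p p′} → p ≡ᵖ p′ → Λᵖ κ p ≡ᵖ Λᵖ κ p′
  _∙_   : ∀ {p p′ τ τ′} → p ≡ᵖ p′ → τ ≡ᵗ τ′ → p ∙ τ ≡ᵖ p′ ∙ τ′
  ƛ     : ∀ {τ τ′ p p′} → τ ≡ᵗ τ′ → p ≡ᵖ p′ → ƛ τ p ≡ᵖ ƛ τ′ p′
  _·_   : ∀ {p₁ p₁′ p₂ p₂′} → p₁ ≡ᵖ p₁′ → p₂ ≡ᵖ p₂′ → p₁ · p₂ ≡ᵖ p₁′ · p₂′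
  [_]   : ∀ {p p′} → p ≡ᵖ p′ → [ p ] ≡ᵖ [ p′ ]
  let′  : ∀ {p₁ p₁′ p₂ p₂′} → p₁ ≡ᵖ p₁′ → p₂ ≡ᵖ p₂′ → let′ p₁ p₂ ≡ᵖ let′ p₁′ p₂′

data _≡ⁱ_ {k : ℕ} : Idx k → Idx k → Set where
  refl  : ∀ {σ} → σ ≡ⁱ σ
  sym   : ∀ {σ σ′} → σ ≡ⁱ σ′ → σ′ ≡ⁱ σ
  trans : ∀ {σ σ′ σ″} → σ ≡ⁱ σ′ → σ′ ≡ⁱ σ″ → σ ≡ⁱ σ″
  R₀    : ∀ {τ τ′} → τ ≡ᵗ τ′ → R₀ τ ≡ⁱ R₀ τ′
  R     : ∀ {τ τ′ σ σ′} → τ ≡ᵗ τ′ → σ ≡ⁱ σ′ → R τ σ ≡ⁱ R τ′ σ′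
  ⋀     : ∀ {κ σ σ′} → σ ≡ⁱ σ′ → ⋀ κ σ ≡ⁱ ⋀ κ σ′

mutual
  data _≡ᵉ_ {k i t : ℕ} : Exp k i t → Exp k i t → Set where
    β     : ∀ {κ e τ} → Λᵉ κ e ∙ τ ≡ᵉ e [ τ ]ᵉᵗ
    refl  : ∀ {e} → e ≡ᵉ e
    sym   : ∀ {e e′} → e ≡ᵉ e′ → e′ ≡ᵉ e
    trans : ∀ {e e′ e″} → e ≡ᵉ e′ → e′ ≡ᵉ e″ → e ≡ᵉ e″
    cmp   : ∀ {τ τ′ σ σ′ φ φ′} → τ ≡ᵗ τ′ → σ ≡ⁱ σ′ → φ ≡ˢ φ′ → cmp τ σ φ ≡ᵉ cmp τ′ σ′ φ′
    cmp₀  : ∀ {τ τ′ φ φ′} → τ ≡ᵗ τ′ → φ ≡ˢ φ′ → cmp₀ τ φ ≡ᵉ cmp₀ τ′ φ′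
    Λᵉ    : ∀ {κ e e′} → e ≡ᵉ e′ → Λᵉ κ e ≡ᵉ Λᵉ κ e′
    _∙_   : ∀ {e e′ τ τ′} → e ≡ᵉ e′ → τ ≡ᵗ τ′ → e ∙ τ ≡ᵉ e′ ∙ τ′

  data _≡ˢ_ {k i t : ℕ} : Spec k i t → Spec k i t → Set where
    refl  : ∀ {φ} → φ ≡ˢ φ
    sym   : ∀ {φ φ′} → φ ≡ˢ φ′ → φ′ ≡ˢ φ
    trans : ∀ {φ φ′ φ″} → φ ≡ˢ φ′ → φ′ ≡ˢ φ″ → φ ≡ˢ φ″
    _⨾_ε_ : ∀ {p p′ e₁ e₁′ e₂ e₂′} →
            p ≡ᵖ p′ → e₂ ≡ᵉ e₂′ → e₁ ≡ᵉ e₁′ → p ⨾ e₂ ε e₁ ≡ˢ p′ ⨾ e₂′ ε e₁′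
    _ε_   : ∀ {p p′ e e′} → p ≡ᵖ p′ → e ≡ᵉ e′ → p ε e ≡ˢ p′ ε e′
    _⊃_   : ∀ {φ₁ φ₁′ φ₂ φ₂′} → φ₁ ≡ˢ φ₁′ → φ₂ ≡ˢ φ₂′ → φ₁ ⊃ φ₂ ≡ˢ φ₁′ ⊃ φ₂′
    ⟨_⟩_  : ∀ {p p′ φ φ′} → p ≡ᵖ p′ → φ ≡ˢ φ′ → ⟨ p ⟩ φ ≡ˢ ⟨ p′ ⟩ φ′
    ⋂     : ∀ {κ φ φ′} → φ ≡ˢ φ′ → ⋂ κ φ ≡ˢ ⋂ κ φ′
    ⊓     : ∀ {τ τ′ φ φ′} → τ ≡ᵗ τ′ → φ ≡ˢ φ′ → ⊓ τ φ ≡ˢ ⊓ τ′ φ′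
    ∀′    : ∀ {σ σ′ φ φ′} → σ ≡ⁱ σ′ → φ ≡ˢ φ′ → ∀′ σ φ ≡ˢ ∀′ σ′ φ′

-- Rules whose binder carries a type or index require it to be well-formed, so
-- that extending a well-formed context yields a well-formed context.

infix 4 _⊢_∶ᵏ_ _∣_⊢_∶_ _⊢_idx _∣_∣_⊢_∶_ _∣_∣_⊢_spec _⊢_∣_ctx

data _⊢_∶ᵏ_ {k : ℕ} (K : Vec Kind k) : Ty k → Kind → Set where
  tvar : ∀ {X κ} → lookup K X ≡ κ → K ⊢ tvar X ∶ᵏ κ
  _·ᵗ_ : ∀ {κ τ₁ τ₂} → K ⊢ τ₁ ∶ᵏ κ ↣⋆ → K ⊢ τ₂ ∶ᵏ κ → K ⊢ τ₁ ·ᵗ τ₂ ∶ᵏ ⋆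
  Λ̄    : ∀ {κ τ} → κ ∷ K ⊢ τ ∶ᵏ ⋆ → K ⊢ Λ̄ κ τ ∶ᵏ κ ↣⋆
  _⇒_  : ∀ {τ₁ τ₂} → K ⊢ τ₁ ∶ᵏ ⋆ → K ⊢ τ₂ ∶ᵏ ⋆ → K ⊢ τ₁ ⇒ τ₂ ∶ᵏ ⋆
  Π    : ∀ {κ τ} → κ ∷ K ⊢ τ ∶ᵏ ⋆ → K ⊢ Π κ τ ∶ᵏ ⋆
  M    : ∀ {τ} → K ⊢ τ ∶ᵏ ⋆ → K ⊢ M τ ∶ᵏ ⋆

data _⊢_idx {k : ℕ} (K : Vec Kind k) : Idx k → Set where
  R₀ : ∀ {τ} → K ⊢ τ ∶ᵏ ⋆ → K ⊢ R₀ τ idx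
  R  : ∀ {τ σ} → K ⊢ τ ∶ᵏ ⋆ → K ⊢ σ idx → K ⊢ R τ σ idx
  ⋀  : ∀ {κ σ} → κ ∷ K ⊢ σ idx → K ⊢ ⋀ κ σ idx

data _∣_⊢_∶_ {k t : ℕ} (K : Vec Kind k) (T : Vec (Ty k) t) : Prog k t → Ty k → Set where
  pvar : ∀ {x τ} → lookup T x ≡ τ → K ∣ T ⊢ pvar x ∶ τ
  Λᵖ   : ∀ {κ p τ} → κ ∷ K ∣ map (renTy suc) T ⊢ p ∶ τ → K ∣ T ⊢ Λᵖ κ p ∶ Π κ τ
  _∙_  : ∀ {κ p τ τ′} → K ∣ T ⊢ p ∶ Π κ τ → K ⊢ τ′ ∶ᵏ κ → K ∣ T ⊢ p ∙ τ′ ∶ τ [ τ′ ]ᵗ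
  ƛ    : ∀ {p τ₁ τ₂} → K ⊢ τ₁ ∶ᵏ ⋆ → K ∣ τ₁ ∷ T ⊢ p ∶ τ₂ → K ∣ T ⊢ ƛ τ₁ p ∶ τ₁ ⇒ τ₂
  _·_  : ∀ {p₁ p₂ τ₁ τ₂} → K ∣ T ⊢ p₁ ∶ τ₁ ⇒ τ₂ → K ∣ T ⊢ p₂ ∶ τ₁ → K ∣ T ⊢ p₁ · p₂ ∶ τ₂
  [_]  : ∀ {p τ} → K ∣ T ⊢ p ∶ τ → K ∣ T ⊢ [ p ] ∶ M τ
  let′ : ∀ {p₁ p₂ τ₁ τ₂} → K ∣ T ⊢ p₁ ∶ M τ₁ → K ∣ τ₁ ∷ T ⊢ p₂ ∶ M τ₂ →
         K ∣ T ⊢ let′ p₁ p₂ ∶ M τ₂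
  conv : ∀ {p τ τ′} → K ∣ T ⊢ p ∶ τ → τ ≡ᵗ τ′ → K ⊢ τ′ ∶ᵏ ⋆ → K ∣ T ⊢ p ∶ τ′

mutual
  data _∣_∣_⊢_∶_ {k i t : ℕ} (K : Vec Kind k) (I : Vec (Idx k) i) (T : Vec (Ty k) t) :
                 Exp k i t → Idx k → Set where
    evar : ∀ {y σ} → lookup I y ≡ σ → K ∣ I ∣ T ⊢ evar y ∶ σ
    cmp  : ∀ {τ σ φ} → K ⊢ τ ∶ᵏ ⋆ → K ⊢ σ idx → K ∣ σ ∷ I ∣ τ ∷ T ⊢ φ spec →
           K ∣ I ∣ T ⊢ cmp τ σ φ ∶ R τ σ
    cmp₀ : ∀ {τ φ} → K ⊢ τ ∶ᵏ ⋆ → K ∣ I ∣ τ ∷ T ⊢ φ spec → K ∣ I ∣ T ⊢ cmp₀ τ φ ∶ R₀ τ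
    Λᵉ   : ∀ {κ e σ} → κ ∷ K ∣ map (renIdx suc) I ∣ map (renTy suc) T ⊢ e ∶ σ →
           K ∣ I ∣ T ⊢ Λᵉ κ e ∶ ⋀ κ σ
    _∙_  : ∀ {κ e σ τ} → K ∣ I ∣ T ⊢ e ∶ ⋀ κ σ → K ⊢ τ ∶ᵏ κ → K ∣ I ∣ T ⊢ e ∙ τ ∶ σ [ τ ]ⁱ
    conv : ∀ {e σ σ′} → K ∣ I ∣ T ⊢ e ∶ σ → σ ≡ⁱ σ′ → K ⊢ σ′ idx → K ∣ I ∣ T ⊢ e ∶ σ′

  data _∣_∣_⊢_spec {k i t : ℕ} (K : Vec Kind k) (I : Vec (Idx k) i) (T : Vec (Ty k) t) :
                   Spec k i t → Set where
    mem  : ∀ {p e₁ e₂ τ σ} → K ∣ T ⊢ p ∶ τ → K ∣ I ∣ T ⊢ e₁ ∶ R τ σ → K ∣ I ∣ T ⊢ e₂ ∶ σ →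
           K ∣ I ∣ T ⊢ p ⨾ e₂ ε e₁ spec
    mem₀ : ∀ {p e τ} → K ∣ T ⊢ p ∶ τ → K ∣ I ∣ T ⊢ e ∶ R₀ τ → K ∣ I ∣ T ⊢ p ε e spec
    _⊃_  : ∀ {φ₁ φ₂} → K ∣ I ∣ T ⊢ φ₁ spec → K ∣ I ∣ T ⊢ φ₂ spec → K ∣ I ∣ T ⊢ φ₁ ⊃ φ₂ spec
    ⟨_⟩_ : ∀ {p τ φ} → K ∣ T ⊢ p ∶ M τ → K ∣ I ∣ τ ∷ T ⊢ φ spec → K ∣ I ∣ T ⊢ ⟨ p ⟩ φ spec
    ⋂    : ∀ {κ φ} → κ ∷ K ∣ map (renIdx suc) I ∣ map (renTy suc) T ⊢ φ spec →
           K ∣ I ∣ T ⊢ ⋂ κ φ spec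
    ⊓    : ∀ {τ φ} → K ⊢ τ ∶ᵏ ⋆ → K ∣ I ∣ τ ∷ T ⊢ φ spec → K ∣ I ∣ T ⊢ ⊓ τ φ spec
    ∀′   : ∀ {σ φ} → K ⊢ σ idx → K ∣ σ ∷ I ∣ T ⊢ φ spec → K ∣ I ∣ T ⊢ ∀′ σ φ spec

_⊢_∣_ctx : Vec Kind k → Vec (Idx k) i → Vec (Ty k) t → Set
K ⊢ I ∣ T ctx = All (K ⊢_idx) I × All (K ⊢_∶ᵏ ⋆) T

infix 4 _∣_∣_⊢_⇒_ _∣_∣_⊢_⇒ʳ_

-- As for HOL: a judgment is derivable if it is well-typed (contexts included)
-- and is the conclusion of a rule (…⇒ʳ…) all of whose premises are derivable.
mutual
  data _∣_∣_⊢_⇒_ {k i t : ℕ} (K : Vec Kind k) (I : Vec (Idx k) i) (T : Vec (Ty k) t)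
                 (Φ : List (Spec k i t)) (φ : Spec k i t) : Set where
    derive : K ⊢ I ∣ T ctx → Allˡ (K ∣ I ∣ T ⊢_spec) Φ → K ∣ I ∣ T ⊢ φ spec →
             K ∣ I ∣ T ⊢ Φ ⇒ʳ φ → K ∣ I ∣ T ⊢ Φ ⇒ φ

  data _∣_∣_⊢_⇒ʳ_ {k i t : ℕ} (K : Vec Kind k) (I : Vec (Idx k) i) (T : Vec (Ty k) t)
                  (Φ : List (Spec k i t)) : Spec k i t → Set where
    ident : ∀ {φ} → φ ∈ˡ Φ → K ∣ I ∣ T ⊢ Φ ⇒ʳ φ

    ⊃-I : ∀ {φ₁ φ₂} → K ∣ I ∣ T ⊢ φ₁ List.∷ Φ ⇒ φ₂ → K ∣ I ∣ T ⊢ Φ ⇒ʳ (φ₁ ⊃ φ₂)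
    ⊃-E : ∀ {φ₁ φ₂} → K ∣ I ∣ T ⊢ Φ ⇒ (φ₁ ⊃ φ₂) → K ∣ I ∣ T ⊢ Φ ⇒ φ₁ → K ∣ I ∣ T ⊢ Φ ⇒ʳ φ₂

    ⊓-I : ∀ {τ φ} → K ∣ I ∣ τ ∷ T ⊢ List.map (renSpec id id suc) Φ ⇒ φ →
          K ∣ I ∣ T ⊢ Φ ⇒ʳ ⊓ τ φ
    ⊓-E : ∀ {τ φ V} → K ∣ I ∣ T ⊢ Φ ⇒ ⊓ τ φ → Value V → K ∣ T ⊢ V ∶ τ →
          K ∣ I ∣ T ⊢ Φ ⇒ʳ φ [ V ]ˣ

    ∀-I : ∀ {σ φ} → K ∣ σ ∷ I ∣ T ⊢ List.map (renSpec id suc id) Φ ⇒ φ →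
          K ∣ I ∣ T ⊢ Φ ⇒ʳ ∀′ σ φ
    ∀-E : ∀ {σ φ e} → K ∣ I ∣ T ⊢ Φ ⇒ ∀′ σ φ → K ∣ I ∣ T ⊢ e ∶ σ →
          K ∣ I ∣ T ⊢ Φ ⇒ʳ φ [ e ]ʸ

    ⋂-I : ∀ {κ φ} →
          κ ∷ K ∣ map (renIdx suc) I ∣ map (renTy suc) T ⊢ List.map (renSpec suc id id) Φ ⇒ φ →
          K ∣ I ∣ T ⊢ Φ ⇒ʳ ⋂ κ φ
    ⋂-E : ∀ {κ φ τ} → K ∣ I ∣ T ⊢ Φ ⇒ ⋂ κ φ → K ⊢ τ ∶ᵏ κ → K ∣ I ∣ T ⊢ Φ ⇒ʳ φ [ τ ]ˢᵗ

    Mod-I : ∀ {p φ} → K ∣ I ∣ T ⊢ Φ ⇒ φ [ p ]ˣ → K ∣ I ∣ T ⊢ Φ ⇒ʳ ⟨ [ p ] ⟩ φ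

    -- φ is scoped without x₁ (x₂ is `zero`); the renaming skips x₁.
    Mod-E : ∀ {p₁ p₂ φ} → K ∣ I ∣ T ⊢ Φ ⇒ ⟨ p₁ ⟩ ⟨ p₂ ⟩ renSpec id id (lift 1 suc) φ →
            K ∣ I ∣ T ⊢ Φ ⇒ʳ ⟨ let′ p₁ p₂ ⟩ φ

    Mon : ∀ {τ p φ₁ φ₂} → K ∣ T ⊢ p ∶ M τ →
          K ∣ I ∣ τ ∷ T ⊢ φ₁ List.∷ List.map (renSpec id id suc) Φ ⇒ φ₂ →
          K ∣ I ∣ T ⊢ Φ ⇒ ⟨ p ⟩ φ₁ → K ∣ I ∣ T ⊢ Φ ⇒ʳ ⟨ p ⟩ φ₂

    -- After [ p ]ˣ the variable x is gone, so e is not captured or weakened.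
    Mem-I : ∀ {τ σ φ p e} → K ∣ I ∣ T ⊢ Φ ⇒ φ [ p ]ˣ [ e ]ʸ →
            K ∣ I ∣ T ⊢ Φ ⇒ʳ p ⨾ e ε cmp τ σ φ
    Mem-E : ∀ {τ σ φ p e} → K ∣ I ∣ T ⊢ Φ ⇒ p ⨾ e ε cmp τ σ φ →
            K ∣ I ∣ T ⊢ Φ ⇒ʳ φ [ p ]ˣ [ e ]ʸ

    Mem₀-I : ∀ {τ φ p} → K ∣ I ∣ T ⊢ Φ ⇒ φ [ p ]ˣ → K ∣ I ∣ T ⊢ Φ ⇒ʳ p ε cmp₀ τ φ
    Mem₀-E : ∀ {τ φ p} → K ∣ I ∣ T ⊢ Φ ⇒ p ε cmp₀ τ φ → K ∣ I ∣ T ⊢ Φ ⇒ʳ φ [ p ]ˣ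

    conv : ∀ {φ₁ φ₂} → K ∣ I ∣ T ⊢ Φ ⇒ φ₁ → φ₁ ≡ˢ φ₂ → K ∣ I ∣ T ⊢ Φ ⇒ʳ φ₂

    red : ∀ {φ p₁ p₂} → K ∣ I ∣ T ⊢ Φ ⇒ φ [ p₂ ]ˣ → p₁ ⇝ p₂ → K ∣ I ∣ T ⊢ Φ ⇒ʳ φ [ p₁ ]ˣ

⟦_⟧ᴷ : Sort → Kind
⟦ ★ ⟧ᴷ    = ⋆
⟦ s ↣★ ⟧ᴷ = ⟦ s ⟧ᴷ ↣⋆

⟦_⟧ᴵ : Sort → Ty k → Idx k
⟦ ★ ⟧ᴵ τ    = R₀ τ
⟦ s ↣★ ⟧ᴵ τ = ⋀ ⟦ s ⟧ᴷ (R (renTy suc τ ·ᵗ tvar zero) (⟦ s ⟧ᴵ (tvar zero)))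

mutual
  ⟦_⟧ᵗ : Tm m → Ty m
  ⟦ var u ⟧ᵗ     = tvar u
  ⟦ ⁅ s ∣ ψ ⁆ ⟧ᵗ = Λ̄ ⟦ s ⟧ᴷ ⟦ ψ ⟧ᵀ
  ⟦ ⁅ ψ ⁆ ⟧ᵗ     = ⟦ ψ ⟧ᵀ

  ⟦_⟧ᵀ : Form m → Ty m
  ⟦ ⌜ t ⌝ ⟧ᵀ    = ⟦ t ⟧ᵗ
  ⟦ t₁ ∈′ t₂ ⟧ᵀ = ⟦ t₂ ⟧ᵗ ·ᵗ ⟦ t₁ ⟧ᵗ
  ⟦ ψ₁ ⊐ ψ₂ ⟧ᵀ  = ⟦ ψ₁ ⟧ᵀ ⇒ M ⟦ ψ₂ ⟧ᵀ
  ⟦ all s ψ ⟧ᵀ  = Π ⟦ s ⟧ᴷ (M ⟦ ψ ⟧ᵀ)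

-- The HOL variable u is sent both to the type variable X_u and to the
-- expression variable y_u with the same de Bruijn index.
mutual
  ⟦_⟧ᵉ : Tm m → Exp m m t
  ⟦ var u ⟧ᵉ     = evar u
  ⟦ ⁅ s ∣ ψ ⁆ ⟧ᵉ = Λᵉ ⟦ s ⟧ᴷ (cmp ⟦ ψ ⟧ᵀ (⟦ s ⟧ᴵ (tvar zero)) (⟦ ψ ⟧ˢ (pvar zero)))
  ⟦ ⁅ ψ ⁆ ⟧ᵉ     = cmp₀ ⟦ ψ ⟧ᵀ (⟦ ψ ⟧ˢ (pvar zero))

  ⟦_⟧ˢ : Form m → Prog m t → Spec m m t
  ⟦ ⌜ t ⌝ ⟧ˢ p    = p ε ⟦ t ⟧ᵉ
  ⟦ t₁ ∈′ t₂ ⟧ˢ p = p ⨾ ⟦ t₁ ⟧ᵉ ε (⟦ t₂ ⟧ᵉ ∙ ⟦ t₁ ⟧ᵗ)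
  ⟦ ψ₁ ⊐ ψ₂ ⟧ˢ p  =
    ⊓ ⟦ ψ₁ ⟧ᵀ (⟦ ψ₁ ⟧ˢ (pvar zero) ⊃ ⟨ renProg id suc p · pvar zero ⟩ ⟦ ψ₂ ⟧ˢ (pvar zero))
  ⟦ all s ψ ⟧ˢ p  =
    ⋂ ⟦ s ⟧ᴷ (∀′ (⟦ s ⟧ᴵ (tvar zero)) (⟨ renProg suc id p ∙ tvar zero ⟩ ⟦ ψ ⟧ˢ (pvar zero)))

⟦_⟧ᴷᶜ : Vec Sort m → Vec Kind m
⟦ S ⟧ᴷᶜ = map ⟦_⟧ᴷ S

⟦_⟧ᴵᶜ : Vec Sort m → Vec (Idx m) m
⟦ [] ⟧ᴵᶜ    = []
⟦ s ∷ S ⟧ᴵᶜ = ⟦ s ⟧ᴵ (tvar zero) ∷ map (renIdx suc) ⟦ S ⟧ᴵᶜ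

-- The j-th hypothesis is realized by the j-th program variable.
⟦_⟧ᵀᶜ : Vec (Form m) n → Vec (Ty m) n
⟦ Ψ ⟧ᵀᶜ = map ⟦_⟧ᵀ Ψ

⟦_⟧ˢᶜ : Vec (Form m) n → List (Spec m m n)
⟦ Ψ ⟧ˢᶜ = toList (tabulate λ j → ⟦ lookup Ψ j ⟧ˢ (pvar j))

-- In Γ , Δ the variables of Δ are the most recent, so Δ comes first as a vector:
-- Δ is injected by _↑ˡ_ and Γ by _↑ʳ_.

infixl 5 _,ᴷ_ _,ᴵ_ _,ᵀ_ _,ˢ_

_,ᴷ_ : Vec Kind m → Vec Kind k → Vec Kind (k + m)
K₁ ,ᴷ K₂ = K₂ ++ K₁

_,ᴵ_ : Vec (Idx m) m′ → Vec (Idx k) i → Vec (Idx (k + m)) (i + m′)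
_,ᴵ_ {m = m} {k = k} I₁ I₂ = map (renIdx (_↑ˡ m)) I₂ ++ map (renIdx (k ↑ʳ_)) I₁

_,ᵀ_ : Vec (Ty m) n → Vec (Ty k) t → Vec (Ty (k + m)) (t + n)
_,ᵀ_ {m = m} {k = k} T₁ T₂ = map (renTy (_↑ˡ m)) T₂ ++ map (renTy (k ↑ʳ_)) T₁

injˡ : ∀ k i t → Spec m m′ n → Spec (k + m) (i + m′) (t + n)
injˡ k i t = renSpec (k ↑ʳ_) (i ↑ʳ_) (t ↑ʳ_)

injʳ : ∀ m m′ n → Spec k i t → Spec (k + m) (i + m′) (t + n)
injʳ m m′ n = renSpec (_↑ˡ m) (_↑ˡ m′) (_↑ˡ n)

_,ˢ_ : List (Spec m m′ n) → List (Spec k i t) → List (Spec (k + m) (i + m′) (t + n))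
_,ˢ_ {m = m} {m′ = m′} {n = n} {k = k} {i = i} {t = t} Φ₁ Φ₂ =
  List.map (injˡ k i t) Φ₁ List.++ List.map (injʳ m m′ n) Φ₂

{-# OPTIONS --safe #-}

-- A derivation is read as a program in the style of Moggi's translation: the
-- introductions of ⊐ and ∀ return abstractions, their eliminations become let,
-- and the rules for comprehensions leave the program unchanged.  In EffHOL the
-- lets are handled by Mod-E and Mon, and the β-redexes by ⇝.  Everything else
-- rests on the translation commuting with HOL substitution, where u := t
-- becomes X_u := ⟦ t ⟧ᵗ followed by y_u := ⟦ t ⟧ᵉ.
module Submission where

open import Defs
open import Data.Fin.Base using (Fin; zero; suc; lift; _↑ˡ_; _↑ʳ_)
open import Data.List.Base as List using (List)
open import Data.List.Membership.Propositional using () renaming (_∈_ to _∈ˡ_)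
open import Data.List.Membership.Propositional.Properties using (∈-map⁺; ∈-++⁺ˡ)
open import Data.List.Relation.Unary.All as Allˡ using () renaming (All to Allˡ)
open import Data.List.Relation.Unary.All.Properties using () renaming (map⁺ to Allˡ-map⁺; ++⁺ to Allˡ-++⁺)
open import Data.List.Relation.Unary.Any using (here; there)
open import Data.Nat.Base using (ℕ; suc)
open import Data.Product.Base using (Σ-syntax; _×_; _,_; proj₁; proj₂)
open import Data.Vec.Base using (Vec; []; _∷_; _++_; map; lookup)
open import Data.Vec.Functional using () renaming (_∷_ to _∷ᶠ_)
open import Data.Vec.Properties using (lookup-map; lookup-++ˡ; lookup-++ʳ; map-∘; map-cong)
open import Data.Vec.Membership.Propositional.Properties using (∈-tabulate⁺; ∈-toList⁺)
open import Data.Vec.Relation.Unary.All as All using (All; []; _∷_)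
open import Data.Vec.Relation.Unary.All.Properties
  using (lookup⁺; tabulate⁺; toList⁺) renaming (map⁺ to All-map⁺; ++⁺ to All-++⁺)
open import Data.Vec.Relation.Unary.Any using (index)
open import Data.Vec.Relation.Unary.Any.Properties using (lookup-index)
open import Function.Base using (_∘_; _$_; id)
open import Relation.Binary.PropositionalEquality as ≡ using (_≡_; refl; cong; cong₂; subst)

-- Eliminations and membership steps are always carried out at a program variable. `⊓-E` accepts
-- only values, whereas a realizer of type `M τ` is a computation, so its result is first named, by
-- `Mon` or by a let, and the name is what gets applied or tested for membership. Programs are
-- therefore almost only renamed; the one kind of redex that arises is a weakened abstraction
-- applied to a fresh variable, which contracts to its own body.
--
-- The obstacle is that X_u and y_u are replaced by different rules. After `⋂-E`, or after β for
-- `Λᵉ`, the variable X_u is already instantiated while y_u is still bound, at an index mentioning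
-- the new type. Such a halfway specification is in general not the translation of a HOL
-- proposition, so a substitution lemma about translated propositions alone cannot describe it. This
-- forces a translation with independent assignments for the two families of variables.

private
  variable
    m m′ n : ℕ
    k k′ k″ i i′ t t′ t″ : ℕ

-- Renaming and substitution of types, indices and programs

lift-id : {ρ : Fin m → Fin m} → (∀ x → ρ x ≡ x) → ∀ x → lift 1 ρ x ≡ x
lift-id h zero    = refl
lift-id h (suc x) = cong suc (h x)

lift-∘ : {ρ : Fin k → Fin k′} {ρ′ : Fin k′ → Fin k″} {ρ″ : Fin k → Fin k″} →
         (∀ x → ρ′ (ρ x) ≡ ρ″ x) → ∀ x → lift 1 ρ′ (lift 1 ρ x) ≡ lift 1 ρ″ x
lift-∘ h zero    = refl
lift-∘ h (suc x) = cong suc (h x)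

-- Equations between renamings and substitutions take pointwise hypotheses, in
-- the absence of function extensionality.

renTy-id : {ρ : Fin k → Fin k} → (∀ X → ρ X ≡ X) → ∀ τ → renTy ρ τ ≡ τ
renTy-id h (tvar X)   = cong tvar (h X)
renTy-id h (τ₁ ·ᵗ τ₂) = cong₂ _·ᵗ_ (renTy-id h τ₁) (renTy-id h τ₂)
renTy-id h (Λ̄ κ τ)    = cong (Λ̄ κ) (renTy-id (lift-id h) τ)
renTy-id h (τ₁ ⇒ τ₂)  = cong₂ _⇒_ (renTy-id h τ₁) (renTy-id h τ₂)
renTy-id h (Π κ τ)    = cong (Π κ) (renTy-id (lift-id h) τ)
renTy-id h (M τ)      = cong M (renTy-id h τ)

renTy-∘ : {ρ : Fin k → Fin k′} {ρ′ : Fin k′ → Fin k″} {ρ″ : Fin k → Fin k″} →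
          (∀ X → ρ′ (ρ X) ≡ ρ″ X) → ∀ τ → renTy ρ′ (renTy ρ τ) ≡ renTy ρ″ τ
renTy-∘ h (tvar X)   = cong tvar (h X)
renTy-∘ h (τ₁ ·ᵗ τ₂) = cong₂ _·ᵗ_ (renTy-∘ h τ₁) (renTy-∘ h τ₂)
renTy-∘ h (Λ̄ κ τ)    = cong (Λ̄ κ) (renTy-∘ (lift-∘ h) τ)
renTy-∘ h (τ₁ ⇒ τ₂)  = cong₂ _⇒_ (renTy-∘ h τ₁) (renTy-∘ h τ₂)
renTy-∘ h (Π κ τ)    = cong (Π κ) (renTy-∘ (lift-∘ h) τ)
renTy-∘ h (M τ)      = cong M (renTy-∘ h τ)

renTy-suc : (ρ : Fin k → Fin k′) → ∀ τ → renTy (lift 1 ρ) (renTy suc τ) ≡ renTy suc (renTy ρ τ)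
renTy-suc ρ τ = ≡.trans (renTy-∘ (λ _ → refl) τ) (≡.sym (renTy-∘ (λ _ → refl) τ))

liftTy-var : {α : Fin k → Ty k′} {ρ : Fin k → Fin k′} →
             (∀ X → α X ≡ tvar (ρ X)) → ∀ X → liftTy α X ≡ tvar (lift 1 ρ X)
liftTy-var h zero    = refl
liftTy-var h (suc X) = cong (renTy suc) (h X)

subTy-var : {α : Fin k → Ty k′} {ρ : Fin k → Fin k′} →
            (∀ X → α X ≡ tvar (ρ X)) → ∀ τ → subTy α τ ≡ renTy ρ τ
subTy-var h (tvar X)   = h X
subTy-var h (τ₁ ·ᵗ τ₂) = cong₂ _·ᵗ_ (subTy-var h τ₁) (subTy-var h τ₂)
subTy-var h (Λ̄ κ τ)    = cong (Λ̄ κ) (subTy-var (liftTy-var h) τ)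
subTy-var h (τ₁ ⇒ τ₂)  = cong₂ _⇒_ (subTy-var h τ₁) (subTy-var h τ₂)
subTy-var h (Π κ τ)    = cong (Π κ) (subTy-var (liftTy-var h) τ)
subTy-var h (M τ)      = cong M (subTy-var h τ)

subTy-id : {α : Fin k → Ty k} → (∀ X → α X ≡ tvar X) → ∀ τ → subTy α τ ≡ τ
subTy-id h τ = ≡.trans (subTy-var h τ) (renTy-id (λ _ → refl) τ)

liftTy-lift : {ρ : Fin k → Fin k′} {α : Fin k′ → Ty k″} {δ : Fin k → Ty k″} →
              (∀ X → α (ρ X) ≡ δ X) → ∀ X → liftTy α (lift 1 ρ X) ≡ liftTy δ X
liftTy-lift h zero    = refl
liftTy-lift h (suc X) = cong (renTy suc) (h X)

subTy-renTy : {ρ : Fin k → Fin k′} {α : Fin k′ → Ty k″} {δ : Fin k → Ty k″} →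
              (∀ X → α (ρ X) ≡ δ X) → ∀ τ → subTy α (renTy ρ τ) ≡ subTy δ τ
subTy-renTy h (tvar X)   = h X
subTy-renTy h (τ₁ ·ᵗ τ₂) = cong₂ _·ᵗ_ (subTy-renTy h τ₁) (subTy-renTy h τ₂)
subTy-renTy h (Λ̄ κ τ)    = cong (Λ̄ κ) (subTy-renTy (liftTy-lift h) τ)
subTy-renTy h (τ₁ ⇒ τ₂)  = cong₂ _⇒_ (subTy-renTy h τ₁) (subTy-renTy h τ₂)
subTy-renTy h (Π κ τ)    = cong (Π κ) (subTy-renTy (liftTy-lift h) τ)
subTy-renTy h (M τ)      = cong M (subTy-renTy h τ)

-- An instance of `subTy-renTy` along the identity renaming, which saves an induction.
subTy-cong : {α δ : Fin k → Ty k′} → (∀ X → α X ≡ δ X) → ∀ τ → subTy α τ ≡ subTy δ τ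
subTy-cong {α = α} h τ =
  ≡.trans (cong (subTy α) (≡.sym (renTy-id (λ _ → refl) τ))) (subTy-renTy h τ)

lift-liftTy : {α : Fin k → Ty k′} {ρ : Fin k′ → Fin k″} {δ : Fin k → Ty k″} →
              (∀ X → renTy ρ (α X) ≡ δ X) → ∀ X → renTy (lift 1 ρ) (liftTy α X) ≡ liftTy δ X
lift-liftTy             h zero    = refl
lift-liftTy {α = α} {ρ} h (suc X) = ≡.trans (renTy-suc ρ (α X)) (cong (renTy suc) (h X))

renTy-subTy : {α : Fin k → Ty k′} {ρ : Fin k′ → Fin k″} {δ : Fin k → Ty k″} →
              (∀ X → renTy ρ (α X) ≡ δ X) → ∀ τ → renTy ρ (subTy α τ) ≡ subTy δ τ
renTy-subTy h (tvar X)   = h X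
renTy-subTy h (τ₁ ·ᵗ τ₂) = cong₂ _·ᵗ_ (renTy-subTy h τ₁) (renTy-subTy h τ₂)
renTy-subTy h (Λ̄ κ τ)    = cong (Λ̄ κ) (renTy-subTy (lift-liftTy h) τ)
renTy-subTy h (τ₁ ⇒ τ₂)  = cong₂ _⇒_ (renTy-subTy h τ₁) (renTy-subTy h τ₂)
renTy-subTy h (Π κ τ)    = cong (Π κ) (renTy-subTy (lift-liftTy h) τ)
renTy-subTy h (M τ)      = cong M (renTy-subTy h τ)

subTy-suc : (α : Fin k → Ty k′) → ∀ τ → subTy (liftTy α) (renTy suc τ) ≡ renTy suc (subTy α τ)
subTy-suc α τ = ≡.trans (subTy-renTy (λ _ → refl) τ) (≡.sym (renTy-subTy (λ _ → refl) τ))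

liftTy-liftTy : {α : Fin k → Ty k′} {α′ : Fin k′ → Ty k″} {δ : Fin k → Ty k″} →
                (∀ X → subTy α′ (α X) ≡ δ X) → ∀ X → subTy (liftTy α′) (liftTy α X) ≡ liftTy δ X
liftTy-liftTy              h zero    = refl
liftTy-liftTy {α = α} {α′} h (suc X) = ≡.trans (subTy-suc α′ (α X)) (cong (renTy suc) (h X))

subTy-subTy : {α : Fin k → Ty k′} {α′ : Fin k′ → Ty k″} {δ : Fin k → Ty k″} →
              (∀ X → subTy α′ (α X) ≡ δ X) → ∀ τ → subTy α′ (subTy α τ) ≡ subTy δ τ
subTy-subTy h (tvar X)   = h X
subTy-subTy h (τ₁ ·ᵗ τ₂) = cong₂ _·ᵗ_ (subTy-subTy h τ₁) (subTy-subTy h τ₂)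
subTy-subTy h (Λ̄ κ τ)    = cong (Λ̄ κ) (subTy-subTy (liftTy-liftTy h) τ)
subTy-subTy h (τ₁ ⇒ τ₂)  = cong₂ _⇒_ (subTy-subTy h τ₁) (subTy-subTy h τ₂)
subTy-subTy h (Π κ τ)    = cong (Π κ) (subTy-subTy (liftTy-liftTy h) τ)
subTy-subTy h (M τ)      = cong M (subTy-subTy h τ)

suc-[]ᵗ : (τ τ′ : Ty k) → renTy suc τ [ τ′ ]ᵗ ≡ τ
suc-[]ᵗ τ τ′ = ≡.trans (subTy-renTy (λ _ → refl) τ) (subTy-id (λ _ → refl) τ)

-- β at an instantiated abstraction leaves two successive substitutions; the assignments used by the
-- translation are extended in one go.
liftTy-[]ᵗ : (α : Fin k → Ty k′) (τ : Ty (suc k)) (τ′ : Ty k′) →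
             subTy (liftTy α) τ [ τ′ ]ᵗ ≡ subTy (τ′ ∷ᶠ α) τ
liftTy-[]ᵗ α τ τ′ = subTy-subTy (λ { zero → refl ; (suc X) → suc-[]ᵗ (α X) τ′ }) τ

renTy-[]ᵗ : (ρ : Fin k → Fin k′) (τ : Ty (suc k)) (τ′ : Ty k) →
            renTy ρ (τ [ τ′ ]ᵗ) ≡ renTy (lift 1 ρ) τ [ renTy ρ τ′ ]ᵗ
renTy-[]ᵗ ρ τ τ′ = ≡.trans
  (renTy-subTy {δ = renTy ρ τ′ ∷ᶠ (tvar ∘ ρ)} (λ { zero → refl ; (suc _) → refl }) τ)
  (≡.sym (subTy-renTy (λ { zero → refl ; (suc _) → refl }) τ))

renIdx-id : {ρ : Fin k → Fin k} → (∀ X → ρ X ≡ X) → ∀ σ → renIdx ρ σ ≡ σ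
renIdx-id h (R₀ τ)  = cong R₀ (renTy-id h τ)
renIdx-id h (R τ σ) = cong₂ R (renTy-id h τ) (renIdx-id h σ)
renIdx-id h (⋀ κ σ) = cong (⋀ κ) (renIdx-id (lift-id h) σ)

renIdx-∘ : {ρ : Fin k → Fin k′} {ρ′ : Fin k′ → Fin k″} {ρ″ : Fin k → Fin k″} →
           (∀ X → ρ′ (ρ X) ≡ ρ″ X) → ∀ σ → renIdx ρ′ (renIdx ρ σ) ≡ renIdx ρ″ σ
renIdx-∘ h (R₀ τ)  = cong R₀ (renTy-∘ h τ)
renIdx-∘ h (R τ σ) = cong₂ R (renTy-∘ h τ) (renIdx-∘ h σ)
renIdx-∘ h (⋀ κ σ) = cong (⋀ κ) (renIdx-∘ (lift-∘ h) σ)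

renIdx-suc : (ρ : Fin k → Fin k′) → ∀ σ → renIdx (lift 1 ρ) (renIdx suc σ) ≡ renIdx suc (renIdx ρ σ)
renIdx-suc ρ σ = ≡.trans (renIdx-∘ (λ _ → refl) σ) (≡.sym (renIdx-∘ (λ _ → refl) σ))

subIdx-renIdx : {ρ : Fin k → Fin k′} {α : Fin k′ → Ty k″} {δ : Fin k → Ty k″} →
                (∀ X → α (ρ X) ≡ δ X) → ∀ σ → subIdx α (renIdx ρ σ) ≡ subIdx δ σ
subIdx-renIdx h (R₀ τ)  = cong R₀ (subTy-renTy h τ)
subIdx-renIdx h (R τ σ) = cong₂ R (subTy-renTy h τ) (subIdx-renIdx h σ)
subIdx-renIdx h (⋀ κ σ) = cong (⋀ κ) (subIdx-renIdx (liftTy-lift h) σ)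

renIdx-subIdx : {α : Fin k → Ty k′} {ρ : Fin k′ → Fin k″} {δ : Fin k → Ty k″} →
                (∀ X → renTy ρ (α X) ≡ δ X) → ∀ σ → renIdx ρ (subIdx α σ) ≡ subIdx δ σ
renIdx-subIdx h (R₀ τ)  = cong R₀ (renTy-subTy h τ)
renIdx-subIdx h (R τ σ) = cong₂ R (renTy-subTy h τ) (renIdx-subIdx h σ)
renIdx-subIdx h (⋀ κ σ) = cong (⋀ κ) (renIdx-subIdx (lift-liftTy h) σ)

renIdx-[]ⁱ : (ρ : Fin k → Fin k′) (σ : Idx (suc k)) (τ : Ty k) →
             renIdx ρ (σ [ τ ]ⁱ) ≡ renIdx (lift 1 ρ) σ [ renTy ρ τ ]ⁱ
renIdx-[]ⁱ ρ σ τ = ≡.trans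
  (renIdx-subIdx {δ = renTy ρ τ ∷ᶠ (tvar ∘ ρ)} (λ { zero → refl ; (suc _) → refl }) σ)
  (≡.sym (subIdx-renIdx (λ { zero → refl ; (suc _) → refl }) σ))

renProg-∘ : {ρ : Fin k → Fin k′} {ρ′ : Fin k′ → Fin k″} {ρ″ : Fin k → Fin k″}
            {ξ : Fin t → Fin t′} {ξ′ : Fin t′ → Fin t″} {ξ″ : Fin t → Fin t″} →
            (∀ X → ρ′ (ρ X) ≡ ρ″ X) → (∀ x → ξ′ (ξ x) ≡ ξ″ x) →
            ∀ p → renProg ρ′ ξ′ (renProg ρ ξ p) ≡ renProg ρ″ ξ″ p
renProg-∘ h g (pvar x)     = cong pvar (g x)
renProg-∘ h g (Λᵖ κ p)     = cong (Λᵖ κ) (renProg-∘ (lift-∘ h) g p)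
renProg-∘ h g (p ∙ τ)      = cong₂ _∙_ (renProg-∘ h g p) (renTy-∘ h τ)
renProg-∘ h g (ƛ τ p)      = cong₂ ƛ (renTy-∘ h τ) (renProg-∘ h (lift-∘ g) p)
renProg-∘ h g (p₁ · p₂)    = cong₂ _·_ (renProg-∘ h g p₁) (renProg-∘ h g p₂)
renProg-∘ h g [ p ]        = cong [_] (renProg-∘ h g p)
renProg-∘ h g (let′ p₁ p₂) = cong₂ let′ (renProg-∘ h g p₁) (renProg-∘ h (lift-∘ g) p₂)

liftTy-retract : {ρ : Fin k → Fin k′} {α : Fin k′ → Ty k} →
                 (∀ X → α (ρ X) ≡ tvar X) → ∀ X → liftTy α (lift 1 ρ X) ≡ tvar X
liftTy-retract h zero    = refl
liftTy-retract h (suc X) = cong (renTy suc) (h X)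

liftProg-retract : {ξ : Fin t → Fin t′} {γ : Fin t′ → Prog k t} →
                   (∀ x → γ (ξ x) ≡ pvar x) → ∀ x → liftProg γ (lift 1 ξ x) ≡ pvar x
liftProg-retract h zero    = refl
liftProg-retract h (suc x) = cong (renProg id suc) (h x)

subTy-retract : {ρ : Fin k → Fin k′} {α : Fin k′ → Ty k} →
                (∀ X → α (ρ X) ≡ tvar X) → ∀ τ → subTy α (renTy ρ τ) ≡ τ
subTy-retract h τ = ≡.trans (subTy-renTy h τ) (subTy-id (λ _ → refl) τ)

-- Serves the β-steps of `sound`: contracting a weakened abstraction at the fresh variable renames
-- the body and then substitutes that variable back, so the body itself is recovered.
subProg-retract : {ρ : Fin k → Fin k′} {α : Fin k′ → Ty k} {ξ : Fin t → Fin t′} {γ : Fin t′ → Prog k t} →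
                  (∀ X → α (ρ X) ≡ tvar X) → (∀ x → γ (ξ x) ≡ pvar x) →
                  ∀ p → subProg α γ (renProg ρ ξ p) ≡ p
subProg-retract h g (pvar x)     = g x
subProg-retract h g (Λᵖ κ p)     =
  cong (Λᵖ κ) (subProg-retract (liftTy-retract h) (λ x → cong (renProg suc id) (g x)) p)
subProg-retract h g (p ∙ τ)      = cong₂ _∙_ (subProg-retract h g p) (subTy-retract h τ)
subProg-retract h g (ƛ τ p)      =
  cong₂ ƛ (subTy-retract h τ) (subProg-retract h (liftProg-retract g) p)
subProg-retract h g (p₁ · p₂)    = cong₂ _·_ (subProg-retract h g p₁) (subProg-retract h g p₂)
subProg-retract h g [ p ]        = cong [_] (subProg-retract h g p)
subProg-retract h g (let′ p₁ p₂) =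
  cong₂ let′ (subProg-retract h g p₁) (subProg-retract h (liftProg-retract g) p₂)

-- Renaming and substitution preserve typing

lookup-lift : {A : Set} {K : Vec A k} {K′ : Vec A k′} {ρ : Fin k → Fin k′} {κ : A} →
              (∀ X → lookup K′ (ρ X) ≡ lookup K X) →
              ∀ X → lookup (κ ∷ K′) (lift 1 ρ X) ≡ lookup (κ ∷ K) X
lookup-lift h zero    = refl
lookup-lift h (suc X) = h X

renTy-kind : {K : Vec Kind k} {K′ : Vec Kind k′} {ρ : Fin k → Fin k′} →
             (∀ X → lookup K′ (ρ X) ≡ lookup K X) →
             ∀ {τ κ} → K ⊢ τ ∶ᵏ κ → K′ ⊢ renTy ρ τ ∶ᵏ κ
renTy-kind h (tvar {X} e) = tvar (≡.trans (h X) e)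
renTy-kind h (d₁ ·ᵗ d₂)   = renTy-kind h d₁ ·ᵗ renTy-kind h d₂
renTy-kind h (Λ̄ d)        = Λ̄ (renTy-kind (lookup-lift h) d)
renTy-kind h (d₁ ⇒ d₂)    = renTy-kind h d₁ ⇒ renTy-kind h d₂
renTy-kind h (Π d)        = Π (renTy-kind (lookup-lift h) d)
renTy-kind h (M d)        = M (renTy-kind h d)

liftTy-kind : {K : Vec Kind k} {K′ : Vec Kind k′} {α : Fin k → Ty k′} {κ : Kind} →
              (∀ X → K′ ⊢ α X ∶ᵏ lookup K X) →
              ∀ X → κ ∷ K′ ⊢ liftTy α X ∶ᵏ lookup (κ ∷ K) X
liftTy-kind h zero    = tvar refl
liftTy-kind h (suc X) = renTy-kind (λ _ → refl) (h X)

subTy-kind : {K : Vec Kind k} {K′ : Vec Kind k′} {α : Fin k → Ty k′} →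
             (∀ X → K′ ⊢ α X ∶ᵏ lookup K X) →
             ∀ {τ κ} → K ⊢ τ ∶ᵏ κ → K′ ⊢ subTy α τ ∶ᵏ κ
subTy-kind h (tvar {X} e) = subst (_ ⊢ _ ∶ᵏ_) e (h X)
subTy-kind h (d₁ ·ᵗ d₂)   = subTy-kind h d₁ ·ᵗ subTy-kind h d₂
subTy-kind h (Λ̄ d)        = Λ̄ (subTy-kind (liftTy-kind h) d)
subTy-kind h (d₁ ⇒ d₂)    = subTy-kind h d₁ ⇒ subTy-kind h d₂
subTy-kind h (Π d)        = Π (subTy-kind (liftTy-kind h) d)
subTy-kind h (M d)        = M (subTy-kind h d)

renIdx-idx : {K : Vec Kind k} {K′ : Vec Kind k′} {ρ : Fin k → Fin k′} →
             (∀ X → lookup K′ (ρ X) ≡ lookup K X) → ∀ {σ} → K ⊢ σ idx → K′ ⊢ renIdx ρ σ idx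
renIdx-idx h (R₀ d)  = R₀ (renTy-kind h d)
renIdx-idx h (R d w) = R (renTy-kind h d) (renIdx-idx h w)
renIdx-idx h (⋀ w)   = ⋀ (renIdx-idx (lookup-lift h) w)

renTy-≡ᵗ : (ρ : Fin k → Fin k′) {τ τ′ : Ty k} → τ ≡ᵗ τ′ → renTy ρ τ ≡ᵗ renTy ρ τ′
renTy-≡ᵗ ρ (β {κ} {τ₁} {τ₂}) =
  subst (Λ̄ κ (renTy (lift 1 ρ) τ₁) ·ᵗ renTy ρ τ₂ ≡ᵗ_) (≡.sym (renTy-[]ᵗ ρ τ₁ τ₂)) β
renTy-≡ᵗ ρ refl          = refl
renTy-≡ᵗ ρ (sym c)       = sym (renTy-≡ᵗ ρ c)
renTy-≡ᵗ ρ (trans c₁ c₂) = trans (renTy-≡ᵗ ρ c₁) (renTy-≡ᵗ ρ c₂)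
renTy-≡ᵗ ρ (c₁ ·ᵗ c₂)    = renTy-≡ᵗ ρ c₁ ·ᵗ renTy-≡ᵗ ρ c₂
renTy-≡ᵗ ρ (Λ̄ c)         = Λ̄ (renTy-≡ᵗ (lift 1 ρ) c)
renTy-≡ᵗ ρ (c₁ ⇒ c₂)     = renTy-≡ᵗ ρ c₁ ⇒ renTy-≡ᵗ ρ c₂
renTy-≡ᵗ ρ (Π c)         = Π (renTy-≡ᵗ (lift 1 ρ) c)
renTy-≡ᵗ ρ (M c)         = M (renTy-≡ᵗ ρ c)

renIdx-≡ⁱ : (ρ : Fin k → Fin k′) {σ σ′ : Idx k} → σ ≡ⁱ σ′ → renIdx ρ σ ≡ⁱ renIdx ρ σ′
renIdx-≡ⁱ ρ refl          = refl
renIdx-≡ⁱ ρ (sym c)       = sym (renIdx-≡ⁱ ρ c)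
renIdx-≡ⁱ ρ (trans c₁ c₂) = trans (renIdx-≡ⁱ ρ c₁) (renIdx-≡ⁱ ρ c₂)
renIdx-≡ⁱ ρ (R₀ c)        = R₀ (renTy-≡ᵗ ρ c)
renIdx-≡ⁱ ρ (R c₁ c₂)     = R (renTy-≡ᵗ ρ c₁) (renIdx-≡ⁱ ρ c₂)
renIdx-≡ⁱ ρ (⋀ c)         = ⋀ (renIdx-≡ⁱ (lift 1 ρ) c)

-- Packed as a record so that `ρ`, `ξ` and both contexts can be read off the type by unification;
-- the bare family of lookup equations would not determine them.
record RenT (ρ : Fin k → Fin k′) (ξ : Fin t → Fin t′) (T : Vec (Ty k) t) (T′ : Vec (Ty k′) t′) : Set where
  constructor renT
  field ren-lookup : ∀ x → lookup T′ (ξ x) ≡ renTy ρ (lookup T x)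

record RenI (ρ : Fin k → Fin k′) (ζ : Fin i → Fin i′) (I : Vec (Idx k) i) (I′ : Vec (Idx k′) i′) : Set where
  constructor renI
  field ren-lookup : ∀ y → lookup I′ (ζ y) ≡ renIdx ρ (lookup I y)

open RenT
open RenI

RenT-∷ : {ρ : Fin k → Fin k′} {ξ : Fin t → Fin t′} {T : Vec (Ty k) t} {T′ : Vec (Ty k′) t′} {τ : Ty k} →
         RenT ρ ξ T T′ → RenT ρ (lift 1 ξ) (τ ∷ T) (renTy ρ τ ∷ T′)
RenT-∷ h .ren-lookup zero    = refl
RenT-∷ h .ren-lookup (suc x) = h .ren-lookup x

RenI-∷ : {ρ : Fin k → Fin k′} {ζ : Fin i → Fin i′} {I : Vec (Idx k) i} {I′ : Vec (Idx k′) i′} {σ : Idx k} →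
         RenI ρ ζ I I′ → RenI ρ (lift 1 ζ) (σ ∷ I) (renIdx ρ σ ∷ I′)
RenI-∷ h .ren-lookup zero    = refl
RenI-∷ h .ren-lookup (suc y) = h .ren-lookup y

RenT-map-suc : {ρ : Fin k → Fin k′} {ξ : Fin t → Fin t′} {T : Vec (Ty k) t} {T′ : Vec (Ty k′) t′} →
               RenT ρ ξ T T′ → RenT (lift 1 ρ) ξ (map (renTy suc) T) (map (renTy suc) T′)
RenT-map-suc {ρ = ρ} {ξ} {T} {T′} h .ren-lookup x = begin
  lookup (map (renTy suc) T′) (ξ x)               ≡⟨ lookup-map (ξ x) (renTy suc) T′ ⟩
  renTy suc (lookup T′ (ξ x))                     ≡⟨ cong (renTy suc) (h .ren-lookup x) ⟩
  renTy suc (renTy ρ (lookup T x))                ≡⟨ renTy-suc ρ (lookup T x) ⟨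
  renTy (lift 1 ρ) (renTy suc (lookup T x))       ≡⟨ cong (renTy (lift 1 ρ)) (lookup-map x (renTy suc) T) ⟨
  renTy (lift 1 ρ) (lookup (map (renTy suc) T) x) ∎
  where open ≡.≡-Reasoning

RenI-map-suc : {ρ : Fin k → Fin k′} {ζ : Fin i → Fin i′} {I : Vec (Idx k) i} {I′ : Vec (Idx k′) i′} →
               RenI ρ ζ I I′ → RenI (lift 1 ρ) ζ (map (renIdx suc) I) (map (renIdx suc) I′)
RenI-map-suc {ρ = ρ} {ζ} {I} {I′} h .ren-lookup y = begin
  lookup (map (renIdx suc) I′) (ζ y)                ≡⟨ lookup-map (ζ y) (renIdx suc) I′ ⟩
  renIdx suc (lookup I′ (ζ y))                      ≡⟨ cong (renIdx suc) (h .ren-lookup y) ⟩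
  renIdx suc (renIdx ρ (lookup I y))                ≡⟨ renIdx-suc ρ (lookup I y) ⟨
  renIdx (lift 1 ρ) (renIdx suc (lookup I y))       ≡⟨ cong (renIdx (lift 1 ρ)) (lookup-map y (renIdx suc) I) ⟨
  renIdx (lift 1 ρ) (lookup (map (renIdx suc) I) y) ∎
  where open ≡.≡-Reasoning

renProg-type : {K : Vec Kind k} {K′ : Vec Kind k′} {T : Vec (Ty k) t} {T′ : Vec (Ty k′) t′}
               {ρ : Fin k → Fin k′} {ξ : Fin t → Fin t′} →
               (∀ X → lookup K′ (ρ X) ≡ lookup K X) → RenT ρ ξ T T′ →
               ∀ {p τ} → K ∣ T ⊢ p ∶ τ → K′ ∣ T′ ⊢ renProg ρ ξ p ∶ renTy ρ τ
renProg-type {ρ = ρ} hK hT (pvar {x} e) = pvar (≡.trans (hT .ren-lookup x) (cong (renTy ρ) e))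
renProg-type hK hT (Λᵖ d)         = Λᵖ (renProg-type (lookup-lift hK) (RenT-map-suc hT) d)
renProg-type {ρ = ρ} hK hT (_∙_ {τ = τ} {τ′} d d′) =
  subst (_ ∣ _ ⊢ _ ∶_) (≡.sym (renTy-[]ᵗ ρ τ τ′)) (renProg-type hK hT d ∙ renTy-kind hK d′)
renProg-type hK hT (ƛ d′ d)       = ƛ (renTy-kind hK d′) (renProg-type hK (RenT-∷ hT) d)
renProg-type hK hT (d₁ · d₂)      = renProg-type hK hT d₁ · renProg-type hK hT d₂
renProg-type hK hT [ d ]          = [ renProg-type hK hT d ]
renProg-type hK hT (let′ d₁ d₂)   = let′ (renProg-type hK hT d₁) (renProg-type hK (RenT-∷ hT) d₂)
renProg-type {ρ = ρ} hK hT (conv d c d′) =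
  conv (renProg-type hK hT d) (renTy-≡ᵗ ρ c) (renTy-kind hK d′)

module _ where
  private
    variable
      K : Vec Kind k
      K′ : Vec Kind k′
      I : Vec (Idx k) i
      I′ : Vec (Idx k′) i′
      T : Vec (Ty k) t
      T′ : Vec (Ty k′) t′
      ρ : Fin k → Fin k′
      ζ : Fin i → Fin i′
      ξ : Fin t → Fin t′

  mutual
    renExp-type : (∀ X → lookup K′ (ρ X) ≡ lookup K X) → RenI ρ ζ I I′ → RenT ρ ξ T T′ →
                  ∀ {e σ} → K ∣ I ∣ T ⊢ e ∶ σ → K′ ∣ I′ ∣ T′ ⊢ renExp ρ ζ ξ e ∶ renIdx ρ σ
    renExp-type {ρ = ρ} hK hI hT (evar {y} e) = evar (≡.trans (hI .ren-lookup y) (cong (renIdx ρ) e))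
    renExp-type hK hI hT (cmp d w s)  =
      cmp (renTy-kind hK d) (renIdx-idx hK w) (renSpec-spec hK (RenI-∷ hI) (RenT-∷ hT) s)
    renExp-type hK hI hT (cmp₀ d s)   = cmp₀ (renTy-kind hK d) (renSpec-spec hK hI (RenT-∷ hT) s)
    renExp-type hK hI hT (Λᵉ d)       =
      Λᵉ (renExp-type (lookup-lift hK) (RenI-map-suc hI) (RenT-map-suc hT) d)
    renExp-type {ρ = ρ} hK hI hT (_∙_ {σ = σ} {τ} d d′) =
      subst (_ ∣ _ ∣ _ ⊢ _ ∶_) (≡.sym (renIdx-[]ⁱ ρ σ τ)) (renExp-type hK hI hT d ∙ renTy-kind hK d′)
    renExp-type {ρ = ρ} hK hI hT (conv d c w) =
      conv (renExp-type hK hI hT d) (renIdx-≡ⁱ ρ c) (renIdx-idx hK w)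

    renSpec-spec : (∀ X → lookup K′ (ρ X) ≡ lookup K X) → RenI ρ ζ I I′ → RenT ρ ξ T T′ →
                   ∀ {φ} → K ∣ I ∣ T ⊢ φ spec → K′ ∣ I′ ∣ T′ ⊢ renSpec ρ ζ ξ φ spec
    renSpec-spec hK hI hT (mem d d₁ d₂) =
      mem (renProg-type hK hT d) (renExp-type hK hI hT d₁) (renExp-type hK hI hT d₂)
    renSpec-spec hK hI hT (mem₀ d d₁)   = mem₀ (renProg-type hK hT d) (renExp-type hK hI hT d₁)
    renSpec-spec hK hI hT (s₁ ⊃ s₂)     = renSpec-spec hK hI hT s₁ ⊃ renSpec-spec hK hI hT s₂
    renSpec-spec hK hI hT (⟨ d ⟩ s)     = ⟨ renProg-type hK hT d ⟩ renSpec-spec hK hI (RenT-∷ hT) s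
    renSpec-spec hK hI hT (⋂ s)         =
      ⋂ (renSpec-spec (lookup-lift hK) (RenI-map-suc hI) (RenT-map-suc hT) s)
    renSpec-spec hK hI hT (⊓ d s)       = ⊓ (renTy-kind hK d) (renSpec-spec hK hI (RenT-∷ hT) s)
    renSpec-spec hK hI hT (∀′ w s)      = ∀′ (renIdx-idx hK w) (renSpec-spec hK (RenI-∷ hI) hT s)

  wkˣ-RenT : ∀ {τ} → RenT id suc T (τ ∷ T)
  wkˣ-RenT {T = T} = renT λ x → ≡.sym (renTy-id (λ _ → refl) (lookup T x))

  id-RenT : RenT id id T T
  id-RenT {T = T} = renT λ x → ≡.sym (renTy-id (λ _ → refl) (lookup T x))

  id-RenI : RenI id id I I
  id-RenI {I = I} = renI λ y → ≡.sym (renIdx-id (λ _ → refl) (lookup I y))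

  wkʸ-RenI : ∀ {σ} → RenI id suc I (σ ∷ I)
  wkʸ-RenI {I = I} = renI λ y → ≡.sym (renIdx-id (λ _ → refl) (lookup I y))

  wkᵗ-RenT : RenT suc id T (map (renTy suc) T)
  wkᵗ-RenT {T = T} = renT λ x → lookup-map x (renTy suc) T

  wkᵗ-RenI : RenI suc id I (map (renIdx suc) I)
  wkᵗ-RenI {I = I} = renI λ y → lookup-map y (renIdx suc) I

  wkˣ-prog : ∀ {p τ τ′} → K ∣ T ⊢ p ∶ τ → K ∣ τ′ ∷ T ⊢ renProg id suc p ∶ τ
  wkˣ-prog d = subst (_ ∣ _ ⊢ _ ∶_) (renTy-id (λ _ → refl) _) (renProg-type (λ _ → refl) wkˣ-RenT d)

  wkᵗ-prog : ∀ {κ p τ} → K ∣ T ⊢ p ∶ τ → κ ∷ K ∣ map (renTy suc) T ⊢ renProg suc id p ∶ renTy suc τ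
  wkᵗ-prog = renProg-type (λ _ → refl) wkᵗ-RenT

  wkˣ-exp : ∀ {e σ τ} → K ∣ I ∣ T ⊢ e ∶ σ → K ∣ I ∣ τ ∷ T ⊢ renExp id id suc e ∶ σ
  wkˣ-exp d =
    subst (_ ∣ _ ∣ _ ⊢ _ ∶_) (renIdx-id (λ _ → refl) _) (renExp-type (λ _ → refl) id-RenI wkˣ-RenT d)

  wkʸ-exp : ∀ {e σ σ′} → K ∣ I ∣ T ⊢ e ∶ σ → K ∣ σ′ ∷ I ∣ T ⊢ renExp id suc id e ∶ σ
  wkʸ-exp d =
    subst (_ ∣ _ ∣ _ ⊢ _ ∶_) (renIdx-id (λ _ → refl) _) (renExp-type (λ _ → refl) wkʸ-RenI id-RenT d)

  wkᵗ-exp : ∀ {κ e σ} → K ∣ I ∣ T ⊢ e ∶ σ →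
            κ ∷ K ∣ map (renIdx suc) I ∣ map (renTy suc) T ⊢ renExp suc id id e ∶ renIdx suc σ
  wkᵗ-exp = renExp-type (λ _ → refl) wkᵗ-RenI wkᵗ-RenT

-- The translation of sorts and of types

renIdx-⟦⟧ᴵ : (ρ : Fin k → Fin k′) → ∀ s τ → renIdx ρ (⟦ s ⟧ᴵ τ) ≡ ⟦ s ⟧ᴵ (renTy ρ τ)
renIdx-⟦⟧ᴵ ρ ★      τ = refl
renIdx-⟦⟧ᴵ ρ (s ↣★) τ = cong₂ (λ τ′ σ → ⋀ ⟦ s ⟧ᴷ (R (τ′ ·ᵗ tvar zero) σ))
  (renTy-suc ρ τ) (renIdx-⟦⟧ᴵ (lift 1 ρ) s (tvar zero))

subIdx-⟦⟧ᴵ : (α : Fin k → Ty k′) → ∀ s τ → subIdx α (⟦ s ⟧ᴵ τ) ≡ ⟦ s ⟧ᴵ (subTy α τ)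
subIdx-⟦⟧ᴵ α ★      τ = refl
subIdx-⟦⟧ᴵ α (s ↣★) τ = cong₂ (λ τ′ σ → ⋀ ⟦ s ⟧ᴷ (R (τ′ ·ᵗ tvar zero) σ))
  (subTy-suc α τ) (subIdx-⟦⟧ᴵ (liftTy α) s (tvar zero))

⟦⟧ᴵ-idx : {K : Vec Kind k} → ∀ s {τ} → K ⊢ τ ∶ᵏ ⟦ s ⟧ᴷ → K ⊢ ⟦ s ⟧ᴵ τ idx
⟦⟧ᴵ-idx ★      d = R₀ d
⟦⟧ᴵ-idx (s ↣★) d =
  ⋀ (R (renTy-kind (λ _ → refl) d ·ᵗ tvar refl) (⟦⟧ᴵ-idx s (tvar refl)))

-- The type part of the translation never refers to expressions or specifications, so its behaviour
-- under renaming and substitution can be settled before theirs.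
mutual
  ⟦renTm⟧ᵗ : (ρ : Fin m → Fin m′) → ∀ t → ⟦ renTm ρ t ⟧ᵗ ≡ renTy ρ ⟦ t ⟧ᵗ
  ⟦renTm⟧ᵗ ρ (var u)   = refl
  ⟦renTm⟧ᵗ ρ ⁅ s ∣ ψ ⁆ = cong (Λ̄ ⟦ s ⟧ᴷ) (⟦renForm⟧ᵀ (lift 1 ρ) ψ)
  ⟦renTm⟧ᵗ ρ ⁅ ψ ⁆     = ⟦renForm⟧ᵀ ρ ψ

  ⟦renForm⟧ᵀ : (ρ : Fin m → Fin m′) → ∀ ψ → ⟦ renForm ρ ψ ⟧ᵀ ≡ renTy ρ ⟦ ψ ⟧ᵀ
  ⟦renForm⟧ᵀ ρ ⌜ t ⌝      = ⟦renTm⟧ᵗ ρ t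
  ⟦renForm⟧ᵀ ρ (t₁ ∈′ t₂) = cong₂ _·ᵗ_ (⟦renTm⟧ᵗ ρ t₂) (⟦renTm⟧ᵗ ρ t₁)
  ⟦renForm⟧ᵀ ρ (ψ₁ ⊐ ψ₂)  = cong₂ (λ τ₁ τ₂ → τ₁ ⇒ M τ₂) (⟦renForm⟧ᵀ ρ ψ₁) (⟦renForm⟧ᵀ ρ ψ₂)
  ⟦renForm⟧ᵀ ρ (all s ψ)  = cong (λ τ → Π ⟦ s ⟧ᴷ (M τ)) (⟦renForm⟧ᵀ (lift 1 ρ) ψ)

⟦liftTm⟧ᵗ : {θ : Fin m → Tm m′} {α : Fin m → Ty m′} →
            (∀ u → ⟦ θ u ⟧ᵗ ≡ α u) → ∀ u → ⟦ liftTm θ u ⟧ᵗ ≡ liftTy α u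
⟦liftTm⟧ᵗ         h zero    = refl
⟦liftTm⟧ᵗ {θ = θ} h (suc u) = ≡.trans (⟦renTm⟧ᵗ suc (θ u)) (cong (renTy suc) (h u))

mutual
  ⟦subTm⟧ᵗ : {θ : Fin m → Tm m′} {α : Fin m → Ty m′} →
             (∀ u → ⟦ θ u ⟧ᵗ ≡ α u) → ∀ t → ⟦ subTm θ t ⟧ᵗ ≡ subTy α ⟦ t ⟧ᵗ
  ⟦subTm⟧ᵗ h (var u)   = h u
  ⟦subTm⟧ᵗ h ⁅ s ∣ ψ ⁆ = cong (Λ̄ ⟦ s ⟧ᴷ) (⟦subForm⟧ᵀ (⟦liftTm⟧ᵗ h) ψ)
  ⟦subTm⟧ᵗ h ⁅ ψ ⁆     = ⟦subForm⟧ᵀ h ψ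

  ⟦subForm⟧ᵀ : {θ : Fin m → Tm m′} {α : Fin m → Ty m′} →
               (∀ u → ⟦ θ u ⟧ᵗ ≡ α u) → ∀ ψ → ⟦ subForm θ ψ ⟧ᵀ ≡ subTy α ⟦ ψ ⟧ᵀ
  ⟦subForm⟧ᵀ h ⌜ t ⌝      = ⟦subTm⟧ᵗ h t
  ⟦subForm⟧ᵀ h (t₁ ∈′ t₂) = cong₂ _·ᵗ_ (⟦subTm⟧ᵗ h t₂) (⟦subTm⟧ᵗ h t₁)
  ⟦subForm⟧ᵀ h (ψ₁ ⊐ ψ₂)  = cong₂ (λ τ₁ τ₂ → τ₁ ⇒ M τ₂) (⟦subForm⟧ᵀ h ψ₁) (⟦subForm⟧ᵀ h ψ₂)
  ⟦subForm⟧ᵀ h (all s ψ)  = cong (λ τ → Π ⟦ s ⟧ᴷ (M τ)) (⟦subForm⟧ᵀ (⟦liftTm⟧ᵗ h) ψ)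

⟦[]ᵘ⟧ᵀ : (ψ : Form (suc m)) (u : Tm m) → ⟦ ψ [ u ]ᵘ ⟧ᵀ ≡ ⟦ ψ ⟧ᵀ [ ⟦ u ⟧ᵗ ]ᵗ
⟦[]ᵘ⟧ᵀ ψ u = ⟦subForm⟧ᵀ (λ { zero → refl ; (suc _) → refl }) ψ

mutual
  tm-kind : {S : Vec Sort m} → ∀ {t s} → S ⊢ t ⦂ s → ⟦ S ⟧ᴷᶜ ⊢ ⟦ t ⟧ᵗ ∶ᵏ ⟦ s ⟧ᴷ
  tm-kind {S = S} (var {u} refl) = tvar (lookup-map u ⟦_⟧ᴷ S)
  tm-kind (cmp d)        = Λ̄ (form-kind d)
  tm-kind (cmp₀ d)       = form-kind d

  form-kind : {S : Vec Sort m} → ∀ {ψ} → S ⊢ ψ wff → ⟦ S ⟧ᴷᶜ ⊢ ⟦ ψ ⟧ᵀ ∶ᵏ ⋆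
  form-kind (⌜⌝ d)      = tm-kind d
  form-kind (mem d₁ d₂) = tm-kind d₂ ·ᵗ tm-kind d₁
  form-kind (imp d₁ d₂) = form-kind d₁ ⇒ M (form-kind d₂)
  form-kind (all d)     = Π (M (form-kind d))

-- The translation relative to an assignment of types and expressions to the HOL
-- variables: ⟦ ψ ⟧ˢ p is specAt tvar evar ψ p, and substitution instances of it
-- are again of the form specAt α ϑ ψ p.
mutual
  expAt : (Fin m → Ty k) → (Fin m → Exp k i t) → Tm m → Exp k i t
  expAt α ϑ (var u)   = ϑ u
  expAt α ϑ ⁅ s ∣ ψ ⁆ =
    -- The weakenings of `ϑ` come in the order in which `subExp` adds them under `Λᵉ` and `cmp`;
    -- `specAt` follows `subSpec` in the same way. The index stays as it is because it depends only
    -- on the bound X_u.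
    Λᵉ ⟦ s ⟧ᴷ (cmp (subTy (liftTy α) ⟦ ψ ⟧ᵀ) (⟦ s ⟧ᴵ (tvar zero))
      (specAt (liftTy α) (liftExp (renExp id id suc ∘ renExp suc id id ∘ ϑ)) ψ (pvar zero)))
  expAt α ϑ ⁅ ψ ⁆     = cmp₀ (subTy α ⟦ ψ ⟧ᵀ) (specAt α (renExp id id suc ∘ ϑ) ψ (pvar zero))

  specAt : (Fin m → Ty k) → (Fin m → Exp k i t) → Form m → Prog k t → Spec k i t
  specAt α ϑ ⌜ t ⌝ p      = p ε expAt α ϑ t
  specAt α ϑ (t₁ ∈′ t₂) p = p ⨾ expAt α ϑ t₁ ε (expAt α ϑ t₂ ∙ subTy α ⟦ t₁ ⟧ᵗ)
  specAt α ϑ (ψ₁ ⊐ ψ₂) p  =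
    ⊓ (subTy α ⟦ ψ₁ ⟧ᵀ)
      (specAt α (renExp id id suc ∘ ϑ) ψ₁ (pvar zero) ⊃
       ⟨ renProg id suc p · pvar zero ⟩
         specAt α (renExp id id suc ∘ renExp id id suc ∘ ϑ) ψ₂ (pvar zero))
  specAt α ϑ (all s ψ) p  =
    ⋂ ⟦ s ⟧ᴷ (∀′ (⟦ s ⟧ᴵ (tvar zero))
      (⟨ renProg suc id p ∙ tvar zero ⟩
        specAt (liftTy α) (renExp id id suc ∘ liftExp (renExp suc id id ∘ ϑ)) ψ (pvar zero)))

-- Renaming and substitution in the relative translation

liftTy-cong : {α α′ : Fin k → Ty k′} → (∀ u → α u ≡ α′ u) → ∀ u → liftTy α u ≡ liftTy α′ u
liftTy-cong h zero    = refl
liftTy-cong h (suc u) = cong (renTy suc) (h u)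

liftExp-lift : {η : Fin m → Fin m′} {ϑ : Fin m′ → Exp k i t} {ϑ′ : Fin m → Exp k i t} →
               (∀ u → ϑ (η u) ≡ ϑ′ u) → ∀ u → liftExp ϑ (lift 1 η u) ≡ liftExp ϑ′ u
liftExp-lift h zero    = refl
liftExp-lift h (suc u) = cong (renExp id suc id) (h u)

liftExp-cong : {ϑ ϑ′ : Fin m → Exp k i t} → (∀ u → ϑ u ≡ ϑ′ u) → ∀ u → liftExp ϑ u ≡ liftExp ϑ′ u
liftExp-cong h zero    = refl
liftExp-cong h (suc u) = cong (renExp id suc id) (h u)

liftExp-var : {η : Fin m → Fin i} {ϑ : Fin m → Exp k i t} →
              (∀ u → ϑ u ≡ evar (η u)) → ∀ u → liftExp ϑ u ≡ evar (lift 1 η u)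
liftExp-var h zero    = refl
liftExp-var h (suc u) = cong (renExp id suc id) (h u)

mutual
  expAt-cong : {α α′ : Fin m → Ty k} {ϑ ϑ′ : Fin m → Exp k i t} →
               (∀ u → α u ≡ α′ u) → (∀ u → ϑ u ≡ ϑ′ u) → ∀ t → expAt α ϑ t ≡ expAt α′ ϑ′ t
  expAt-cong f g (var u)   = g u
  expAt-cong f g ⁅ s ∣ ψ ⁆ = cong₂ (λ τ φ → Λᵉ ⟦ s ⟧ᴷ (cmp τ (⟦ s ⟧ᴵ (tvar zero)) φ))
    (subTy-cong (liftTy-cong f) ⟦ ψ ⟧ᵀ)
    (specAt-cong (liftTy-cong f)
      (liftExp-cong λ u → cong (renExp id id suc ∘ renExp suc id id) (g u)) ψ (pvar zero))
  expAt-cong f g ⁅ ψ ⁆     = cong₂ cmp₀ (subTy-cong f ⟦ ψ ⟧ᵀ)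
    (specAt-cong f (λ u → cong (renExp id id suc) (g u)) ψ (pvar zero))

  specAt-cong : {α α′ : Fin m → Ty k} {ϑ ϑ′ : Fin m → Exp k i t} →
                (∀ u → α u ≡ α′ u) → (∀ u → ϑ u ≡ ϑ′ u) → ∀ ψ p → specAt α ϑ ψ p ≡ specAt α′ ϑ′ ψ p
  specAt-cong f g ⌜ t ⌝ p      = cong (p ε_) (expAt-cong f g t)
  specAt-cong f g (t₁ ∈′ t₂) p = cong₂ (λ e₁ e₂ → p ⨾ e₁ ε e₂)
    (expAt-cong f g t₁) (cong₂ _∙_ (expAt-cong f g t₂) (subTy-cong f ⟦ t₁ ⟧ᵗ))
  specAt-cong f g (ψ₁ ⊐ ψ₂) p  = cong₂ ⊓ (subTy-cong f ⟦ ψ₁ ⟧ᵀ) (cong₂ (λ φ₁ φ₂ → φ₁ ⊃ (⟨ _ ⟩ φ₂))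
    (specAt-cong f (λ u → cong (renExp id id suc) (g u)) ψ₁ (pvar zero))
    (specAt-cong f (λ u → cong (renExp id id suc ∘ renExp id id suc) (g u)) ψ₂ (pvar zero)))
  specAt-cong f g (all s ψ) p  = cong (λ φ → ⋂ ⟦ s ⟧ᴷ (∀′ (⟦ s ⟧ᴵ (tvar zero)) (⟨ _ ⟩ φ)))
    (specAt-cong (liftTy-cong f)
      (λ u → cong (renExp id id suc) (liftExp-cong (λ v → cong (renExp suc id id) (g v)) u))
      ψ (pvar zero))

-- An induction is required because under binders the lifted identity assignments are identities
-- only pointwise.
mutual
  expAt-id : {α : Fin m → Ty m} {ϑ : Fin m → Exp m m t} →
             (∀ u → α u ≡ tvar u) → (∀ u → ϑ u ≡ evar u) → ∀ t → expAt α ϑ t ≡ ⟦ t ⟧ᵉ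
  expAt-id f g (var u)   = g u
  expAt-id f g ⁅ s ∣ ψ ⁆ = cong₂ (λ τ φ → Λᵉ ⟦ s ⟧ᴷ (cmp τ (⟦ s ⟧ᴵ (tvar zero)) φ))
    (subTy-id (liftTy-id f) ⟦ ψ ⟧ᵀ)
    (specAt-id (liftTy-id f)
      (liftExp-id λ u → cong (renExp id id suc ∘ renExp suc id id) (g u)) ψ (pvar zero))
  expAt-id f g ⁅ ψ ⁆     = cong₂ cmp₀ (subTy-id f ⟦ ψ ⟧ᵀ)
    (specAt-id f (λ u → cong (renExp id id suc) (g u)) ψ (pvar zero))

  specAt-id : {α : Fin m → Ty m} {ϑ : Fin m → Exp m m t} →
              (∀ u → α u ≡ tvar u) → (∀ u → ϑ u ≡ evar u) → ∀ ψ p → specAt α ϑ ψ p ≡ ⟦ ψ ⟧ˢ p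
  specAt-id f g ⌜ t ⌝ p      = cong (p ε_) (expAt-id f g t)
  specAt-id f g (t₁ ∈′ t₂) p = cong₂ (λ e₁ e₂ → p ⨾ e₁ ε e₂)
    (expAt-id f g t₁) (cong₂ _∙_ (expAt-id f g t₂) (subTy-id f ⟦ t₁ ⟧ᵗ))
  specAt-id f g (ψ₁ ⊐ ψ₂) p  = cong₂ ⊓ (subTy-id f ⟦ ψ₁ ⟧ᵀ) (cong₂ (λ φ₁ φ₂ → φ₁ ⊃ (⟨ _ ⟩ φ₂))
    (specAt-id f (λ u → cong (renExp id id suc) (g u)) ψ₁ (pvar zero))
    (specAt-id f (λ u → cong (renExp id id suc ∘ renExp id id suc) (g u)) ψ₂ (pvar zero)))
  specAt-id f g (all s ψ) p  = cong (λ φ → ⋂ ⟦ s ⟧ᴷ (∀′ (⟦ s ⟧ᴵ (tvar zero)) (⟨ _ ⟩ φ)))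
    (specAt-id (liftTy-id f)
      (λ u → cong (renExp id id suc) (liftExp-id (λ v → cong (renExp suc id id) (g v)) u))
      ψ (pvar zero))

  liftTy-id : {α : Fin k → Ty k} → (∀ X → α X ≡ tvar X) → ∀ X → liftTy α X ≡ tvar X
  liftTy-id h zero    = refl
  liftTy-id h (suc X) = cong (renTy suc) (h X)

  liftExp-id : {ϑ : Fin i → Exp k i t} → (∀ y → ϑ y ≡ evar y) → ∀ y → liftExp ϑ y ≡ evar y
  liftExp-id h zero    = refl
  liftExp-id h (suc y) = cong (renExp id suc id) (h y)

cmp-cong : {τ τ′ : Ty k} {σ σ′ : Idx k} {φ φ′ : Spec k (suc i) (suc t)} →
           τ ≡ τ′ → σ ≡ σ′ → φ ≡ φ′ → cmp τ σ φ ≡ cmp τ′ σ′ φ′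
cmp-cong refl refl refl = refl

-- Renaming and substitution are only considered where ϑ assigns variables and
-- the program is a variable: in general they would require commutations of
-- renaming and substitution in arbitrary expressions and programs.
mutual
  expAt-ren : {ρ : Fin k → Fin k′} {ζ : Fin i → Fin i′} (ξ : Fin t → Fin t′)
              {α : Fin m → Ty k} {α′ : Fin m → Ty k′}
              {ϑ : Fin m → Exp k i t} {ϑ′ : Fin m → Exp k′ i′ t′}
              {η : Fin m → Fin i} {η′ : Fin m → Fin i′} →
              (∀ u → renTy ρ (α u) ≡ α′ u) → (∀ u → ζ (η u) ≡ η′ u) →
              (∀ u → ϑ u ≡ evar (η u)) → (∀ u → ϑ′ u ≡ evar (η′ u)) →
              ∀ t → renExp ρ ζ ξ (expAt α ϑ t) ≡ expAt α′ ϑ′ t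
  expAt-ren {ρ = ρ} {ζ} ξ f h g g′ (var u) =
    ≡.trans (cong (renExp ρ ζ ξ) (g u)) (≡.trans (cong evar (h u)) (≡.sym (g′ u)))
  expAt-ren {ρ = ρ} ξ f h g g′ ⁅ s ∣ ψ ⁆ =
    cong (Λᵉ ⟦ s ⟧ᴷ) $ cmp-cong (renTy-subTy (lift-liftTy f) ⟦ ψ ⟧ᵀ)
      (renIdx-⟦⟧ᴵ (lift 1 ρ) s (tvar zero))
      (specAt-ren (lift 1 ξ) (lift-liftTy f) (lift-∘ h)
        (liftExp-var λ u → cong (renExp id id suc ∘ renExp suc id id) (g u))
        (liftExp-var λ u → cong (renExp id id suc ∘ renExp suc id id) (g′ u)) ψ zero)
  expAt-ren ξ f h g g′ ⁅ ψ ⁆ = cong₂ cmp₀ (renTy-subTy f ⟦ ψ ⟧ᵀ)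
    (specAt-ren (lift 1 ξ) f h
      (λ u → cong (renExp id id suc) (g u)) (λ u → cong (renExp id id suc) (g′ u)) ψ zero)

  specAt-ren : {ρ : Fin k → Fin k′} {ζ : Fin i → Fin i′} (ξ : Fin t → Fin t′)
               {α : Fin m → Ty k} {α′ : Fin m → Ty k′}
               {ϑ : Fin m → Exp k i t} {ϑ′ : Fin m → Exp k′ i′ t′}
               {η : Fin m → Fin i} {η′ : Fin m → Fin i′} →
               (∀ u → renTy ρ (α u) ≡ α′ u) → (∀ u → ζ (η u) ≡ η′ u) →
               (∀ u → ϑ u ≡ evar (η u)) → (∀ u → ϑ′ u ≡ evar (η′ u)) →
               ∀ ψ x → renSpec ρ ζ ξ (specAt α ϑ ψ (pvar x)) ≡ specAt α′ ϑ′ ψ (pvar (ξ x))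
  specAt-ren ξ f h g g′ ⌜ t ⌝ x      = cong (pvar (ξ x) ε_) (expAt-ren ξ f h g g′ t)
  specAt-ren ξ f h g g′ (t₁ ∈′ t₂) x = cong₂ (λ e₁ e₂ → pvar (ξ x) ⨾ e₁ ε e₂)
    (expAt-ren ξ f h g g′ t₁) (cong₂ _∙_ (expAt-ren ξ f h g g′ t₂) (renTy-subTy f ⟦ t₁ ⟧ᵗ))
  specAt-ren ξ f h g g′ (ψ₁ ⊐ ψ₂) x  =
    cong₂ ⊓ (renTy-subTy f ⟦ ψ₁ ⟧ᵀ) (cong₂ (λ φ₁ φ₂ → φ₁ ⊃ (⟨ _ ⟩ φ₂))
      (specAt-ren (lift 1 ξ) f h
        (λ u → cong (renExp id id suc) (g u)) (λ u → cong (renExp id id suc) (g′ u)) ψ₁ zero)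
      (specAt-ren (lift 1 (lift 1 ξ)) f h
        (λ u → cong (renExp id id suc ∘ renExp id id suc) (g u))
        (λ u → cong (renExp id id suc ∘ renExp id id suc) (g′ u)) ψ₂ zero))
  specAt-ren {ρ = ρ} ξ f h g g′ (all s ψ) x =
    cong₂ (λ σ φ → ⋂ ⟦ s ⟧ᴷ (∀′ σ (⟨ _ ⟩ φ)))
      (renIdx-⟦⟧ᴵ (lift 1 ρ) s (tvar zero))
      (specAt-ren (lift 1 ξ) (lift-liftTy f) (lift-∘ h)
        (λ u → cong (renExp id id suc) (liftExp-var (λ v → cong (renExp suc id id) (g v)) u))
        (λ u → cong (renExp id id suc) (liftExp-var (λ v → cong (renExp suc id id) (g′ v)) u))
        ψ zero)

-- The restriction to variables concerns the source only: `ϑ′` takes whatever `b` supplies, so y_u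
-- can receive the translation of an arbitrary term, and the subject can become an arbitrary program
-- `c x`.
mutual
  expAt-sub : {a : Fin k → Ty k′} {b : Fin i → Exp k′ i′ t′} (c : Fin t → Prog k′ t′)
              {α : Fin m → Ty k} {α′ : Fin m → Ty k′}
              {ϑ : Fin m → Exp k i t} {ϑ′ : Fin m → Exp k′ i′ t′} {η : Fin m → Fin i} →
              (∀ u → subTy a (α u) ≡ α′ u) → (∀ u → ϑ u ≡ evar (η u)) → (∀ u → b (η u) ≡ ϑ′ u) →
              ∀ t → subExp a b c (expAt α ϑ t) ≡ expAt α′ ϑ′ t
  expAt-sub {a = a} {b} c f g h (var u) = ≡.trans (cong (subExp a b c) (g u)) (h u)
  expAt-sub {a = a} c f g h ⁅ s ∣ ψ ⁆ =
    cong (Λᵉ ⟦ s ⟧ᴷ) $ cmp-cong (subTy-subTy (liftTy-liftTy f) ⟦ ψ ⟧ᵀ)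
      (subIdx-⟦⟧ᴵ (liftTy a) s (tvar zero))
      (specAt-sub _ (liftTy-liftTy f)
        (liftExp-var λ u → cong (renExp id id suc ∘ renExp suc id id) (g u))
        (liftExp-lift λ u → cong (renExp id id suc ∘ renExp suc id id) (h u)) ψ zero)
  expAt-sub c f g h ⁅ ψ ⁆ = cong₂ cmp₀ (subTy-subTy f ⟦ ψ ⟧ᵀ)
    (specAt-sub _ f
      (λ u → cong (renExp id id suc) (g u)) (λ u → cong (renExp id id suc) (h u)) ψ zero)

  specAt-sub : {a : Fin k → Ty k′} {b : Fin i → Exp k′ i′ t′} (c : Fin t → Prog k′ t′)
               {α : Fin m → Ty k} {α′ : Fin m → Ty k′}
               {ϑ : Fin m → Exp k i t} {ϑ′ : Fin m → Exp k′ i′ t′} {η : Fin m → Fin i} →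
               (∀ u → subTy a (α u) ≡ α′ u) → (∀ u → ϑ u ≡ evar (η u)) → (∀ u → b (η u) ≡ ϑ′ u) →
               ∀ ψ x → subSpec a b c (specAt α ϑ ψ (pvar x)) ≡ specAt α′ ϑ′ ψ (c x)
  specAt-sub c f g h ⌜ t ⌝ x      = cong (c x ε_) (expAt-sub c f g h t)
  specAt-sub c f g h (t₁ ∈′ t₂) x = cong₂ (λ e₁ e₂ → c x ⨾ e₁ ε e₂)
    (expAt-sub c f g h t₁) (cong₂ _∙_ (expAt-sub c f g h t₂) (subTy-subTy f ⟦ t₁ ⟧ᵗ))
  specAt-sub c f g h (ψ₁ ⊐ ψ₂) x  =
    -- The subjects of the modalities agree definitionally, as `liftProg c (suc x)` unfolds to
    -- `renProg id suc (c x)`.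
    cong₂ ⊓ (subTy-subTy f ⟦ ψ₁ ⟧ᵀ) (cong₂ (λ φ₁ φ₂ → φ₁ ⊃ (⟨ _ ⟩ φ₂))
      (specAt-sub _ f
        (λ u → cong (renExp id id suc) (g u)) (λ u → cong (renExp id id suc) (h u)) ψ₁ zero)
      (specAt-sub _ f
        (λ u → cong (renExp id id suc ∘ renExp id id suc) (g u))
        (λ u → cong (renExp id id suc ∘ renExp id id suc) (h u)) ψ₂ zero))
  specAt-sub {a = a} c f g h (all s ψ) x =
    cong₂ (λ σ φ → ⋂ ⟦ s ⟧ᴷ (∀′ σ (⟨ _ ⟩ φ)))
      (subIdx-⟦⟧ᴵ (liftTy a) s (tvar zero))
      (specAt-sub _ (liftTy-liftTy f)
        (λ u → cong (renExp id id suc) (liftExp-var (λ v → cong (renExp suc id id) (g v)) u))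
        (λ u → cong (renExp id id suc) (liftExp-lift (λ v → cong (renExp suc id id) (h v)) u))
        ψ zero)
-- Renaming on the HOL side merely precomposes the assignments, so here `ϑ` may be arbitrary.
mutual
  expAt-renTm : {r : Fin m → Fin m′} {α : Fin m′ → Ty k} {α′ : Fin m → Ty k}
                {ϑ : Fin m′ → Exp k i t} {ϑ′ : Fin m → Exp k i t} →
                (∀ u → α (r u) ≡ α′ u) → (∀ u → ϑ (r u) ≡ ϑ′ u) →
                ∀ t → expAt α ϑ (renTm r t) ≡ expAt α′ ϑ′ t
  expAt-renTm f g (var u) = g u
  expAt-renTm {r = r} f g ⁅ s ∣ ψ ⁆ =
    cong (Λᵉ ⟦ s ⟧ᴷ) $ cmp-cong (subTy-⟦renForm⟧ᵀ (liftTy-lift f) ψ) refl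
      (specAt-renForm (liftTy-lift f)
        (liftExp-lift λ u → cong (renExp id id suc ∘ renExp suc id id) (g u)) ψ (pvar zero))
  expAt-renTm f g ⁅ ψ ⁆ = cong₂ cmp₀ (subTy-⟦renForm⟧ᵀ f ψ)
    (specAt-renForm f (λ u → cong (renExp id id suc) (g u)) ψ (pvar zero))

  specAt-renForm : {r : Fin m → Fin m′} {α : Fin m′ → Ty k} {α′ : Fin m → Ty k}
                   {ϑ : Fin m′ → Exp k i t} {ϑ′ : Fin m → Exp k i t} →
                   (∀ u → α (r u) ≡ α′ u) → (∀ u → ϑ (r u) ≡ ϑ′ u) →
                   ∀ ψ p → specAt α ϑ (renForm r ψ) p ≡ specAt α′ ϑ′ ψ p
  specAt-renForm f g ⌜ t ⌝ p      = cong (p ε_) (expAt-renTm f g t)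
  specAt-renForm {r = r} {α} f g (t₁ ∈′ t₂) p = cong₂ (λ e₁ e₂ → p ⨾ e₁ ε e₂)
    (expAt-renTm f g t₁) (cong₂ _∙_ (expAt-renTm f g t₂)
      (≡.trans (cong (subTy α) (⟦renTm⟧ᵗ r t₁)) (subTy-renTy f ⟦ t₁ ⟧ᵗ)))
  specAt-renForm f g (ψ₁ ⊐ ψ₂) p  =
    cong₂ ⊓ (subTy-⟦renForm⟧ᵀ f ψ₁) (cong₂ (λ φ₁ φ₂ → φ₁ ⊃ (⟨ _ ⟩ φ₂))
      (specAt-renForm f (λ u → cong (renExp id id suc) (g u)) ψ₁ (pvar zero))
      (specAt-renForm f (λ u → cong (renExp id id suc ∘ renExp id id suc) (g u)) ψ₂ (pvar zero)))
  specAt-renForm f g (all s ψ) p  =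
    cong (λ φ → ⋂ ⟦ s ⟧ᴷ (∀′ (⟦ s ⟧ᴵ (tvar zero)) (⟨ _ ⟩ φ)))
      (specAt-renForm (liftTy-lift f)
        (λ u → cong (renExp id id suc) (liftExp-lift (λ v → cong (renExp suc id id) (g v)) u))
        ψ (pvar zero))

  subTy-⟦renForm⟧ᵀ : {r : Fin m → Fin m′} {α : Fin m′ → Ty k} {α′ : Fin m → Ty k} →
                     (∀ u → α (r u) ≡ α′ u) → ∀ ψ → subTy α ⟦ renForm r ψ ⟧ᵀ ≡ subTy α′ ⟦ ψ ⟧ᵀ
  subTy-⟦renForm⟧ᵀ {r = r} {α} f ψ =
    ≡.trans (cong (subTy α) (⟦renForm⟧ᵀ r ψ)) (subTy-renTy f ⟦ ψ ⟧ᵀ)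

subTy-⟦subForm⟧ᵀ : {θ : Fin m → Tm m′} {α : Fin m′ → Ty k} {α′ : Fin m → Ty k} →
                   (∀ u → subTy α ⟦ θ u ⟧ᵗ ≡ α′ u) → ∀ ψ → subTy α ⟦ subForm θ ψ ⟧ᵀ ≡ subTy α′ ⟦ ψ ⟧ᵀ
subTy-⟦subForm⟧ᵀ {α = α} f ψ =
  ≡.trans (cong (subTy α) (⟦subForm⟧ᵀ (λ _ → refl) ψ)) (subTy-subTy f ⟦ ψ ⟧ᵀ)

liftTy-liftTm : {θ : Fin m → Tm m′} {α : Fin m′ → Ty k} {α′ : Fin m → Ty k} →
                (∀ u → subTy α ⟦ θ u ⟧ᵗ ≡ α′ u) → ∀ u → subTy (liftTy α) ⟦ liftTm θ u ⟧ᵗ ≡ liftTy α′ u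
liftTy-liftTm                 h zero    = refl
liftTy-liftTm {θ = θ} {α = α} h (suc u) = begin
  subTy (liftTy α) ⟦ renTm suc (θ u) ⟧ᵗ   ≡⟨ cong (subTy (liftTy α)) (⟦renTm⟧ᵗ suc (θ u)) ⟩
  subTy (liftTy α) (renTy suc ⟦ θ u ⟧ᵗ)   ≡⟨ subTy-suc α ⟦ θ u ⟧ᵗ ⟩
  renTy suc (subTy α ⟦ θ u ⟧ᵗ)            ≡⟨ cong (renTy suc) (h u) ⟩
  renTy suc _                             ∎
  where open ≡.≡-Reasoning

-- Formulated for any `e` equal to the translated term so that uses can be chained, one for each
-- binder crossed in `expAt-subTm`.
expAt-wkˣ : {α : Fin m → Ty k} {ϑ : Fin m → Exp k i t} {η : Fin m → Fin i} → (∀ u → ϑ u ≡ evar (η u)) →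
            ∀ t {e} → expAt α ϑ t ≡ e → expAt α (renExp id id suc ∘ ϑ) t ≡ renExp id id suc e
expAt-wkˣ g t refl = ≡.sym
  (expAt-ren suc (λ u → renTy-id (λ _ → refl) _) (λ _ → refl) g (λ u → cong (renExp id id suc) (g u)) t)

expAt-wkᵗ : {α : Fin m → Ty k} {ϑ : Fin m → Exp k i t} {η : Fin m → Fin i} → (∀ u → ϑ u ≡ evar (η u)) →
            ∀ t {e} → expAt α ϑ t ≡ e → expAt (renTy suc ∘ α) (renExp suc id id ∘ ϑ) t ≡ renExp suc id id e
expAt-wkᵗ g t refl = ≡.sym
  (expAt-ren id (λ _ → refl) (λ _ → refl) g (λ u → cong (renExp suc id id) (g u)) t)

-- In the successor case `renTm suc` hides the head of both assignments, which is why the hypothesis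
-- speaks of `α ∘ suc`; the remaining shift of expression variables is pulled out as
-- `renExp id suc id`.
liftExp-liftTm : {θ : Fin m → Tm m′} {α : Fin (suc m′) → Ty k} {ϑ : Fin m′ → Exp k i t}
                 {ϑ′ : Fin m → Exp k i t} {η : Fin m′ → Fin i} →
                 (∀ u → ϑ u ≡ evar (η u)) → (∀ u → expAt (α ∘ suc) ϑ (θ u) ≡ ϑ′ u) →
                 ∀ u → expAt α (liftExp ϑ) (liftTm θ u) ≡ liftExp ϑ′ u
liftExp-liftTm                     g h zero    = refl
liftExp-liftTm {θ = θ} {α = α} {ϑ} g h (suc u) = begin
  expAt α (liftExp ϑ) (renTm suc (θ u))
    ≡⟨ expAt-renTm (λ _ → refl) (λ _ → refl) (θ u) ⟩
  expAt (α ∘ suc) (renExp id suc id ∘ ϑ) (θ u)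
    ≡⟨ expAt-ren id (λ _ → renTy-id (λ _ → refl) _) (λ _ → refl) g
         (λ v → cong (renExp id suc id) (g v)) (θ u) ⟨
  renExp id suc id (expAt (α ∘ suc) ϑ (θ u))
    ≡⟨ cong (renExp id suc id) (h u) ⟩
  renExp id suc id _ ∎
  where open ≡.≡-Reasoning

-- HOL substitution becomes a change of assignment: the term `θ u` is evaluated in the old one.
-- Since EffHOL substitution (`expAt-sub`) also ends in a changed assignment, the two kinds of
-- substitution can be compared by comparing assignments.
mutual
  expAt-subTm : {θ : Fin m → Tm m′} {α : Fin m′ → Ty k} {α′ : Fin m → Ty k}
                {ϑ : Fin m′ → Exp k i t} {ϑ′ : Fin m → Exp k i t} {η : Fin m′ → Fin i} →
                (∀ u → subTy α ⟦ θ u ⟧ᵗ ≡ α′ u) → (∀ u → ϑ u ≡ evar (η u)) →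
                (∀ u → expAt α ϑ (θ u) ≡ ϑ′ u) → ∀ t → expAt α ϑ (subTm θ t) ≡ expAt α′ ϑ′ t
  expAt-subTm f g h (var u)   = h u
  expAt-subTm {θ = θ} f g h ⁅ s ∣ ψ ⁆ =
    cong (Λᵉ ⟦ s ⟧ᴷ) $ cmp-cong (subTy-⟦subForm⟧ᵀ (liftTy-liftTm {θ = θ} f) ψ) refl
      (specAt-subForm (liftTy-liftTm {θ = θ} f)
        (liftExp-var λ u → cong (renExp id id suc ∘ renExp suc id id) (g u))
        (liftExp-liftTm {θ = θ} (λ u → cong (renExp id id suc ∘ renExp suc id id) (g u))
          (λ u → expAt-wkˣ (λ v → cong (renExp suc id id) (g v)) (θ u) (expAt-wkᵗ g (θ u) (h u))))
        ψ (pvar zero))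
  expAt-subTm {θ = θ} f g h ⁅ ψ ⁆ = cong₂ cmp₀ (subTy-⟦subForm⟧ᵀ {θ = θ} f ψ)
    (specAt-subForm f (λ u → cong (renExp id id suc) (g u)) (λ u → expAt-wkˣ g (θ u) (h u)) ψ (pvar zero))

  specAt-subForm : {θ : Fin m → Tm m′} {α : Fin m′ → Ty k} {α′ : Fin m → Ty k}
                   {ϑ : Fin m′ → Exp k i t} {ϑ′ : Fin m → Exp k i t} {η : Fin m′ → Fin i} →
                   (∀ u → subTy α ⟦ θ u ⟧ᵗ ≡ α′ u) → (∀ u → ϑ u ≡ evar (η u)) →
                   (∀ u → expAt α ϑ (θ u) ≡ ϑ′ u) →
                   ∀ ψ p → specAt α ϑ (subForm θ ψ) p ≡ specAt α′ ϑ′ ψ p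
  specAt-subForm f g h ⌜ t ⌝ p      = cong (p ε_) (expAt-subTm f g h t)
  specAt-subForm {α = α} f g h (t₁ ∈′ t₂) p = cong₂ (λ e₁ e₂ → p ⨾ e₁ ε e₂)
    (expAt-subTm f g h t₁) (cong₂ _∙_ (expAt-subTm f g h t₂)
      (≡.trans (cong (subTy α) (⟦subTm⟧ᵗ (λ _ → refl) t₁)) (subTy-subTy f ⟦ t₁ ⟧ᵗ)))
  specAt-subForm {θ = θ} f g h (ψ₁ ⊐ ψ₂) p  =
    cong₂ ⊓ (subTy-⟦subForm⟧ᵀ {θ = θ} f ψ₁) (cong₂ (λ φ₁ φ₂ → φ₁ ⊃ (⟨ _ ⟩ φ₂))
      (specAt-subForm f (λ u → cong (renExp id id suc) (g u)) (λ u → expAt-wkˣ g (θ u) (h u)) ψ₁ (pvar zero))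
      (specAt-subForm f (λ u → cong (renExp id id suc ∘ renExp id id suc) (g u))
        (λ u → expAt-wkˣ (λ v → cong (renExp id id suc) (g v)) (θ u) (expAt-wkˣ g (θ u) (h u)))
        ψ₂ (pvar zero)))
  specAt-subForm {θ = θ} f g h (all s ψ) p  =
    cong (λ φ → ⋂ ⟦ s ⟧ᴷ (∀′ (⟦ s ⟧ᴵ (tvar zero)) (⟨ _ ⟩ φ)))
      (specAt-subForm (liftTy-liftTm {θ = θ} f)
        (λ u → cong (renExp id id suc) (liftExp-var (λ v → cong (renExp suc id id) (g v)) u))
        (λ u → expAt-wkˣ (liftExp-var (λ v → cong (renExp suc id id) (g v))) (liftTm θ u)
          (liftExp-liftTm {θ = θ} (λ v → cong (renExp suc id id) (g v)) (λ v → expAt-wkᵗ g (θ v) (h v)) u))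
        ψ (pvar zero))

-- Well-formedness of the relative translation

lift-suc-[]ᵗ : (τ : Ty (suc k)) → renTy (lift 1 suc) τ [ tvar zero ]ᵗ ≡ τ
lift-suc-[]ᵗ τ =
  ≡.trans (subTy-renTy (λ { zero → refl ; (suc _) → refl }) τ) (subTy-id (λ _ → refl) τ)

prog-subst : {K : Vec Kind k} {T : Vec (Ty k) t} {p : Prog k t} {τ τ′ : Ty k} →
             τ ≡ τ′ → K ∣ T ⊢ p ∶ τ → K ∣ T ⊢ p ∶ τ′
prog-subst refl d = d

exp-subst : {K : Vec Kind k} {I : Vec (Idx k) i} {T : Vec (Ty k) t} {e : Exp k i t} {σ σ′ : Idx k} →
            σ ≡ σ′ → K ∣ I ∣ T ⊢ e ∶ σ → K ∣ I ∣ T ⊢ e ∶ σ′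
exp-subst refl d = d

At-kind : {S : Vec Sort m} {K : Vec Kind k} {α : Fin m → Ty k} →
          (∀ u → K ⊢ α u ∶ᵏ ⟦ lookup S u ⟧ᴷ) → ∀ {τ κ} → ⟦ S ⟧ᴷᶜ ⊢ τ ∶ᵏ κ → K ⊢ subTy α τ ∶ᵏ κ
At-kind {S = S} h = subTy-kind λ u → subst (_ ⊢ _ ∶ᵏ_) (≡.sym (lookup-map u ⟦_⟧ᴷ S)) (h u)

wkᵗ-sort : {S : Vec Sort m} {K : Vec Kind k} {κ : Kind} {I : Vec (Idx k) i} {T : Vec (Ty k) t}
           {α : Fin m → Ty k} {ϑ : Fin m → Exp k i t} →
           (∀ u → K ∣ I ∣ T ⊢ ϑ u ∶ ⟦ lookup S u ⟧ᴵ (α u)) →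
           ∀ u → κ ∷ K ∣ map (renIdx suc) I ∣ map (renTy suc) T
                   ⊢ renExp suc id id (ϑ u) ∶ ⟦ lookup S u ⟧ᴵ (renTy suc (α u))
wkᵗ-sort {S = S} h u = exp-subst (renIdx-⟦⟧ᴵ suc (lookup S u) _) (wkᵗ-exp (h u))

module _ {S : Vec Sort m} {s : Sort} where

  liftTy-sort : {K : Vec Kind k} {α : Fin m → Ty k} → (∀ u → K ⊢ α u ∶ᵏ ⟦ lookup S u ⟧ᴷ) →
                ∀ u → ⟦ s ⟧ᴷ ∷ K ⊢ liftTy α u ∶ᵏ ⟦ lookup (s ∷ S) u ⟧ᴷ
  liftTy-sort h zero    = tvar refl
  liftTy-sort h (suc u) = renTy-kind (λ _ → refl) (h u)

  liftExp-sort : {K : Vec Kind (suc k)} {I : Vec (Idx (suc k)) i} {T : Vec (Ty (suc k)) t}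
                 {α : Fin m → Ty (suc k)} {ϑ : Fin m → Exp (suc k) i t} {τ : Ty (suc k)} →
                 (∀ u → K ∣ I ∣ T ⊢ ϑ u ∶ ⟦ lookup S u ⟧ᴵ (α u)) →
                 ∀ u → K ∣ ⟦ s ⟧ᴵ τ ∷ I ∣ T ⊢ liftExp ϑ u ∶ ⟦ lookup (s ∷ S) u ⟧ᴵ ((τ ∷ᶠ α) u)
  liftExp-sort h zero    = evar refl
  liftExp-sort h (suc u) = wkʸ-exp (h u)

mutual
  expAt-type : {S : Vec Sort m} {K : Vec Kind k} {I : Vec (Idx k) i} {T : Vec (Ty k) t}
               {α : Fin m → Ty k} {ϑ : Fin m → Exp k i t} →
               (∀ u → K ⊢ α u ∶ᵏ ⟦ lookup S u ⟧ᴷ) →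
               (∀ u → K ∣ I ∣ T ⊢ ϑ u ∶ ⟦ lookup S u ⟧ᴵ (α u)) →
               ∀ {t s} → S ⊢ t ⦂ s → K ∣ I ∣ T ⊢ expAt α ϑ t ∶ ⟦ s ⟧ᴵ (subTy α ⟦ t ⟧ᵗ)
  expAt-type f g (var {u} refl) = g u
  expAt-type {S = S} {α = α} f g (cmp {s} {ψ} d) =
    conv (Λᵉ (cmp (At-kind (liftTy-sort f) (form-kind d)) (⟦⟧ᴵ-idx s (tvar refl))
           (specAt-spec (liftTy-sort f) (liftExp-sort λ u → wkˣ-exp (wkᵗ-sort {S = S} g u)) d (pvar refl))))
         -- The index demanded of a predicate applies its type to X₀. For a comprehension this
         -- application is a redex whose contractum is `ψ′`, the type that `cmp` actually carries.
         (⋀ (R (subst (_≡ᵗ renTy suc (Λ̄ ⟦ s ⟧ᴷ ψ′) ·ᵗ tvar zero) (lift-suc-[]ᵗ ψ′) (sym β))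
               refl))
         (⟦⟧ᴵ-idx (s ↣★) (At-kind f (tm-kind (cmp d))))
    where ψ′ = subTy (liftTy α) ⟦ ψ ⟧ᵀ
  expAt-type f g (cmp₀ d) =
    cmp₀ (At-kind f (form-kind d)) (specAt-spec f (λ u → wkˣ-exp (g u)) d (pvar refl))

  specAt-spec : {S : Vec Sort m} {K : Vec Kind k} {I : Vec (Idx k) i} {T : Vec (Ty k) t}
                {α : Fin m → Ty k} {ϑ : Fin m → Exp k i t} →
                (∀ u → K ⊢ α u ∶ᵏ ⟦ lookup S u ⟧ᴷ) →
                (∀ u → K ∣ I ∣ T ⊢ ϑ u ∶ ⟦ lookup S u ⟧ᴵ (α u)) →
                ∀ {ψ p} → S ⊢ ψ wff → K ∣ T ⊢ p ∶ subTy α ⟦ ψ ⟧ᵀ → K ∣ I ∣ T ⊢ specAt α ϑ ψ p spec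
  specAt-spec f g (⌜⌝ d) e = mem₀ e (expAt-type f g d)
  specAt-spec {α = α} f g (mem {t₁} {t₂} {s} d₁ d₂) e =
    mem e (exp-subst
             (cong₂ (λ τ σ → R (τ ·ᵗ subTy α ⟦ t₁ ⟧ᵗ) σ)
               (suc-[]ᵗ (subTy α ⟦ t₂ ⟧ᵗ) _) (subIdx-⟦⟧ᴵ _ s (tvar zero)))
             (expAt-type f g d₂ ∙ At-kind f (tm-kind d₁)))
          (expAt-type f g d₁)
  specAt-spec f g (imp d₁ d₂) e =
    ⊓ (At-kind f (form-kind d₁))
      (specAt-spec f (λ u → wkˣ-exp (g u)) d₁ (pvar refl) ⊃
       ⟨ wkˣ-prog e · pvar refl ⟩
         specAt-spec f (λ u → wkˣ-exp (wkˣ-exp (g u))) d₂ (pvar refl))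
  specAt-spec {S = S} {α = α} f g (all {s} {ψ} d) e =
    ⋂ (∀′ (⟦⟧ᴵ-idx s (tvar refl))
      (⟨ prog-subst (cong M (lift-suc-[]ᵗ (subTy (liftTy α) ⟦ ψ ⟧ᵀ))) (wkᵗ-prog e ∙ tvar refl) ⟩
        specAt-spec (liftTy-sort f) (λ u → wkˣ-exp (liftExp-sort (wkᵗ-sort {S = S} g) u)) d (pvar refl)))

-- Derived rules of EffHOL

module _ {K : Vec Kind k} {I : Vec (Idx k) i} {T : Vec (Ty k) t} {Φ : List (Spec k i t)} where

  ⇒-ctx : ∀ {φ} → K ∣ I ∣ T ⊢ Φ ⇒ φ → K ⊢ I ∣ T ctx
  ⇒-ctx (derive c _ _ _) = c

  ⇒-spec : ∀ {φ} → K ∣ I ∣ T ⊢ Φ ⇒ φ → K ∣ I ∣ T ⊢ φ spec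
  ⇒-spec (derive _ _ s _) = s

  ⇒-subst : ∀ {φ φ′} → φ ≡ φ′ → K ∣ I ∣ T ⊢ Φ ⇒ φ → K ∣ I ∣ T ⊢ Φ ⇒ φ′
  ⇒-subst refl D = D

  ⇒ʳ-subst : ∀ {φ φ′} → φ ≡ φ′ → K ∣ I ∣ T ⊢ Φ ⇒ʳ φ → K ∣ I ∣ T ⊢ Φ ⇒ʳ φ′
  ⇒ʳ-subst refl D = D

  -- Derivability includes well-formedness of the whole judgment; the part about contexts and
  -- hypotheses is inherited from a judgment already derived, leaving only the new conclusion to
  -- check.
  next : ∀ {φ φ′} → K ∣ I ∣ T ⊢ Φ ⇒ φ → K ∣ I ∣ T ⊢ φ′ spec → K ∣ I ∣ T ⊢ Φ ⇒ʳ φ′ → K ∣ I ∣ T ⊢ Φ ⇒ φ′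
  next (derive c h _ _) s D = derive c h s D

module _ {K : Vec Kind k} {I : Vec (Idx k) i} {T : Vec (Ty k) t} {Φ : List (Spec k i t)} where

  -- `Mon` rewrites what holds under `⟨ p₁ ⟩` into a second modality, and `Mod-E` merges the two.
  -- The renaming `lift 1 suc` fixes the result variable and skips the one bound by the let.
  bind : ∀ {p₁ p₂ τ₁ τ₂ φ₁ φ} →
         K ∣ T ⊢ p₁ ∶ M τ₁ → K ∣ I ∣ T ⊢ Φ ⇒ ⟨ p₁ ⟩ φ₁ →
         K ∣ τ₁ ∷ T ⊢ p₂ ∶ M τ₂ →
         K ∣ I ∣ τ₁ ∷ T ⊢ φ₁ List.∷ List.map (renSpec id id suc) Φ ⇒ ⟨ p₂ ⟩ renSpec id id (lift 1 suc) φ →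
         K ∣ I ∣ τ₂ ∷ T ⊢ φ spec → K ∣ I ∣ T ⊢ Φ ⇒ ⟨ let′ p₁ p₂ ⟩ φ
  bind e₁ D₁ e₂ D₂ s = next D₁ (⟨ let′ e₁ e₂ ⟩ s)
    (Mod-E (next D₁ (⟨ e₁ ⟩ ⇒-spec D₂) (Mon e₁ D₂ D₁)))

  wkˣ-hyps : ∀ {τ} → Allˡ (K ∣ I ∣ T ⊢_spec) Φ →
             Allˡ (K ∣ I ∣ τ ∷ T ⊢_spec) (List.map (renSpec id id suc) Φ)
  wkˣ-hyps h = Allˡ-map⁺ (Allˡ.map (renSpec-spec (λ _ → refl) id-RenI wkˣ-RenT) h)

  wkʸ-hyps : ∀ {σ} → Allˡ (K ∣ I ∣ T ⊢_spec) Φ →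
             Allˡ (K ∣ σ ∷ I ∣ T ⊢_spec) (List.map (renSpec id suc id) Φ)
  wkʸ-hyps h = Allˡ-map⁺ (Allˡ.map (renSpec-spec (λ _ → refl) wkʸ-RenI id-RenT) h)

  wkᵗ-hyps : ∀ {κ} → Allˡ (K ∣ I ∣ T ⊢_spec) Φ →
             Allˡ (κ ∷ K ∣ map (renIdx suc) I ∣ map (renTy suc) T ⊢_spec) (List.map (renSpec suc id id) Φ)
  wkᵗ-hyps h = Allˡ-map⁺ (Allˡ.map (renSpec-spec (λ _ → refl) wkᵗ-RenI wkᵗ-RenT) h)

wkᵗ-ctx : {K : Vec Kind k} {I : Vec (Idx k) i} {T : Vec (Ty k) t} {κ : Kind} → K ⊢ I ∣ T ctx →
          κ ∷ K ⊢ map (renIdx suc) I ∣ map (renTy suc) T ctx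
wkᵗ-ctx (cI , cT) = All-map⁺ (All.map (renIdx-idx λ _ → refl) cI) , All-map⁺ (All.map (renTy-kind λ _ → refl) cT)

-- Instantiating the HOL variables by distinct variables of an EffHOL context

tyAt : (Fin m → Fin k) → Form m → Ty k
tyAt ρ ψ = subTy (tvar ∘ ρ) ⟦ ψ ⟧ᵀ

instTy : (Fin m → Fin k) → Tm m → Fin (suc m) → Ty k
instTy ρ u = subTy (tvar ∘ ρ) ⟦ u ⟧ᵗ ∷ᶠ (tvar ∘ ρ)

tyAt-[]ᵘ : (ρ : Fin m → Fin k) → ∀ ψ u → tyAt ρ (ψ [ u ]ᵘ) ≡ subTy (instTy ρ u) ⟦ ψ ⟧ᵀ
tyAt-[]ᵘ ρ ψ u = subTy-⟦subForm⟧ᵀ {θ = u ∷ᶠ var} (λ { zero → refl ; (suc _) → refl }) ψ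

module _ (ρ : Fin m → Fin k) (ζ : Fin m → Fin i) where

  specIn : Form m → Prog k t → Spec k i t
  specIn = specAt (tvar ∘ ρ) (evar ∘ ζ)

  specIn-ren : (ξ : Fin t → Fin t′) → ∀ ψ x → renSpec id id ξ (specIn ψ (pvar x)) ≡ specIn ψ (pvar (ξ x))
  specIn-ren ξ = specAt-ren ξ (λ _ → refl) (λ _ → refl) (λ _ → refl) (λ _ → refl)

  specIn-[]ˣ : ∀ ψ (p : Prog k t) → specIn ψ (pvar zero) [ p ]ˣ ≡ specIn ψ p
  specIn-[]ˣ ψ p = specAt-sub _ (λ _ → refl) (λ _ → refl) (λ _ → refl) ψ zero

  module _ (ψ : Form (suc m)) (u : Tm m) where

    -- X_u has been instantiated, whereas y_u is still bound, as variable zero.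
    bodyAt : Prog k t → Spec k (suc i) t
    bodyAt = specAt (instTy ρ u) (evar ∘ lift 1 ζ) ψ

    -- Both sides equal `specAt` at the assignment sending u to its type and its expression, by
    -- `specAt-sub` on the left and `specAt-subForm` on the right. Keeping `b` pointwise covers
    -- substitution at top level (`∈-body`) as well as below a modality (`all-elim`).
    bodyAt-[]ᵘ : {b : Fin (suc i) → Exp k i t} (c : Fin t′ → Prog k t) →
                 b zero ≡ expAt (tvar ∘ ρ) (evar ∘ ζ) u → (∀ y → b (suc y) ≡ evar y) →
                 ∀ x → subSpec tvar b c (bodyAt (pvar x)) ≡ specIn (ψ [ u ]ᵘ) (c x)
    bodyAt-[]ᵘ c e h x = ≡.trans
      (specAt-sub c {α = instTy ρ u} {α′ = instTy ρ u} {ϑ′ = expAt (tvar ∘ ρ) (evar ∘ ζ) u ∷ᶠ (evar ∘ ζ)}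
        (λ _ → subTy-id (λ _ → refl) _) (λ _ → refl)
        (λ { zero → e ; (suc v) → h (ζ v) }) ψ x)
      (≡.sym (specAt-subForm (λ { zero → refl ; (suc _) → refl }) (λ _ → refl)
        (λ { zero → refl ; (suc _) → refl }) ψ (c x)))

    bodyAt-[]ˣ : (x : Fin t) → bodyAt (pvar zero) [ pvar x ]ˣ ≡ bodyAt (pvar x)
    bodyAt-[]ˣ x = specAt-sub _ (λ _ → subTy-id (λ _ → refl) _) (λ _ → refl) (λ _ → refl) ψ zero

In-kind : {S : Vec Sort m} {K : Vec Kind k} {ρ : Fin m → Fin k} →
          (∀ u → lookup K (ρ u) ≡ ⟦ lookup S u ⟧ᴷ) →
          ∀ {τ κ} → ⟦ S ⟧ᴷᶜ ⊢ τ ∶ᵏ κ → K ⊢ subTy (tvar ∘ ρ) τ ∶ᵏ κ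
In-kind {S = S} kinds = At-kind {S = S} λ u → tvar (kinds u)

module _ {S : Vec Sort m} {K : Vec Kind k} {I : Vec (Idx k) i} {ρ : Fin m → Fin k} {ζ : Fin m → Fin i}
         (kinds : ∀ u → lookup K (ρ u) ≡ ⟦ lookup S u ⟧ᴷ)
         (idxs : ∀ u → lookup I (ζ u) ≡ ⟦ lookup S u ⟧ᴵ (tvar (ρ u)))
         where

  specIn-spec : ∀ {T : Vec (Ty k) t} {ψ p} → S ⊢ ψ wff → K ∣ T ⊢ p ∶ tyAt ρ ψ →
                K ∣ I ∣ T ⊢ specIn ρ ζ ψ p spec
  specIn-spec = specAt-spec (λ u → tvar (kinds u)) (λ u → evar (idxs u))

  module _ {s : Sort} {ψ : Form (suc m)} {u : Tm m}
           (dψ : s ∷ S ⊢ ψ wff) (du : S ⊢ u ⦂ s) (dψu : S ⊢ ψ [ u ]ᵘ wff) where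

    private
      τᵤ : Ty k
      τᵤ = subTy (tvar ∘ ρ) ⟦ u ⟧ᵗ

      eᵤ : Exp k i t
      eᵤ = expAt (tvar ∘ ρ) (evar ∘ ζ) u

      eᵤ-type : ∀ {T : Vec (Ty k) t} → K ∣ I ∣ T ⊢ eᵤ ∶ ⟦ s ⟧ᴵ τᵤ
      eᵤ-type = expAt-type (λ v → tvar (kinds v)) (λ v → evar (idxs v)) du

      τᵤ-kind : K ⊢ τᵤ ∶ᵏ ⟦ s ⟧ᴷ
      τᵤ-kind = In-kind kinds (tm-kind du)

      body-kinds : ∀ v → K ⊢ instTy ρ u v ∶ᵏ ⟦ lookup (s ∷ S) v ⟧ᴷ
      body-kinds zero    = τᵤ-kind
      body-kinds (suc v) = tvar (kinds v)

      body-spec : ∀ {T : Vec (Ty k) t} {p} → K ∣ T ⊢ p ∶ subTy (instTy ρ u) ⟦ ψ ⟧ᵀ →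
                  K ∣ ⟦ s ⟧ᴵ τᵤ ∷ I ∣ T ⊢ bodyAt ρ ζ ψ u p spec
      body-spec = specAt-spec body-kinds
        (λ { zero → evar refl ; (suc v) → evar (idxs v) }) dψ

    module _ {T : Vec (Ty k) t} {x : Fin t} where

      private
        -- The translated comprehension after its `Λᵉ` has consumed `τᵤ`: conversion instantiates
        -- X_u, and `Mem` is left to instantiate x and y_u.
        comprehension : Exp k i t
        comprehension = cmp (subTy (instTy ρ u) ⟦ ψ ⟧ᵀ) (⟦ s ⟧ᴵ τᵤ) (bodyAt ρ ζ ψ u (pvar zero))

        ∈-body : bodyAt ρ ζ ψ u (pvar zero) [ pvar x ]ˣ [ eᵤ ]ʸ ≡ specIn ρ ζ (ψ [ u ]ᵘ) (pvar x)
        ∈-body = ≡.trans (cong _[ eᵤ ]ʸ (bodyAt-[]ˣ ρ ζ ψ u x))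
          (bodyAt-[]ᵘ ρ ζ ψ u pvar refl (λ _ → refl) x)

        ∈-≡ˢ : specIn ρ ζ (u ∈′ ⁅ s ∣ ψ ⁆) (pvar x) ≡ˢ pvar x ⨾ eᵤ ε comprehension
        ∈-≡ˢ = refl ⨾ refl ε subst (expAt (tvar ∘ ρ) (evar ∘ ζ) ⁅ s ∣ ψ ⁆ ∙ τᵤ ≡ᵉ_)
          (cmp-cong (liftTy-[]ᵗ (tvar ∘ ρ) ⟦ ψ ⟧ᵀ τᵤ) (subIdx-⟦⟧ᴵ _ s (tvar zero))
            (specAt-sub _ {η = lift 1 ζ} (λ { zero → refl ; (suc _) → refl })
              (λ { zero → refl ; (suc _) → refl }) (λ { zero → refl ; (suc _) → refl }) ψ zero))
          β

        ∈-spec : K ∣ T ⊢ pvar x ∶ tyAt ρ (ψ [ u ]ᵘ) → K ∣ I ∣ T ⊢ pvar x ⨾ eᵤ ε comprehension spec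
        ∈-spec e = mem (prog-subst (tyAt-[]ᵘ ρ ψ u) e)
          (cmp (At-kind body-kinds (form-kind dψ)) (⟦⟧ᴵ-idx s τᵤ-kind) (body-spec (pvar refl))) eᵤ-type

        -- A membership and its unfolding have different but convertible types, which is what
        -- permits them to share a realizer.
        tyAt-∈ : tyAt ρ (u ∈′ ⁅ s ∣ ψ ⁆) ≡ᵗ tyAt ρ (ψ [ u ]ᵘ)
        tyAt-∈ = subst (tyAt ρ (u ∈′ ⁅ s ∣ ψ ⁆) ≡ᵗ_)
          (≡.trans (liftTy-[]ᵗ (tvar ∘ ρ) ⟦ ψ ⟧ᵀ τᵤ) (≡.sym (tyAt-[]ᵘ ρ ψ u))) β

        ∈-wff : S ⊢ u ∈′ ⁅ s ∣ ψ ⁆ wff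
        ∈-wff = mem du (cmp dψ)

      ∈-intro : ∀ {Φ} → K ∣ T ⊢ pvar x ∶ tyAt ρ (ψ [ u ]ᵘ) →
                K ∣ I ∣ T ⊢ Φ ⇒ specIn ρ ζ (ψ [ u ]ᵘ) (pvar x) →
                K ∣ I ∣ T ⊢ Φ ⇒ specIn ρ ζ (u ∈′ ⁅ s ∣ ψ ⁆) (pvar x)
      ∈-intro e D = next D (specIn-spec ∈-wff (conv e (sym tyAt-∈) (In-kind kinds (form-kind ∈-wff))))
        (conv (next D (∈-spec e) (Mem-I (⇒-subst (≡.sym ∈-body) D))) (sym ∈-≡ˢ))

      ∈-elim : ∀ {Φ} → K ∣ T ⊢ pvar x ∶ tyAt ρ (u ∈′ ⁅ s ∣ ψ ⁆) →
               K ∣ I ∣ T ⊢ Φ ⇒ specIn ρ ζ (u ∈′ ⁅ s ∣ ψ ⁆) (pvar x) →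
               K ∣ I ∣ T ⊢ Φ ⇒ specIn ρ ζ (ψ [ u ]ᵘ) (pvar x)
      ∈-elim e D = next D (specIn-spec dψu e′)
        (⇒ʳ-subst ∈-body (Mem-E (next D (∈-spec e′) (conv D ∈-≡ˢ))))
        where
        e′ : K ∣ T ⊢ pvar x ∶ tyAt ρ (ψ [ u ]ᵘ)
        e′ = conv e tyAt-∈ (In-kind kinds (form-kind dψu))

      ∙-type : K ∣ T ⊢ pvar x ∶ tyAt ρ (all s ψ) → K ∣ T ⊢ pvar x ∙ τᵤ ∶ M (tyAt ρ (ψ [ u ]ᵘ))
      ∙-type e = prog-subst
        (cong M (≡.trans (liftTy-[]ᵗ (tvar ∘ ρ) ⟦ ψ ⟧ᵀ τᵤ) (≡.sym (tyAt-[]ᵘ ρ ψ u)))) (e ∙ τᵤ-kind)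

      all-elim : ∀ {Φ} → K ∣ T ⊢ pvar x ∶ tyAt ρ (all s ψ) →
                 K ∣ I ∣ T ⊢ Φ ⇒ specIn ρ ζ (all s ψ) (pvar x) →
                 K ∣ I ∣ T ⊢ Φ ⇒ ⟨ pvar x ∙ τᵤ ⟩ specIn ρ ζ (ψ [ u ]ᵘ) (pvar zero)
      all-elim e D = next D
        (⟨ ∙-type e ⟩ specIn-spec dψu (pvar refl))
        -- `⋂-E` has instantiated X_u and `∀-E` now instantiates y_u. The latter lies below a
        -- modality, so `eᵤ` arrives weakened; `expAt-wkˣ` recognizes it as the translation of u in
        -- the larger context.
        (⇒ʳ-subst (cong₂ (λ τ φ → ⟨ pvar x ∙ τ ⟩ φ) (subTy-id (λ _ → refl) τᵤ)
                    (bodyAt-[]ᵘ ρ ζ ψ u _ (≡.sym (expAt-wkˣ (λ _ → refl) u refl)) (λ _ → refl) zero))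
          (∀-E (next D (∀′ (⟦⟧ᴵ-idx s τᵤ-kind) (⟨ e′ ⟩ body-spec (pvar refl)))
                 (⇒ʳ-subst (cong₂ (λ σ φ → ∀′ σ (⟨ pvar x ∙ τᵤ ⟩ φ))
                              (subIdx-⟦⟧ᴵ _ s (tvar zero))
                              (specAt-sub _ {η = lift 1 ζ} (λ { zero → refl ; (suc _) → refl })
                                (λ { zero → refl ; (suc _) → refl }) (λ { zero → refl ; (suc _) → refl })
                                ψ zero))
                   (⋂-E D τᵤ-kind)))
               eᵤ-type))
        where
        e′ : K ∣ T ⊢ pvar x ∙ τᵤ ∶ M (subTy (instTy ρ u) ⟦ ψ ⟧ᵀ)
        e′ = prog-subst (cong M (tyAt-[]ᵘ ρ ψ u)) (∙-type e)

-- The realizers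

⇛-wff : {S : Vec Sort m} {Ψ : Vec (Form m) n} {ψ : Form m} → S ⊢ Ψ ⇛ ψ → S ⊢ ψ wff
⇛-wff (derive _ w _) = w

all-wff : {S : Vec Sort m} → ∀ {s ψ} → S ⊢ all s ψ wff → s ∷ S ⊢ ψ wff
all-wff (all w) = w

comprehension-wff : {S : Vec Sort m} → ∀ {s ψ u} → S ⊢ u ∈′ ⁅ s ∣ ψ ⁆ wff → s ∷ S ⊢ ψ wff
comprehension-wff (mem _ (cmp w)) = w

realizer : {S : Vec Sort m} {Ψ : Vec (Form m) n} {ψ : Form m} → S ⊢ Ψ ⇛ ψ → Prog m n
realizer (derive _ _ (ident ψ∈Ψ))            = [ pvar (index ψ∈Ψ) ]
realizer (derive _ _ (⊐-I {ψ₁} d))           = [ ƛ ⟦ ψ₁ ⟧ᵀ (realizer d) ]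
-- Function and argument are both let-bound before the application, so that the argument is a
-- variable and hence a value, as `⊓-E` requires.
realizer (derive _ _ (⊐-E d₁ d₂))            =
  let′ (realizer d₁) (let′ (renProg id suc (realizer d₂)) (pvar (suc zero) · pvar zero))
realizer (derive _ _ (all-I {s} d))          = [ Λᵖ ⟦ s ⟧ᴷ (realizer d) ]
realizer (derive _ _ (all-E {u = u} d _))    = let′ (realizer d) (pvar zero ∙ ⟦ u ⟧ᵗ)
realizer (derive _ _ (∈-I _ d))              = realizer d
realizer (derive _ _ (∈-E _ d))              = realizer d
realizer (derive _ _ (⌜⌝-I d))               = realizer d
realizer (derive _ _ (⌜⌝-E d))               = realizer d

⟦renForm⟧ᵀᶜ : (Ψ : Vec (Form m) n) → ⟦ map (renForm suc) Ψ ⟧ᵀᶜ ≡ map (renTy suc) ⟦ Ψ ⟧ᵀᶜ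
⟦renForm⟧ᵀᶜ Ψ = begin
  map ⟦_⟧ᵀ (map (renForm suc) Ψ)  ≡⟨ map-∘ ⟦_⟧ᵀ (renForm suc) Ψ ⟨
  map (⟦_⟧ᵀ ∘ renForm suc) Ψ      ≡⟨ map-cong (⟦renForm⟧ᵀ suc) Ψ ⟩
  map (renTy suc ∘ ⟦_⟧ᵀ) Ψ        ≡⟨ map-∘ (renTy suc) ⟦_⟧ᵀ Ψ ⟩
  map (renTy suc) (map ⟦_⟧ᵀ Ψ)    ∎
  where open ≡.≡-Reasoning

Λᵖ-type : {S : Vec Sort m} (Ψ : Vec (Form m) n) → ∀ {s p τ} →
          ⟦ s ∷ S ⟧ᴷᶜ ∣ ⟦ map (renForm suc) Ψ ⟧ᵀᶜ ⊢ p ∶ τ → ⟦ S ⟧ᴷᶜ ∣ ⟦ Ψ ⟧ᵀᶜ ⊢ Λᵖ ⟦ s ⟧ᴷ p ∶ Π ⟦ s ⟧ᴷ τ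
Λᵖ-type Ψ e = Λᵖ (subst (_ ∣_⊢ _ ∶ _) (⟦renForm⟧ᵀᶜ Ψ) e)

realizer-type : {S : Vec Sort m} {Ψ : Vec (Form m) n} {ψ : Form m} (d : S ⊢ Ψ ⇛ ψ) →
                ⟦ S ⟧ᴷᶜ ∣ ⟦ Ψ ⟧ᵀᶜ ⊢ realizer d ∶ M ⟦ ψ ⟧ᵀ
realizer-type {Ψ = Ψ} (derive _ _ (ident ψ∈Ψ)) =
  [ pvar (≡.trans (lookup-map (index ψ∈Ψ) ⟦_⟧ᵀ Ψ) (cong ⟦_⟧ᵀ (≡.sym (lookup-index ψ∈Ψ)))) ]
realizer-type (derive _ (imp w₁ _) (⊐-I d)) = [ ƛ (form-kind w₁) (realizer-type d) ]
realizer-type (derive _ _ (⊐-E d₁ d₂)) =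
  let′ (realizer-type d₁) (let′ (wkˣ-prog (realizer-type d₂)) (pvar refl · pvar refl))
realizer-type {Ψ = Ψ} (derive _ _ (all-I d)) =
  [ Λᵖ-type Ψ (realizer-type d) ]
realizer-type (derive _ _ (all-E {ψ = ψ} {u} d du)) =
  let′ (realizer-type d) (prog-subst (cong M (≡.sym (⟦[]ᵘ⟧ᵀ ψ u))) (pvar refl ∙ tm-kind du))
realizer-type (derive _ w (∈-I {ψ = ψ} {u} _ d)) =
  conv (prog-subst (cong M (⟦[]ᵘ⟧ᵀ ψ u)) (realizer-type d)) (M (sym β)) (M (form-kind w))
realizer-type (derive _ w (∈-E {ψ = ψ} {u} _ d)) =
  conv (realizer-type d) (M (subst (⟦ ⁅ _ ∣ ψ ⁆ ⟧ᵗ ·ᵗ ⟦ u ⟧ᵗ ≡ᵗ_) (≡.sym (⟦[]ᵘ⟧ᵀ ψ u)) β)) (M (form-kind w))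
realizer-type (derive _ _ (⌜⌝-I d)) = realizer-type d
realizer-type (derive _ _ (⌜⌝-E d)) = realizer-type d

-- Interpretations of a sequent in an EffHOL context

-- Three separate maps are kept because the three classes of variables are extended at different
-- moments. Membership in `Φ`, instead of equality with the translated hypotheses, leaves room for
-- what `Mon` adds and for the extra specifications of the theorem.
record Realizes (S : Vec Sort m) (Ψ : Vec (Form m) n)
                (ρ : Fin m → Fin k) (ζ : Fin m → Fin i) (ξ : Fin n → Fin t)
                (K : Vec Kind k) (I : Vec (Idx k) i) (T : Vec (Ty k) t) (Φ : List (Spec k i t)) : Set where
  field
    ctx      : K ⊢ I ∣ T ctx
    hyps     : Allˡ (K ∣ I ∣ T ⊢_spec) Φ
    kinds    : ∀ u → lookup K (ρ u) ≡ ⟦ lookup S u ⟧ᴷ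
    idxs     : ∀ u → lookup I (ζ u) ≡ ⟦ lookup S u ⟧ᴵ (tvar (ρ u))
    types    : ∀ j → lookup T (ξ j) ≡ tyAt ρ (lookup Ψ j)
    realized : ∀ j → specIn ρ ζ (lookup Ψ j) (pvar (ξ j)) ∈ˡ Φ

open Realizes

module _ {S : Vec Sort m} {Ψ : Vec (Form m) n} {ρ : Fin m → Fin k} {ζ : Fin m → Fin i} {ξ : Fin n → Fin t}
         {K : Vec Kind k} {I : Vec (Idx k) i} {T : Vec (Ty k) t} {Φ : List (Spec k i t)}
         (r : Realizes S Ψ ρ ζ ξ K I T Φ) where

  private
    wkˣ-realized : ∀ {φ} j → specIn ρ ζ (lookup Ψ j) (pvar (suc (ξ j))) ∈ˡ φ List.∷ List.map (renSpec id id suc) Φ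
    wkˣ-realized j =
      there (subst (_∈ˡ _) (specIn-ren ρ ζ suc (lookup Ψ j) (ξ j)) (∈-map⁺ (renSpec id id suc) (r .realized j)))

  wkˣ-Realizes : ∀ {τ φ} → K ⊢ τ ∶ᵏ ⋆ → K ∣ I ∣ τ ∷ T ⊢ φ spec →
                 Realizes S Ψ ρ ζ (suc ∘ ξ) K I (τ ∷ T) (φ List.∷ List.map (renSpec id id suc) Φ)
  wkˣ-Realizes d s .ctx        = proj₁ (r .ctx) , d ∷ proj₂ (r .ctx)
  wkˣ-Realizes d s .hyps       = s Allˡ.∷ wkˣ-hyps (r .hyps)
  wkˣ-Realizes d s .kinds      = r .kinds
  wkˣ-Realizes d s .idxs       = r .idxs
  wkˣ-Realizes d s .types      = r .types
  wkˣ-Realizes d s .realized j = wkˣ-realized j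

  -- For ⊐-introduction: the new program variable realizes a new hypothesis of the sequent, hence
  -- `lift 1 ξ`. A let-bound result, as in `bindVar`, leaves `Ψ` alone and gives `suc ∘ ξ`.
  assume : ∀ {ψ} → S ⊢ ψ wff →
           Realizes S (ψ ∷ Ψ) ρ ζ (lift 1 ξ) K I (tyAt ρ ψ ∷ T)
             (specIn ρ ζ ψ (pvar zero) List.∷ List.map (renSpec id id suc) Φ)
  assume w .ctx              = proj₁ (r .ctx) , In-kind (r .kinds) (form-kind w) ∷ proj₂ (r .ctx)
  assume w .hyps             = specIn-spec (r .kinds) (r .idxs) w (pvar refl) Allˡ.∷ wkˣ-hyps (r .hyps)
  assume w .kinds            = r .kinds
  assume w .idxs             = r .idxs
  assume w .types zero       = refl
  assume w .types (suc j)    = r .types j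
  assume w .realized zero    = here refl
  assume w .realized (suc j) = wkˣ-realized j

  -- X_u and y_u enter one after the other, through `⋂-I` and `∀-I`, so the hypotheses are weakened
  -- twice. Those weakenings shift the images of the old variables, and precomposing the lifted maps
  -- with the HOL weakening has the same effect.
  wkᵘ-Realizes : ∀ {s} →
                 Realizes (s ∷ S) (map (renForm suc) Ψ) (lift 1 ρ) (lift 1 ζ) ξ
                   (⟦ s ⟧ᴷ ∷ K) (⟦ s ⟧ᴵ (tvar zero) ∷ map (renIdx suc) I) (map (renTy suc) T)
                   (List.map (renSpec id suc id) (List.map (renSpec suc id id) Φ))
  wkᵘ-Realizes {s} .ctx = ⟦⟧ᴵ-idx s (tvar refl) ∷ proj₁ (wkᵗ-ctx (r .ctx)) , proj₂ (wkᵗ-ctx (r .ctx))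
  wkᵘ-Realizes .hyps = wkʸ-hyps (wkᵗ-hyps (r .hyps))
  wkᵘ-Realizes .kinds zero    = refl
  wkᵘ-Realizes .kinds (suc u) = r .kinds u
  wkᵘ-Realizes .idxs zero     = refl
  wkᵘ-Realizes .idxs (suc u)  = begin
    lookup (map (renIdx suc) I) (ζ u)              ≡⟨ lookup-map (ζ u) (renIdx suc) I ⟩
    renIdx suc (lookup I (ζ u))                    ≡⟨ cong (renIdx suc) (r .idxs u) ⟩
    renIdx suc (⟦ lookup S u ⟧ᴵ (tvar (ρ u)))      ≡⟨ renIdx-⟦⟧ᴵ suc (lookup S u) _ ⟩
    ⟦ lookup S u ⟧ᴵ (tvar (suc (ρ u)))             ∎
    where open ≡.≡-Reasoning
  wkᵘ-Realizes .types j = begin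
    lookup (map (renTy suc) T) (ξ j)                   ≡⟨ lookup-map (ξ j) (renTy suc) T ⟩
    renTy suc (lookup T (ξ j))                         ≡⟨ cong (renTy suc) (r .types j) ⟩
    renTy suc (tyAt ρ (lookup Ψ j))                    ≡⟨ renTy-subTy (λ _ → refl) ⟦ lookup Ψ j ⟧ᵀ ⟩
    subTy (λ u → tvar (suc (ρ u))) ⟦ lookup Ψ j ⟧ᵀ     ≡⟨ subTy-⟦renForm⟧ᵀ (λ _ → refl) (lookup Ψ j) ⟨
    tyAt (lift 1 ρ) (renForm suc (lookup Ψ j))         ≡⟨ cong (tyAt (lift 1 ρ)) (lookup-map j (renForm suc) Ψ) ⟨
    tyAt (lift 1 ρ) (lookup (map (renForm suc) Ψ) j)   ∎
    where open ≡.≡-Reasoning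
  wkᵘ-Realizes .realized j =
    subst (_∈ˡ _) eq (∈-map⁺ (renSpec id suc id) (∈-map⁺ (renSpec suc id id) (r .realized j)))
    where
    open ≡.≡-Reasoning
    ψ = lookup Ψ j
    x = ξ j
    eq : renSpec id suc id (renSpec suc id id (specIn ρ ζ ψ (pvar x))) ≡
         specIn (lift 1 ρ) (lift 1 ζ) (lookup (map (renForm suc) Ψ) j) (pvar x)
    eq = begin
      renSpec id suc id (renSpec suc id id (specIn ρ ζ ψ (pvar x)))
        ≡⟨ cong (renSpec id suc id)
             (specAt-ren id (λ _ → refl) (λ _ → refl) (λ _ → refl) (λ _ → refl) ψ x) ⟩
      renSpec id suc id (specIn (suc ∘ ρ) ζ ψ (pvar x))
        ≡⟨ specAt-ren id (λ _ → refl) (λ _ → refl) (λ _ → refl) (λ _ → refl) ψ x ⟩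
      specIn (suc ∘ ρ) (suc ∘ ζ) ψ (pvar x)
        ≡⟨ specAt-renForm (λ _ → refl) (λ _ → refl) ψ (pvar x) ⟨
      specIn (lift 1 ρ) (lift 1 ζ) (renForm suc ψ) (pvar x)
        ≡⟨ cong (λ ψ′ → specIn (lift 1 ρ) (lift 1 ζ) ψ′ (pvar x)) (lookup-map j (renForm suc) Ψ) ⟨
      specIn (lift 1 ρ) (lift 1 ζ) (lookup (map (renForm suc) Ψ) j) (pvar x) ∎

  -- Realizers are transported by renaming, but types by substituting variables, the form that
  -- `specAt` uses; `subTy-var` identifies the two.
  In-type : ∀ {p τ} → ⟦ S ⟧ᴷᶜ ∣ ⟦ Ψ ⟧ᵀᶜ ⊢ p ∶ τ → K ∣ T ⊢ renProg ρ ξ p ∶ subTy (tvar ∘ ρ) τ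
  In-type {τ = τ} d = prog-subst (≡.sym (subTy-var (λ _ → refl) τ))
    (renProg-type (λ u → ≡.trans (r .kinds u) (≡.sym (lookup-map u ⟦_⟧ᴷ S)))
      (renT λ j → ≡.trans (r .types j)
        (≡.trans (subTy-var (λ _ → refl) _) (cong (renTy ρ) (≡.sym (lookup-map j ⟦_⟧ᵀ Ψ))))) d)

  form-spec : ∀ {ψ p} → S ⊢ ψ wff → K ∣ T ⊢ p ∶ tyAt ρ ψ → K ∣ I ∣ T ⊢ specIn ρ ζ ψ p spec
  form-spec = specIn-spec (r .kinds) (r .idxs)

  var-spec : ∀ {ψ} → S ⊢ ψ wff → K ∣ I ∣ tyAt ρ ψ ∷ T ⊢ specIn ρ ζ ψ (pvar zero) spec
  var-spec w = specIn-spec (r .kinds) (r .idxs) w (pvar refl)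

  bindVar : ∀ {ψ} → S ⊢ ψ wff →
            Realizes S Ψ ρ ζ (suc ∘ ξ) K I (tyAt ρ ψ ∷ T)
              (specIn ρ ζ ψ (pvar zero) List.∷ List.map (renSpec id id suc) Φ)
  bindVar w = wkˣ-Realizes (In-kind (r .kinds) (form-kind w)) (var-spec w)

  hyp : ∀ {φ} → K ∣ I ∣ T ⊢ φ spec → φ ∈ˡ Φ → K ∣ I ∣ T ⊢ Φ ⇒ φ
  hyp s φ∈Φ = derive (r .ctx) (r .hyps) s (ident φ∈Φ)

  ⟨⟩-red : ∀ {ψ p₁ p₂} → S ⊢ ψ wff → K ∣ T ⊢ p₁ ∶ M (tyAt ρ ψ) → p₁ ⇝ p₂ →
           K ∣ I ∣ T ⊢ Φ ⇒ ⟨ p₂ ⟩ specIn ρ ζ ψ (pvar zero) → K ∣ I ∣ T ⊢ Φ ⇒ ⟨ p₁ ⟩ specIn ρ ζ ψ (pvar zero)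
  ⟨⟩-red {ψ} {p₁} {p₂} w e p₁⇝p₂ D = next D (⟨ e ⟩ var-spec w)
    -- `red` rewrites only a program substituted for a variable x, so the modality is presented as
    -- `⟨ x ⟩` with x not free in the translated proposition.
    (⇒ʳ-subst (eq p₁) (red {φ = ⟨ pvar zero ⟩ specIn ρ ζ ψ (pvar zero)} (⇒-subst (≡.sym (eq p₂)) D) p₁⇝p₂))
    where
    eq : ∀ p → (⟨ pvar zero ⟩ specIn ρ ζ ψ (pvar zero)) [ p ]ˣ ≡ ⟨ p ⟩ specIn ρ ζ ψ (pvar zero)
    eq p = cong (⟨ p ⟩_) (specAt-sub _ (λ _ → refl) (λ _ → refl) (λ _ → refl) ψ zero)

  return : ∀ {ψ p} → S ⊢ ψ wff → K ∣ T ⊢ p ∶ tyAt ρ ψ →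
           K ∣ I ∣ T ⊢ Φ ⇒ specIn ρ ζ ψ p → K ∣ I ∣ T ⊢ Φ ⇒ ⟨ [ p ] ⟩ specIn ρ ζ ψ (pvar zero)
  return {ψ} {p} w e D = next D (⟨ [ e ] ⟩ var-spec w) (Mod-I (⇒-subst (≡.sym (specIn-[]ˣ ρ ζ ψ p)) D))

  ⊐-intro : ∀ {ψ₁ ψ₂ p} → K ∣ I ∣ T ⊢ specIn ρ ζ (ψ₁ ⊐ ψ₂) p spec →
            K ∣ I ∣ tyAt ρ ψ₁ ∷ T ⊢ specIn ρ ζ ψ₁ (pvar zero) List.∷ List.map (renSpec id id suc) Φ
              ⇒ ⟨ renProg id suc p · pvar zero ⟩ specIn ρ ζ ψ₂ (pvar zero) →
            K ∣ I ∣ T ⊢ Φ ⇒ specIn ρ ζ (ψ₁ ⊐ ψ₂) p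
  ⊐-intro (⊓ d s) D =
    derive (r .ctx) (r .hyps) (⊓ d s) (⊓-I (derive (⇒-ctx D) (wkˣ-hyps (r .hyps)) s (⊃-I D)))

  ⊐-elim : ∀ {ψ₁ ψ₂ f x} → S ⊢ ψ₂ wff → K ∣ T ⊢ pvar f ∶ tyAt ρ (ψ₁ ⊐ ψ₂) → K ∣ T ⊢ pvar x ∶ tyAt ρ ψ₁ →
           K ∣ I ∣ T ⊢ Φ ⇒ specIn ρ ζ (ψ₁ ⊐ ψ₂) (pvar f) → K ∣ I ∣ T ⊢ Φ ⇒ specIn ρ ζ ψ₁ (pvar x) →
           K ∣ I ∣ T ⊢ Φ ⇒ ⟨ pvar f · pvar x ⟩ specIn ρ ζ ψ₂ (pvar zero)
  ⊐-elim {ψ₁} {ψ₂} {f} {x} w ef ex Df Dx = next Dx s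
    (⊃-E (next Df (⇒-spec Dx ⊃ s) (⇒ʳ-subst eq (⊓-E Df pvar ex))) Dx)
    where
    s : K ∣ I ∣ T ⊢ ⟨ pvar f · pvar x ⟩ specIn ρ ζ ψ₂ (pvar zero) spec
    s = ⟨ ef · ex ⟩ var-spec w
    eq : (specIn ρ ζ ψ₁ (pvar zero) ⊃ ⟨ pvar (suc f) · pvar zero ⟩ specIn ρ ζ ψ₂ (pvar zero)) [ pvar x ]ˣ ≡
         (specIn ρ ζ ψ₁ (pvar x) ⊃ ⟨ pvar f · pvar x ⟩ specIn ρ ζ ψ₂ (pvar zero))
    eq = cong₂ (λ φ₁ φ₂ → φ₁ ⊃ ⟨ pvar f · pvar x ⟩ φ₂) (specIn-[]ˣ ρ ζ ψ₁ (pvar x))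
      (specAt-sub _ (λ _ → refl) (λ _ → refl) (λ _ → refl) ψ₂ zero)

  all-intro : ∀ {s ψ p} → K ∣ I ∣ T ⊢ specIn ρ ζ (all s ψ) p spec →
              ⟦ s ⟧ᴷ ∷ K ∣ ⟦ s ⟧ᴵ (tvar zero) ∷ map (renIdx suc) I ∣ map (renTy suc) T
                ⊢ List.map (renSpec id suc id) (List.map (renSpec suc id id) Φ)
                ⇒ ⟨ renProg suc id p ∙ tvar zero ⟩ specIn (lift 1 ρ) (lift 1 ζ) ψ (pvar zero) →
              K ∣ I ∣ T ⊢ Φ ⇒ specIn ρ ζ (all s ψ) p
  all-intro {ψ = ψ} (⋂ s) D = derive (r .ctx) (r .hyps) (⋂ s)
    -- The assignment produced by the translation and the one built from `lift 1 ρ` and `lift 1 ζ`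
    -- agree only pointwise, hence `specAt-cong`.
    (⋂-I (derive (wkᵗ-ctx (r .ctx)) (wkᵗ-hyps (r .hyps)) s (∀-I (⇒-subst (cong (⟨ _ ⟩_)
      (specAt-cong (λ { zero → refl ; (suc _) → refl }) (λ { zero → refl ; (suc _) → refl }) ψ (pvar zero))) D))))

-- Quantifying over all target contexts lets the induction hypotheses be used
-- under binders, so that weakening of EffHOL derivations is not needed.
sound : {S : Vec Sort m} {Ψ : Vec (Form m) n} {ψ : Form m} (d : S ⊢ Ψ ⇛ ψ) →
        {ρ : Fin m → Fin k} {ζ : Fin m → Fin i} {ξ : Fin n → Fin t}
        {K : Vec Kind k} {I : Vec (Idx k) i} {T : Vec (Ty k) t} {Φ : List (Spec k i t)} →
        Realizes S Ψ ρ ζ ξ K I T Φ →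
        K ∣ I ∣ T ⊢ Φ ⇒ ⟨ renProg ρ ξ (realizer d) ⟩ specIn ρ ζ ψ (pvar zero)
sound {ψ = ψ} (derive _ w (ident ψ∈Ψ)) {ρ} {ζ} {ξ} {T = T} r =
  return r w e (hyp r (form-spec r w e)
    (subst (λ ψ′ → specIn ρ ζ ψ′ (pvar (ξ j)) ∈ˡ _) (≡.sym (lookup-index ψ∈Ψ)) (r .realized j)))
  where
  j = index ψ∈Ψ
  e : _ ∣ T ⊢ pvar (ξ j) ∶ tyAt ρ ψ
  e = pvar (≡.trans (r .types j) (cong (tyAt ρ) (≡.sym (lookup-index ψ∈Ψ))))
sound (derive _ w@(imp w₁ w₂) (⊐-I {ψ₁} d)) {ρ} {ξ = ξ} r =
  return r w e (⊐-intro r (form-spec r w e)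
    (⟨⟩-red r₁ w₂ (wkˣ-prog e · pvar refl)
      (subst (renProg id suc (renProg ρ ξ (ƛ ⟦ ψ₁ ⟧ᵀ (realizer d))) · pvar zero ⇝_) eq (ƛ-β pvar)) (sound d r₁)))
  where
  r₁ = assume r w₁
  e = In-type r (ƛ (form-kind w₁) (realizer-type d))
  eq = subProg-retract (λ _ → refl) (λ { zero → refl ; (suc _) → refl }) (renProg ρ (lift 1 ξ) (realizer d))
sound (derive _ w (⊐-E {ψ₁} {ψ₂} d₁ d₂)) {ρ} {ζ} {ξ} r =
  bind (In-type r (realizer-type d₁)) (sound d₁ r)
    (let′ e₂ (pvar refl · pvar refl))
    (⇒-subst (cong (⟨ _ ⟩_) (≡.sym (specIn-ren ρ ζ (lift 1 suc) ψ₂ zero)))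
      (bind e₂ D₂ (pvar refl · pvar refl)
        (⇒-subst (cong (⟨ _ ⟩_) (≡.sym (specIn-ren ρ ζ (lift 1 suc) ψ₂ zero)))
          (⊐-elim r₂ {ψ₁ = ψ₁} w (pvar refl) (pvar refl)
            (hyp r₂ (form-spec r₂ w₁₂ (pvar refl)) (there (here (≡.sym (specIn-ren ρ ζ suc (ψ₁ ⊐ ψ₂) zero)))))
            (hyp r₂ (form-spec r₂ (⇛-wff d₂) (pvar refl)) (here refl))))
        (var-spec r₁ w)))
    (var-spec r w)
  where
  w₁₂ = ⇛-wff d₁
  r₁ = bindVar r w₁₂
  r₂ = bindVar r₁ (⇛-wff d₂)
  -- The induction hypothesis for `d₂` is used after the function has been bound, with all images
  -- shifted past it, whereas the realizer weakens `realizer d₂` explicitly.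
  eq : renProg ρ (suc ∘ ξ) (realizer d₂) ≡ renProg ρ (lift 1 ξ) (renProg id suc (realizer d₂))
  eq = ≡.sym (renProg-∘ (λ _ → refl) (λ _ → refl) (realizer d₂))
  e₂ = subst (_ ∣ _ ⊢_∶ _) eq (In-type r₁ (realizer-type d₂))
  D₂ = ⇒-subst (cong (⟨_⟩ specIn ρ ζ ψ₁ (pvar zero)) eq) (sound d₂ r₁)
sound {Ψ = Ψ} (derive _ w@(all w₁) (all-I {s} {ψ} d)) {ρ} {ξ = ξ} r =
  return r w e (all-intro r {ψ = ψ} (form-spec r w e)
    (⟨⟩-red r₁ w₁ (prog-subst (cong M eqᵀ) (wkᵗ-prog e ∙ tvar refl))
      (subst (renProg suc id (renProg ρ ξ (Λᵖ ⟦ s ⟧ᴷ (realizer d))) ∙ tvar zero ⇝_) eq Λ-β) (sound d r₁)))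
  where
  r₁ = wkᵘ-Realizes r
  e = In-type r (Λᵖ-type Ψ (realizer-type d))
  eq = subProg-retract (λ { zero → refl ; (suc _) → refl }) (λ _ → refl) (renProg (lift 1 ρ) ξ (realizer d))
  eqᵀ : renTy (lift 1 suc) (subTy (liftTy (tvar ∘ ρ)) ⟦ ψ ⟧ᵀ) [ tvar zero ]ᵗ ≡ tyAt (lift 1 ρ) ψ
  eqᵀ = ≡.trans (lift-suc-[]ᵗ _) (subTy-cong (λ { zero → refl ; (suc _) → refl }) ⟦ ψ ⟧ᵀ)
sound (derive _ w (all-E {s} {ψ} {u} d du)) {ρ} {ζ} {K = K} {I} {T} r =
  bind (In-type r (realizer-type d)) (sound d r)
    (subst (λ τ → K ∣ _ ∷ T ⊢ pvar zero ∙ τ ∶ M (tyAt ρ (ψ [ u ]ᵘ))) eq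
      (∙-type {I = I} {ζ = ζ} (r₁ .kinds) (r₁ .idxs) wψ du w (pvar refl)))
    (⇒-subst (cong₂ (λ τ φ → ⟨ pvar zero ∙ τ ⟩ φ) eq (≡.sym (specIn-ren ρ ζ (lift 1 suc) (ψ [ u ]ᵘ) zero)))
      (all-elim (r₁ .kinds) (r₁ .idxs) wψ du w (pvar refl) (hyp r₁ (form-spec r₁ w₁ (pvar refl)) (here refl))))
    (var-spec r w)
  where
  w₁ = ⇛-wff d
  wψ = all-wff w₁
  r₁ = bindVar r w₁
  eq = subTy-var (λ _ → refl) ⟦ u ⟧ᵗ
sound d₀@(derive _ w (∈-I du d)) r =
  -- `d₀` and `d` have the same realizer at two convertible types: `Mon` binds the result at the
  -- type of the premise, while the conclusion is checked at its own.
  next D (⟨ In-type r (realizer-type d₀) ⟩ var-spec r w)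
    (Mon (In-type r (realizer-type d))
      (∈-intro (r₁ .kinds) (r₁ .idxs) (comprehension-wff w) du w₁ (pvar refl)
        (hyp r₁ (form-spec r₁ w₁ (pvar refl)) (here refl))) D)
  where
  D = sound d r
  w₁ = ⇛-wff d
  r₁ = bindVar r w₁
sound d₀@(derive _ w (∈-E du d)) r =
  next D (⟨ In-type r (realizer-type d₀) ⟩ var-spec r w)
    (Mon (In-type r (realizer-type d))
      (∈-elim (r₁ .kinds) (r₁ .idxs) (comprehension-wff w₁) du w (pvar refl)
        (hyp r₁ (form-spec r₁ w₁ (pvar refl)) (here refl))) D)
  where
  D = sound d r
  w₁ = ⇛-wff d
  r₁ = bindVar r w₁
sound d₀@(derive _ w (⌜⌝-I {ψ} d)) {ρ} {ζ} r =
  next D (⟨ In-type r (realizer-type d₀) ⟩ var-spec r w)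
    (Mon (In-type r (realizer-type d))
      (next H (form-spec r₁ w (pvar refl)) (Mem₀-I (⇒-subst (≡.sym (specIn-[]ˣ ρ ζ ψ (pvar zero))) H))) D)
  where
  D = sound d r
  w₁ = ⇛-wff d
  r₁ = bindVar r w₁
  H = hyp r₁ (form-spec r₁ w₁ (pvar refl)) (here refl)
sound {ψ = ψ} d₀@(derive _ w (⌜⌝-E d)) {ρ} {ζ} r =
  next D (⟨ In-type r (realizer-type d₀) ⟩ var-spec r w)
    (Mon (In-type r (realizer-type d))
      (next H (form-spec r₁ w (pvar refl)) (⇒ʳ-subst (specIn-[]ˣ ρ ζ ψ (pvar zero)) (Mem₀-E H))) D)
  where
  D = sound d r
  w₁ = ⇛-wff d
  r₁ = bindVar r w₁
  H = hyp r₁ (form-spec r₁ w₁ (pvar refl)) (here refl)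

-- Specialization to the concatenated contexts

⟦⟧ˢ-ren : (ρ : Fin m → Fin k) (ζ : Fin m → Fin i) (ξ : Fin t → Fin t′) → ∀ ψ x →
          renSpec ρ ζ ξ (⟦ ψ ⟧ˢ (pvar x)) ≡ specIn ρ ζ ψ (pvar (ξ x))
⟦⟧ˢ-ren ρ ζ ξ ψ x = ≡.trans
  -- Renaming has been analysed for `specAt`, so the translation is first presented as its value at
  -- the identity assignments.
  (cong (renSpec ρ ζ ξ) (≡.sym (specAt-id (λ _ → refl) (λ _ → refl) ψ (pvar x))))
  (specAt-ren ξ (λ _ → refl) (λ _ → refl) (λ _ → refl) (λ _ → refl) ψ x)

lookup-⟦⟧ᴵᶜ : (S : Vec Sort m) → ∀ u → lookup ⟦ S ⟧ᴵᶜ u ≡ ⟦ lookup S u ⟧ᴵ (tvar u)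
lookup-⟦⟧ᴵᶜ (s ∷ S) zero    = refl
lookup-⟦⟧ᴵᶜ (s ∷ S) (suc u) = begin
  lookup (map (renIdx suc) ⟦ S ⟧ᴵᶜ) u    ≡⟨ lookup-map u (renIdx suc) ⟦ S ⟧ᴵᶜ ⟩
  renIdx suc (lookup ⟦ S ⟧ᴵᶜ u)          ≡⟨ cong (renIdx suc) (lookup-⟦⟧ᴵᶜ S u) ⟩
  renIdx suc (⟦ lookup S u ⟧ᴵ (tvar u))  ≡⟨ renIdx-⟦⟧ᴵ suc (lookup S u) (tvar u) ⟩
  ⟦ lookup S u ⟧ᴵ (tvar (suc u))         ∎
  where open ≡.≡-Reasoning

⟦⟧ᴵᶜ-idx : (S : Vec Sort m) → All (⟦ S ⟧ᴷᶜ ⊢_idx) ⟦ S ⟧ᴵᶜ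
⟦⟧ᴵᶜ-idx []      = []
⟦⟧ᴵᶜ-idx (s ∷ S) = ⟦⟧ᴵ-idx s (tvar refl) ∷ All-map⁺ (All.map (renIdx-idx λ _ → refl) (⟦⟧ᴵᶜ-idx S))

module _ {S : Vec Sort m} {Ψ : Vec (Form m) n} (wΨ : All (S ⊢_wff) Ψ)
         {K : Vec Kind k} {I : Vec (Idx k) i} {T : Vec (Ty k) t} {Φ : List (Spec k i t)}
         (cIT : K ⊢ I ∣ T ctx) (sΦ : Allˡ (K ∣ I ∣ T ⊢_spec) Φ) where

  private
    lookup-ˡ : ∀ X → lookup (K ++ ⟦ S ⟧ᴷᶜ) (X ↑ˡ m) ≡ lookup K X
    lookup-ˡ = lookup-++ˡ K ⟦ S ⟧ᴷᶜ

    lookup-ʳ : ∀ X → lookup (K ++ ⟦ S ⟧ᴷᶜ) (k ↑ʳ X) ≡ lookup ⟦ S ⟧ᴷᶜ X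
    lookup-ʳ = lookup-++ʳ K ⟦ S ⟧ᴷᶜ

    kinds′ : ∀ u → lookup (K ++ ⟦ S ⟧ᴷᶜ) (k ↑ʳ u) ≡ ⟦ lookup S u ⟧ᴷ
    kinds′ u = ≡.trans (lookup-ʳ u) (lookup-map u ⟦_⟧ᴷ S)

    idxs′ : ∀ u → lookup (⟦ S ⟧ᴵᶜ ,ᴵ I) (i ↑ʳ u) ≡ ⟦ lookup S u ⟧ᴵ (tvar (k ↑ʳ u))
    idxs′ u = begin
      lookup (⟦ S ⟧ᴵᶜ ,ᴵ I) (i ↑ʳ u)
        ≡⟨ lookup-++ʳ (map (renIdx (_↑ˡ m)) I) (map (renIdx (k ↑ʳ_)) ⟦ S ⟧ᴵᶜ) u ⟩
      lookup (map (renIdx (k ↑ʳ_)) ⟦ S ⟧ᴵᶜ) u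
        ≡⟨ lookup-map u (renIdx (k ↑ʳ_)) ⟦ S ⟧ᴵᶜ ⟩
      renIdx (k ↑ʳ_) (lookup ⟦ S ⟧ᴵᶜ u)
        ≡⟨ cong (renIdx (k ↑ʳ_)) (lookup-⟦⟧ᴵᶜ S u) ⟩
      renIdx (k ↑ʳ_) (⟦ lookup S u ⟧ᴵ (tvar u))
        ≡⟨ renIdx-⟦⟧ᴵ (k ↑ʳ_) (lookup S u) (tvar u) ⟩
      ⟦ lookup S u ⟧ᴵ (tvar (k ↑ʳ u)) ∎
      where open ≡.≡-Reasoning

    types′ : ∀ j → lookup (⟦ Ψ ⟧ᵀᶜ ,ᵀ T) (t ↑ʳ j) ≡ tyAt (k ↑ʳ_) (lookup Ψ j)
    types′ j = begin
      lookup (⟦ Ψ ⟧ᵀᶜ ,ᵀ T) (t ↑ʳ j)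
        ≡⟨ lookup-++ʳ (map (renTy (_↑ˡ m)) T) (map (renTy (k ↑ʳ_)) ⟦ Ψ ⟧ᵀᶜ) j ⟩
      lookup (map (renTy (k ↑ʳ_)) ⟦ Ψ ⟧ᵀᶜ) j
        ≡⟨ lookup-map j (renTy (k ↑ʳ_)) ⟦ Ψ ⟧ᵀᶜ ⟩
      renTy (k ↑ʳ_) (lookup ⟦ Ψ ⟧ᵀᶜ j)
        ≡⟨ cong (renTy (k ↑ʳ_)) (lookup-map j ⟦_⟧ᵀ Ψ) ⟩
      renTy (k ↑ʳ_) ⟦ lookup Ψ j ⟧ᵀ
        ≡⟨ subTy-var (λ _ → refl) ⟦ lookup Ψ j ⟧ᵀ ⟨
      tyAt (k ↑ʳ_) (lookup Ψ j) ∎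
      where open ≡.≡-Reasoning

    Φ-RenI : RenI (_↑ˡ m) (_↑ˡ m) I (⟦ S ⟧ᴵᶜ ,ᴵ I)
    Φ-RenI = renI λ y → ≡.trans
      (lookup-++ˡ (map (renIdx (_↑ˡ m)) I) (map (renIdx (k ↑ʳ_)) ⟦ S ⟧ᴵᶜ) y)
      (lookup-map y (renIdx (_↑ˡ m)) I)

    Φ-RenT : RenT (_↑ˡ m) (_↑ˡ n) T (⟦ Ψ ⟧ᵀᶜ ,ᵀ T)
    Φ-RenT = renT λ x → ≡.trans
      (lookup-++ˡ (map (renTy (_↑ˡ m)) T) (map (renTy (k ↑ʳ_)) ⟦ Ψ ⟧ᵀᶜ) x)
      (lookup-map x (renTy (_↑ˡ m)) T)

  -- The three maps are the right injections, since the translated declarations come before `K`, `I`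
  -- and `T`. The specifications in `Φ` only enlarge the pool of hypotheses.
  extended-Realizes : Realizes S Ψ (k ↑ʳ_) (i ↑ʳ_) (t ↑ʳ_)
    (⟦ S ⟧ᴷᶜ ,ᴷ K) (⟦ S ⟧ᴵᶜ ,ᴵ I) (⟦ Ψ ⟧ᵀᶜ ,ᵀ T) (⟦ Ψ ⟧ˢᶜ ,ˢ Φ)
  extended-Realizes .ctx =
    All-++⁺ (All-map⁺ (All.map (renIdx-idx lookup-ˡ) (proj₁ cIT)))
            (All-map⁺ (All.map (renIdx-idx lookup-ʳ) (⟦⟧ᴵᶜ-idx S))) ,
    All-++⁺ (All-map⁺ (All.map (renTy-kind lookup-ˡ) (proj₂ cIT)))
            (All-map⁺ (All-map⁺ (All.map (λ w → renTy-kind lookup-ʳ (form-kind w)) wΨ)))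
  extended-Realizes .hyps =
    Allˡ-++⁺ (Allˡ-map⁺ (toList⁺ (tabulate⁺ λ j →
               subst (_ ∣ _ ∣ _ ⊢_spec) (≡.sym (⟦⟧ˢ-ren _ _ (t ↑ʳ_) (lookup Ψ j) j))
                 (specIn-spec kinds′ idxs′ (lookup⁺ wΨ j) (pvar (types′ j))))))
             (Allˡ-map⁺ (Allˡ.map (renSpec-spec lookup-ˡ Φ-RenI Φ-RenT) sΦ))
  extended-Realizes .kinds = kinds′
  extended-Realizes .idxs  = idxs′
  extended-Realizes .types = types′
  extended-Realizes .realized j =
    ∈-++⁺ˡ (subst (_∈ˡ _) (⟦⟧ˢ-ren _ _ (t ↑ʳ_) (lookup Ψ j) j)
      (∈-map⁺ (injˡ k i t) (∈-toList⁺ (∈-tabulate⁺ (λ j → ⟦ lookup Ψ j ⟧ˢ (pvar j)) j))))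

theorem5 : ∀ {m n} (S : Vec Sort m) (Ψ : Vec (Form m) n) (ψ : Form m) →
    S ⊢ Ψ ⇛ ψ →
    Σ[ p ∈ Prog m n ]
    (⟦ S ⟧ᴷᶜ ∣ ⟦ Ψ ⟧ᵀᶜ ⊢ p ∶ M ⟦ ψ ⟧ᵀ) ×
    (∀ {k i t} (K : Vec Kind k) (I : Vec (Idx k) i) (T : Vec (Ty k) t) (Φ : List (Spec k i t)) →
    K ⊢ I ∣ T ctx →
    Allˡ (K ∣ I ∣ T ⊢_spec) Φ →
    ⟦ S ⟧ᴷᶜ ,ᴷ K ∣ ⟦ S ⟧ᴵᶜ ,ᴵ I ∣ ⟦ Ψ ⟧ᵀᶜ ,ᵀ T
    ⊢ ⟦ Ψ ⟧ˢᶜ ,ˢ Φ ⇒ injˡ k i t (⟨ p ⟩ ⟦ ψ ⟧ˢ (pvar zero)))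
theorem5 S Ψ ψ d@(derive wΨ _ _) = realizer d , realizer-type d , λ {k} {i} {t} K I T Φ cIT sΦ →
  -- Below the modality `injˡ` acts on program variables as `lift 1 (t ↑ʳ_)`, which fixes the result
  -- variable.
  ⇒-subst (cong (⟨ _ ⟩_) (≡.sym (⟦⟧ˢ-ren (k ↑ʳ_) (i ↑ʳ_) (lift 1 (t ↑ʳ_)) ψ zero)))
    (sound d (extended-Realizes wΨ cIT sΦ))
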